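{- Let $q\equiv 1\pmod 4$, $q\not\equiv 1 \pmod 3$, and let $G$, $\bm{p}$, $\pi$ be as in the context, with $G$ viewed as a collineation group of $\mathrm{PG}(3,q)$ via the Klein correspondence. The orbits of $G$ on the points of $\mathrm{PG}(3,q)$ are: (i) $\{\bm{p}\}$ ($\bm{p}$ is fixed); (ii) the set of points of $\pi$, forming a single orbit of size $q^2+q+1$; (iii) the remaining points, which fall into four orbits, each of size $\frac{q-1}{4}(q^2+q+1)$.
   Context: $\mathbb{F}=\mathbb{F}_q$, $\mathbb{E}=\mathbb{F}_{q^3}$, $\mathrm{T}(x)=x+x^q+x^{q^2}$. Fix a primitive element $\alpha$ of $\mathbb{E}$, put $\omega=\alpha^{q^2+q+1}$ and $\mu=\alpha^{q-1}$. On $V=\mathbb{E}^2$ (an $\mathbb{F}$-space of dimension 6) take the quadratic form $\mathrm{Q}((u,v))=\mathrm{T}(uv)$, whose quadric is a hyperbolic quadric $\mathcal{Q}^+(5,q)$ in $\mathrm{PG}(5,q)$, with disjoint generators $\pi_1=\{\langle(x,0)\rangle : x\in\mathbb{E}^*\}$ and $\pi_2=\{\langle(0,y)\rangle: y\in\mathbb{E}^*\}$. Let $G=\langle c,z\rangle$ where $c:(u,v)\mapsto(\mu u,\mu^{ -1}v)$ and $z:(u,v)\mapsto(u,\omega^4v)$; these fix $\pi_1$ and $\pi_2$ and thus preserve each system of generators. Fix a Klein correspondence, i.e. a bijection from the points of the quadric to the lines of $\mathrm{PG}(3,q)$ such that points are collinear on the quadric iff the image lines meet, chosen so that $\pi_1$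 is mapped to the set of lines through a point $\bm{p}$ and $\pi_2$ to the set of lines in a plane $\pi$; via this correspondence $G$ acts as a collineation group of $\mathrm{PG}(3,q)$. -}

module Defs where

open import Level using (0ℓ)
open import Data.Nat as ℕ using (ℕ; zero; suc)
open import Data.Fin using (Fin)
open import Data.Product using (Σ; ∃; _×_; _,_)
open import Relation.Binary.PropositionalEquality using (_≡_; _≢_)
open import Relation.Nullary using (¬_)
open import Algebra.Core using (Op₁; Op₂)
open import Algebra.Structures using (IsCommutativeRing)
open import Function.Bundles using (_↔_; _⇔_)

record FiniteField (q : ℕ) : Set₁ where
  infixl 7 _*_
  infixl 6 _+_
  field
    Carrier           : Set
    _+_ _*_           : Op₂ Carrier
    -_                : Op₁ Carrier
    0# 1#             : Carrier
    isCommutativeRing : IsCommutativeRing _≡_ _+_ _*_ -_ 0# 1#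
    0≢1               : 0# ≢ 1#
    _⁻¹               : Op₁ Carrier
    ⁻¹-inverse        : ∀ x → x ≢ 0# → x * (x ⁻¹) ≡ 1#
    enum              : Carrier ↔ Fin q

  pow : Carrier → ℕ → Carrier
  pow x zero    = 1#
  pow x (suc n) = x * pow x n

Primitive : ∀ {Q} (E : FiniteField Q) → FiniteField.Carrier E → Set
Primitive E α = ∀ x → x ≢ 0# → ∃ λ n → pow α n ≡ x
  where open FiniteField E

record Embedding {q Q} (F : FiniteField q) (E : FiniteField Q) : Set where
  private
    module F = FiniteField F
    module E = FiniteField E
  field
    ι     : F.Carrier → E.Carrier
    ι-+   : ∀ a b → ι (a F.+ b) ≡ ι a E.+ ι b
    ι-*   : ∀ a b → ι (a F.* b) ≡ ι a E.* ι b
    ι-1   : ι F.1# ≡ E.1#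
    ι-inj : ∀ a b → ι a ≡ ι b → a ≡ b

module Geometry {q : ℕ} (F : FiniteField q) (E : FiniteField (q ℕ.^ 3))
                (emb : Embedding F E) where
  module F = FiniteField F
  module E = FiniteField E
  open Embedding emb

  V : Set
  V = E.Carrier × E.Carrier

  T : E.Carrier → E.Carrier
  T x = x E.+ E.pow x q E.+ E.pow x (q ℕ.* q)

  Qf : V → E.Carrier
  Qf (u , v) = T (u E.* v)

  _·V_ : F.Carrier → V → V
  a ·V (u , v) = (ι a E.* u , ι a E.* v)

  _+V_ : V → V → V
  (u , v) +V (u' , v') = (u E.+ u' , v E.+ v')

  NonzeroV : V → Set
  NonzeroV x = x ≢ (E.0# , E.0#)

  PropV : V → V → Set
  PropV x y = ∃ λ a → a ≢ F.0# × y ≡ a ·V x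

  -- projective point of the quadric Q⁺(5,q)
  QPt : V → Set
  QPt x = NonzeroV x × Qf x ≡ E.0#

  CollinearQ : V → V → Set
  CollinearQ x y = ∀ a b → Qf ((a ·V x) +V (b ·V y)) ≡ E.0#

  W : Set
  W = Fin 4 → F.Carrier

  NonzeroW : W → Set
  NonzeroW P = ¬ (∀ i → P i ≡ F.0#)

  PropW : W → W → Set
  PropW P P' = ∃ λ a → a ≢ F.0# × (∀ i → P' i ≡ a F.* P i)

  -- a line of PG(3,q), given by two spanning vectors
  Line : Set
  Line = W × W

  Independent : Line → Set
  Independent (a , b) =
    ∀ s t → (∀ i → s F.* a i F.+ t F.* b i ≡ F.0#) → s ≡ F.0# × t ≡ F.0#

  OnLine : W → Line → Set
  OnLine P (a , b) =
    NonzeroW P × ∃ λ s → ∃ λ t → ∀ i → P i ≡ s F.* a i F.+ t F.* b i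

  SameLine : Line → Line → Set
  SameLine L M = ∀ P → OnLine P L ⇔ OnLine P M

  Meet : Line → Line → Set
  Meet L M = ∃ λ P → OnLine P L × OnLine P M

  InPlane : W → W → Set
  InPlane h P = NonzeroW P ×
    (h Fin0 F.* P Fin0 F.+ h Fin1 F.* P Fin1 F.+ h Fin2 F.* P Fin2
       F.+ h Fin3 F.* P Fin3 ≡ F.0#)
    where
    open import Data.Fin using (zero; suc)
    Fin0 Fin1 Fin2 Fin3 : Fin 4
    Fin0 = zero
    Fin1 = suc zero
    Fin2 = suc (suc zero)
    Fin3 = suc (suc (suc zero))

  record Klein (p h : W) : Set where
    field
      κ        : V → Line
      indep    : ∀ x → QPt x → Independent (κ x)
      wellDef  : ∀ x y → QPt x → QPt y → PropV x y → SameLine (κ x) (κ y)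
      inj      : ∀ x y → QPt x → QPt y → SameLine (κ x) (κ y) → PropV x y
      surj     : ∀ L → Independent L → ∃ λ x → QPt x × SameLine (κ x) L
      collin   : ∀ x y → QPt x → QPt y → (CollinearQ x y ⇔ Meet (κ x) (κ y))
      π₁→p     : ∀ u → u ≢ E.0# → OnLine p (κ (u , E.0#))
      p→π₁     : ∀ L → Independent L → OnLine p L →
                 ∃ λ u → u ≢ E.0# × SameLine (κ (u , E.0#)) L
      π₂→π     : ∀ v → v ≢ E.0# → ∀ P → OnLine P (κ (E.0# , v)) → InPlane h P
      π→π₂     : ∀ L → Independent L → (∀ P → OnLine P L → InPlane h P) →
                 ∃ λ v → v ≢ E.0# × SameLine (κ (E.0# , v)) L

  -- The group G = ⟨c, z⟩.  As c and z commute and have finite order,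
  -- G = { c^i z^j : i, j ∈ ℕ }.

  iter : ℕ → (V → V) → V → V
  iter zero    f x = x
  iter (suc n) f x = f (iter n f x)

  module Group (α : E.Carrier) where
    ω μ : E.Carrier
    ω = E.pow α (q ℕ.* q ℕ.+ q ℕ.+ 1)
    μ = E.pow α (q ℕ.∸ 1)

    c z : V → V
    c (u , v) = (μ E.* u , (μ E.⁻¹) E.* v)
    z (u , v) = (u , E.pow ω 4 E.* v)

    g : ℕ → ℕ → V → V
    g i j x = iter i c (iter j z x)

  -- Orbits of G on points of PG(3,q) via the Klein correspondence:
  -- the collineation g' induced by g satisfies g'(κ x) = κ (g x), so
  -- g' P = P'  iff  for every quadric point x, P ∈ κ x ⇔ P' ∈ κ (g x).

  module Orbits (α : E.Carrier) {p h : W} (K : Klein p h) where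
    open Group α
    open Klein K

    SameOrbit : W → W → Set
    SameOrbit P P' = ∃ λ i → ∃ λ j →
      ∀ x → QPt x → (OnLine P (κ x) ⇔ OnLine P' (κ (g i j x)))

  ProjCard : (W → Set) → ℕ → Set
  ProjCard S n = Σ (Fin n → W) λ r →
    (∀ k → NonzeroW (r k) × S (r k)) ×
    (∀ k l → PropW (r k) (r l) → k ≡ l) ×
    (∀ P → NonzeroW P → S P → ∃ λ k → PropW (r k) P)

module _ {q : ℕ} (F : FiniteField q) (E : FiniteField (q ℕ.^ 3))
         (emb : Embedding F E) where
  open Geometry F E emb

  OrbitDescription : (α : FiniteField.Carrier E) (p h : W) → Klein p h → Set
  OrbitDescription α p h K =
    (∀ P → NonzeroW P → (SameOrbit p P ⇔ PropW p P))
    × (∀ P P' → InPlane h P → NonzeroW P' → (SameOrbit P P' ⇔ InPlane h P'))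
    × (∀ P → InPlane h P → ProjCard (SameOrbit P) (q ℕ.* q ℕ.+ q ℕ.+ 1))
    × (Σ (Fin 4 → W) λ R →
         (∀ k → NonzeroW (R k) × ¬ PropW p (R k) × ¬ InPlane h (R k))
       × (∀ k l → SameOrbit (R k) (R l) → k ≡ l)
       × (∀ P → NonzeroW P → ¬ PropW p P → ¬ InPlane h P →
            ∃ λ k → SameOrbit (R k) P)
       × (∀ k → ProjCard (SameOrbit (R k))
                  (((q ℕ.∸ 1) ℕ./ 4) ℕ.* (q ℕ.* q ℕ.+ q ℕ.+ 1))))
    where open Orbits α K

{-# OPTIONS --safe #-}
-- Write x ⨯ y = x^q y^(q²) - x^(q²) y^q, an alternating F-bilinear product on E for which
-- T(x (y ⨯ z)) is the determinant of the conjugates of x, y, z. Under the Klein correspondence the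
-- lines through a point off π form a plane of Q⁺(5,q) disjoint from π₂, that is, the graph
-- {(x, x ⨯ β)} of a skew map; so the points off π are labelled by β ∈ E, the point p by β = 0.
-- Elements of norm 1 satisfy (m x) ⨯ (m y) = m⁻¹ (x ⨯ y), hence c and z act on labels as
-- multiplication by μ and ω⁴. As gcd(q - 1, q² + q + 1) = gcd(q - 1, 3) = 1 and 4 divides q - 1,
-- ⟨μ, ω⁴⟩ = ⟨α⁴⟩ has index 4 in E*. A point of π lies on a unique line through p, that is, on a
-- unique point (u, 0) of π₁; there u counts modulo F* = ⟨ω⟩, and E* = ⟨μ⟩⟨ω⟩.
module Submission where

open import Defs
open import Data.Nat using (ℕ; _%_; _^_)
open import Relation.Binary.PropositionalEquality using (_≡_; _≢_)

open import Level using (0ℓ)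
open import Algebra.Bundles using (CommutativeRing)
open import Algebra.Solver.Ring.AlmostCommutativeRing using (fromCommutativeRing; _-Raw-AlmostCommutative⟶_)
open import Data.Empty using (⊥)
open import Data.Fin as Fin using (Fin)
open import Data.Fin.Patterns using (0F; 1F; 2F; 3F)
import Data.Fin.Properties as Finₚ
open import Data.Fin.Permutation using (Permutation; permutation; _⟨$⟩ʳ_)
open import Data.Integer as ℤ using (ℤ; -[1+_]; _⊖_)
import Data.Integer.Properties as ℤₚ
import Data.Maybe as Maybe
open import Data.Nat as ℕ using (zero; suc; _<_; _≤_)
open import Data.Nat.DivMod using (_/_; m≡m%n+[m/n]*n; m%n<n; m*n/n≡m; m<n⇒m%n≡m; [m+kn]%n≡m%n; m∣n⇒o%n%m≡o%m)
open import Data.Nat.Divisibility using (_∣_; m∣m*n)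
import Data.Nat.Properties as ℕₚ
import Data.Nat.Solver
open import Data.Product using (∃; _×_; _,_; proj₁; proj₂)
open import Data.Sum using (inj₁; inj₂)
open import Data.Vec.Functional using (removeAt)
open import Function.Bundles using (_⇔_; mk⇔; Inverse; Injection; Equivalence)
open import Function.Properties.Inverse using (↔⇒↣; ↔-sym)
open import Relation.Binary.Definitions using (DecidableEquality)
open import Relation.Binary.PropositionalEquality
  using (refl; sym; trans; cong; cong₂; subst; module ≡-Reasoning)
open import Relation.Nullary using (¬_; Dec; yes; no; contradiction; ¬?; _×-dec_)
open import Relation.Nullary.Decidable as Dec using (via-injection; dec⇒maybe)

private module ℕS = Data.Nat.Solver.+-*-Solver

-- `Klein` is an arbitrary incidence-preserving bijection without coordinates, so no point of
-- PG(3,q) can simply be written down. A point arises as the meet of two lines whose quadric points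
-- are orthogonal, and two points are identified by lying on two distinct common lines. The label β
-- of a point off π is an honest vector, since the graph of x ↦ x ⨯ β determines β. Hence the scalar
-- ω⁴ moves labels off π although it acts trivially on π, where labels are classes modulo F*: z is a
-- homology with centre p and axis π, so transitivity on π must come from c alone. Off π the orbit
-- of a nonzero label α^e is decided by e modulo 4. On the field side only cardinalities are given.
-- The number q is not presented as a prime power, so additivity of x ↦ x^q cannot be read off from
-- binomial coefficients; it is obtained by counting roots, and so is the fact that F is exactly the
-- set fixed by this map.

private
  variable
    q : ℕ

-- Arithmetic, Fermat's theorem and root counting in a finite field

module FieldTheory (K : FiniteField q) where
  open FiniteField K public

  commutativeRing : CommutativeRing 0ℓ 0ℓ
  commutativeRing = record { isCommutativeRing = isCommutativeRing }

  open CommutativeRing commutativeRing public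
    using (+-assoc; +-comm; +-identityˡ; +-identityʳ; -‿inverseʳ
          ; *-assoc; *-comm; *-identityˡ; *-identityʳ; zeroˡ; zeroʳ; _-_)
  open CommutativeRing commutativeRing using (ring; semiring; *-commutativeMonoid)
  open import Algebra.Properties.Ring ring public
    using (-‿distribˡ-*; -‿distribʳ-*; -0#≈0#; -‿involutive; -‿+-comm)
  open import Algebra.Properties.Semiring.Mult semiring using (×-homo-+; ×1-homo-*) renaming (_×_ to _·_)

  -- The ring solver decides cancellation only if its coefficients compute,
  -- hence the coefficient ring ℤ.
  module Solver where
    ⟦_⟧ℤ : ℤ → Carrier
    ⟦ ℤ.+ n ⟧ℤ      = n · 1#
    ⟦ -[1+ n ] ⟧ℤ = - (suc n · 1#)

    private
      cancel : ∀ a b → (1# + a) + - (1# + b) ≡ a + - b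
      cancel a b = begin
        (1# + a) + - (1# + b)     ≡⟨ cong ((1# + a) +_) (sym (-‿+-comm 1# b)) ⟩
        (1# + a) + (- 1# + - b)   ≡⟨ cong (_+ (- 1# + - b)) (+-comm 1# a) ⟩
        (a + 1#) + (- 1# + - b)   ≡⟨ +-assoc a 1# _ ⟩
        a + (1# + (- 1# + - b))   ≡⟨ cong (a +_) (sym (+-assoc 1# (- 1#) (- b))) ⟩
        a + ((1# + - 1#) + - b)   ≡⟨ cong (λ z → a + (z + - b)) (-‿inverseʳ 1#) ⟩
        a + (0# + - b)            ≡⟨ cong (a +_) (+-identityˡ (- b)) ⟩
        a + - b                   ∎
        where open ≡-Reasoning

    ⊖-homo : ∀ m n → ⟦ m ⊖ n ⟧ℤ ≡ m · 1# + - (n · 1#)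
    ⊖-homo zero    zero    = sym (trans (+-identityˡ _) -0#≈0#)
    ⊖-homo zero    (suc n) = sym (+-identityˡ _)
    ⊖-homo (suc m) zero    = sym (trans (cong (suc m · 1# +_) -0#≈0#) (+-identityʳ _))
    ⊖-homo (suc m) (suc n) = begin
      ⟦ suc m ⊖ suc n ⟧ℤ             ≡⟨ cong ⟦_⟧ℤ (ℤₚ.[1+m]⊖[1+n]≡m⊖n m n) ⟩
      ⟦ m ⊖ n ⟧ℤ                     ≡⟨ ⊖-homo m n ⟩
      m · 1# + - (n · 1#)            ≡⟨ cancel _ _ ⟨
      suc m · 1# + - (suc n · 1#)    ∎
      where open ≡-Reasoning

    +-homo : ∀ i j → ⟦ i ℤ.+ j ⟧ℤ ≡ ⟦ i ⟧ℤ + ⟦ j ⟧ℤ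
    +-homo (ℤ.+ m)      (ℤ.+ n)      = ×-homo-+ 1# m n
    +-homo (ℤ.+ m)      -[1+ n ]   = ⊖-homo m (suc n)
    +-homo -[1+ m ]   (ℤ.+ n)      = trans (⊖-homo n (suc m)) (+-comm _ _)
    +-homo -[1+ m ]   -[1+ n ]   = begin
      - (suc (suc (m ℕ.+ n)) · 1#)         ≡⟨ cong (λ z → - (suc z · 1#)) (ℕₚ.+-suc m n) ⟨
      - ((suc m ℕ.+ suc n) · 1#)           ≡⟨ cong -_ (×-homo-+ 1# (suc m) (suc n)) ⟩
      - (suc m · 1# + suc n · 1#)          ≡⟨ -‿+-comm _ _ ⟨
      - (suc m · 1#) + - (suc n · 1#)      ∎
      where open ≡-Reasoning

    -‿homo : ∀ i → ⟦ ℤ.- i ⟧ℤ ≡ - ⟦ i ⟧ℤ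
    -‿homo (ℤ.+ zero)  = sym -0#≈0#
    -‿homo (ℤ.+ suc n) = refl
    -‿homo -[1+ n ]  = sym (-‿involutive _)

    pos-*-homo : ∀ m j → ⟦ ℤ.+ m ℤ.* j ⟧ℤ ≡ m · 1# * ⟦ j ⟧ℤ
    pos-*-homo m (ℤ.+ n)  = trans (cong ⟦_⟧ℤ (sym (ℤₚ.pos-* m n))) (×1-homo-* m n)
    pos-*-homo m -[1+ n ] = begin
      ⟦ ℤ.+ m ℤ.* -[1+ n ] ⟧ℤ            ≡⟨ cong ⟦_⟧ℤ (ℤₚ.neg-distribʳ-* (ℤ.+ m) (ℤ.+ suc n)) ⟨
      ⟦ ℤ.- (ℤ.+ m ℤ.* ℤ.+ suc n) ⟧ℤ     ≡⟨ -‿homo (ℤ.+ m ℤ.* ℤ.+ suc n) ⟩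
      - ⟦ ℤ.+ m ℤ.* ℤ.+ suc n ⟧ℤ         ≡⟨ cong -_ (pos-*-homo m (ℤ.+ suc n)) ⟩
      - (m · 1# * suc n · 1#)            ≡⟨ -‿distribʳ-* _ _ ⟩
      m · 1# * - (suc n · 1#)            ∎
      where open ≡-Reasoning

    *-homo : ∀ i j → ⟦ i ℤ.* j ⟧ℤ ≡ ⟦ i ⟧ℤ * ⟦ j ⟧ℤ
    *-homo (ℤ.+ m) j = pos-*-homo m j
    *-homo -[1+ m ] j = begin
      ⟦ -[1+ m ] ℤ.* j ⟧ℤ            ≡⟨ cong ⟦_⟧ℤ (ℤₚ.neg-distribˡ-* (ℤ.+ suc m) j) ⟨
      ⟦ ℤ.- (ℤ.+ suc m ℤ.* j) ⟧ℤ     ≡⟨ -‿homo (ℤ.+ suc m ℤ.* j) ⟩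
      - ⟦ ℤ.+ suc m ℤ.* j ⟧ℤ         ≡⟨ cong -_ (pos-*-homo (suc m) j) ⟩
      - (suc m · 1# * ⟦ j ⟧ℤ)        ≡⟨ -‿distribˡ-* _ _ ⟩
      - (suc m · 1#) * ⟦ j ⟧ℤ        ∎
      where open ≡-Reasoning

    morphism : ℤ.+-*-rawRing -Raw-AlmostCommutative⟶ fromCommutativeRing commutativeRing
    morphism = record
      { ⟦_⟧    = ⟦_⟧ℤ
      ; +-homo = +-homo
      ; *-homo = *-homo
      ; -‿homo = -‿homo
      ; 0-homo = refl
      ; 1-homo = +-identityʳ 1#
      }

    open import Algebra.Solver.Ring ℤ.+-*-rawRing (fromCommutativeRing commutativeRing) morphism
      (λ i j → Maybe.map (cong ⟦_⟧ℤ) (dec⇒maybe (i ℤ.≟ j)))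
      public using (solve; con; _:=_; _:+_; _:*_; :-_; _:-_)

  open Solver public using (solve; con; _:=_; _:+_; _:*_; :-_; _:-_)

  index : Carrier → Fin q
  index = Inverse.to enum

  index-injective : ∀ {x y} → index x ≡ index y → x ≡ y
  index-injective = Injection.injective (↔⇒↣ enum)

  infix 4 _≟_
  _≟_ : DecidableEquality Carrier
  x ≟ y = via-injection (↔⇒↣ enum) Fin._≟_ x y

  -- Finiteness of the field makes this search possible. It decides membership in the image of `ι`
  -- and proportionality of vectors, so that later case distinctions are constructive.
  ∃? : ∀ {ℓ} {P : Carrier → Set ℓ} → (∀ x → Dec (P x)) → Dec (∃ P)
  ∃? {P = P} P? = Dec.map′
    (λ (i , Pi) → Inverse.from enum i , Pi)
    (λ (x , Px) → index x , subst P (sym (Inverse.inverseʳ enum refl)) Px)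
    (Finₚ.any? (λ i → P? (Inverse.from enum i)))

  *-cancelˡ-nonZero : ∀ a {x y} → a ≢ 0# → a * x ≡ a * y → x ≡ y
  *-cancelˡ-nonZero a {x} {y} a≢0 eq = begin
    x                 ≡⟨ strip x ⟨
    a ⁻¹ * (a * x)    ≡⟨ cong (a ⁻¹ *_) eq ⟩
    a ⁻¹ * (a * y)    ≡⟨ strip y ⟩
    y                 ∎
    where
    open ≡-Reasoning
    strip : ∀ z → a ⁻¹ * (a * z) ≡ z
    strip z = begin
      a ⁻¹ * (a * z)  ≡⟨ solve 3 (λ i a z → i :* (a :* z) := (a :* i) :* z) refl (a ⁻¹) a z ⟩
      (a * a ⁻¹) * z  ≡⟨ cong (_* z) (⁻¹-inverse a a≢0) ⟩
      1# * z          ≡⟨ *-identityˡ z ⟩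
      z               ∎

  integral : ∀ {a x} → a ≢ 0# → a * x ≡ 0# → x ≡ 0#
  integral {a} a≢0 eq = *-cancelˡ-nonZero a a≢0 (trans eq (sym (zeroʳ a)))

  *-nonZero : ∀ {a b} → a ≢ 0# → b ≢ 0# → a * b ≢ 0#
  *-nonZero a≢0 b≢0 eq = b≢0 (integral a≢0 eq)

  factorˡ-nonZero : ∀ {a b} → a * b ≢ 0# → a ≢ 0#
  factorˡ-nonZero ab≢0 refl = ab≢0 (zeroˡ _)

  ⁻¹-nonZero : ∀ {a} → a ≢ 0# → a ⁻¹ ≢ 0#
  ⁻¹-nonZero {a} a≢0 eq = 0≢1 (begin
    0#         ≡⟨ zeroʳ a ⟨
    a * 0#     ≡⟨ cong (a *_) eq ⟨
    a * a ⁻¹   ≡⟨ ⁻¹-inverse a a≢0 ⟩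
    1#         ∎)
    where open ≡-Reasoning

  a*[a⁻¹*x]≡x : ∀ {a} → a ≢ 0# → ∀ x → a * (a ⁻¹ * x) ≡ x
  a*[a⁻¹*x]≡x {a} a≢0 x = begin
    a * (a ⁻¹ * x)   ≡⟨ *-assoc a (a ⁻¹) x ⟨
    (a * a ⁻¹) * x   ≡⟨ cong (_* x) (⁻¹-inverse a a≢0) ⟩
    1# * x           ≡⟨ *-identityˡ x ⟩
    x                ∎
    where open ≡-Reasoning

  x-y≡0⇒x≡y : ∀ {x y} → x - y ≡ 0# → x ≡ y
  x-y≡0⇒x≡y {x} {y} eq = begin
    x              ≡⟨ solve 2 (λ x y → x := (x :- y) :+ y) refl x y ⟩
    (x - y) + y    ≡⟨ cong (_+ y) eq ⟩
    0# + y         ≡⟨ +-identityˡ y ⟩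
    y              ∎
    where open ≡-Reasoning

  x≡y⇒x-y≡0 : ∀ {x y} → x ≡ y → x - y ≡ 0#
  x≡y⇒x-y≡0 refl = -‿inverseʳ _

  -- Powers

  pow-+ : ∀ x m n → pow x (m ℕ.+ n) ≡ pow x m * pow x n
  pow-+ x zero    n = sym (*-identityˡ _)
  pow-+ x (suc m) n = trans (cong (x *_) (pow-+ x m n)) (sym (*-assoc x _ _))

  pow-* : ∀ x m n → pow x (m ℕ.* n) ≡ pow (pow x m) n
  pow-* x m zero    = cong (pow x) (ℕₚ.*-zeroʳ m)
  pow-* x m (suc n) = begin
    pow x (m ℕ.* suc n)         ≡⟨ cong (pow x) (ℕₚ.*-suc m n) ⟩
    pow x (m ℕ.+ m ℕ.* n)       ≡⟨ pow-+ x m (m ℕ.* n) ⟩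
    pow x m * pow x (m ℕ.* n)   ≡⟨ cong (pow x m *_) (pow-* x m n) ⟩
    pow x m * pow (pow x m) n   ∎
    where open ≡-Reasoning

  pow-distrib-* : ∀ x y n → pow (x * y) n ≡ pow x n * pow y n
  pow-distrib-* x y zero    = sym (*-identityˡ 1#)
  pow-distrib-* x y (suc n) = begin
    (x * y) * pow (x * y) n          ≡⟨ cong ((x * y) *_) (pow-distrib-* x y n) ⟩
    (x * y) * (pow x n * pow y n)    ≡⟨ solve 4 (λ x y a b → (x :* y) :* (a :* b) := (x :* a) :* (y :* b)) refl x y _ _ ⟩
    (x * pow x n) * (y * pow y n)    ∎
    where open ≡-Reasoning

  pow-1 : ∀ n → pow 1# n ≡ 1#
  pow-1 zero    = refl
  pow-1 (suc n) = trans (*-identityˡ _) (pow-1 n)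

  pow-nonZero : ∀ {x} n → x ≢ 0# → pow x n ≢ 0#
  pow-nonZero zero    x≢0 eq = 0≢1 (sym eq)
  pow-nonZero (suc n) x≢0    = *-nonZero x≢0 (pow-nonZero n x≢0)

  -- Fermat's little theorem: multiplication by a permutes the nonzero elements. In the products
  -- over the whole field the factor at 0 is replaced by 1.

  private
    module Prod where
      open import Algebra.Properties.CommutativeMonoid.Sum *-commutativeMonoid public
        renaming (sum to prod)

  open Prod using (prod)

  private
    orOne : Carrier → Carrier → Carrier
    orOne x y with x ≟ 0#
    ... | yes _ = 1#
    ... | no  _ = y

    orOne-0 : ∀ {x} y → x ≡ 0# → orOne x y ≡ 1#
    orOne-0 {x} y x≡0 with x ≟ 0#
    ... | yes _   = refl
    ... | no  x≢0 = contradiction x≡0 x≢0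

    orOne-≢0 : ∀ {x} y → x ≢ 0# → orOne x y ≡ y
    orOne-≢0 {x} y x≢0 with x ≟ 0#
    ... | yes x≡0 = contradiction x≡0 x≢0
    ... | no  _   = refl

    prod-nonZero : ∀ {n} (t : Fin n → Carrier) → (∀ i → t i ≢ 0#) → prod t ≢ 0#
    prod-nonZero {zero}  t t≢0 eq = 0≢1 (sym eq)
    prod-nonZero {suc n} t t≢0    = *-nonZero (t≢0 Fin.zero) (prod-nonZero (λ i → t (Fin.suc i)) (λ i → t≢0 (Fin.suc i)))

    prod-const : ∀ n a → prod {n} (λ _ → a) ≡ pow a n
    prod-const zero    a = refl
    prod-const (suc n) a = cong (a *_) (prod-const n a)

    prod-orOne : ∀ {n} (r : Fin n → Carrier) (i₀ : Fin n) → r i₀ ≡ 0# →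
                 (∀ i → r i ≡ 0# → i ≡ i₀) → ∀ a → prod (λ i → orOne (r i) a) ≡ pow a (n ℕ.∸ 1)
    prod-orOne {suc n} r i₀ r₀ uniq a = begin
      prod t                            ≡⟨ Prod.sum-remove {i = i₀} t ⟩
      t i₀ * prod (removeAt t i₀)       ≡⟨ cong₂ _*_ (orOne-0 a r₀) (Prod.sum-cong-≗ rest) ⟩
      1# * prod {n} (λ _ → a)           ≡⟨ *-identityˡ _ ⟩
      prod {n} (λ _ → a)                ≡⟨ prod-const n a ⟩
      pow a n                           ∎
      where
      open ≡-Reasoning
      t = λ i → orOne (r i) a
      rest : ∀ j → removeAt t i₀ j ≡ a
      rest j = orOne-≢0 a (λ eq → Finₚ.punchInᵢ≢i i₀ j (uniq _ eq))

  pow-order : ∀ {a} → a ≢ 0# → pow a (q ℕ.∸ 1) ≡ 1#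
  pow-order {a} a≢0 = *-cancelˡ-nonZero (prod f) (prod-nonZero f f≢0) (begin
    prod f * pow a (q ℕ.∸ 1)           ≡⟨ *-comm _ _ ⟩
    pow a (q ℕ.∸ 1) * prod f           ≡⟨ cong (_* prod f) (sym (prod-orOne r (index 0#) (Inverse.inverseʳ enum refl) r-zero a)) ⟩
    prod s * prod f                    ≡⟨ sym (Prod.∑-distrib-+ s f) ⟩
    prod (λ i → s i * f i)             ≡⟨ Prod.sum-cong-≗ step ⟩
    prod (λ i → f (π ⟨$⟩ʳ i))          ≡⟨ sym (Prod.sum-permute f π) ⟩
    prod f                             ≡⟨ *-identityʳ _ ⟨
    prod f * 1#                        ∎)
    where
    open ≡-Reasoning
    r : Fin q → Carrier
    r = Inverse.from enum
    s f : Fin q → Carrier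
    -- At the index of zero both `s` and `f` equal 1, so `s i * f i ≡ f (π ⟨$⟩ʳ i)` holds there too,
    -- while the product of `s` has exactly q - 1 factors `a`.
    s i = orOne (r i) a
    f i = orOne (r i) (r i)
    r-index : ∀ x → r (index x) ≡ x
    r-index x = Inverse.inverseʳ enum refl
    index-r : ∀ i → index (r i) ≡ i
    index-r i = Inverse.inverseˡ enum refl
    r-zero : ∀ i → r i ≡ 0# → i ≡ index 0#
    r-zero i eq = trans (sym (index-r i)) (cong index eq)
    f≢0 : ∀ i → f i ≢ 0#
    f≢0 i eq with r i ≟ 0#
    ... | yes _   = 0≢1 (sym eq)
    ... | no  r≢0 = r≢0 eq
    b≢0 = ⁻¹-nonZero a≢0
    cancel : ∀ x → (a ⁻¹) * (a * x) ≡ x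
    cancel x = *-cancelˡ-nonZero a a≢0 (a*[a⁻¹*x]≡x a≢0 (a * x))
    π : Permutation q q
    π = permutation (λ i → index (a * r i)) (λ i → index (a ⁻¹ * r i))
      (λ i → trans (cong (λ z → index (a * z)) (r-index _))
               (trans (cong index (a*[a⁻¹*x]≡x a≢0 (r i))) (index-r i)))
      (λ i → trans (cong (λ z → index (a ⁻¹ * z)) (r-index _))
               (trans (cong index (cancel (r i))) (index-r i)))
    step : ∀ i → s i * f i ≡ f (π ⟨$⟩ʳ i)
    step i = trans (step′ i) (cong (λ z → orOne z z) (sym (r-index (a * r i))))
      where
      step′ : ∀ i → s i * f i ≡ orOne (a * r i) (a * r i)
      step′ i with r i ≟ 0#
      ... | yes eq = trans (*-identityˡ 1#) (sym (orOne-0 _ (trans (cong (a *_) eq) (zeroʳ a))))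
      ... | no  r≢0 = sym (orOne-≢0 _ (*-nonZero a≢0 r≢0))

  0<order : 0 < q ℕ.∸ 1
  0<order = ℕₚ.m<n⇒0<n∸m (Finₚ.injective⇒≤ {f = two} two-injective)
    where
    two : Fin 2 → Fin q
    two Fin.zero          = index 0#
    two (Fin.suc Fin.zero) = index 1#
    two-injective : ∀ {i j} → two i ≡ two j → i ≡ j
    two-injective {Fin.zero}          {Fin.zero}          _  = refl
    two-injective {Fin.zero}          {Fin.suc Fin.zero}  eq = contradiction (index-injective eq) 0≢1
    two-injective {Fin.suc Fin.zero}  {Fin.zero}          eq = contradiction (index-injective (sym eq)) 0≢1
    two-injective {Fin.suc Fin.zero}  {Fin.suc Fin.zero}  _  = refl

  suc-order : suc (q ℕ.∸ 1) ≡ q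
  suc-order = ℕₚ.m+[n∸m]≡n (ℕₚ.≤-trans 0<order (ℕₚ.m∸n≤m q 1))

  pow-fixed : ∀ a → pow a q ≡ a
  pow-fixed a with a ≟ 0#
  ... | yes refl = trans (cong (pow 0#) (sym suc-order)) (zeroˡ _)
  ... | no  a≢0  = begin
    pow a q                    ≡⟨ cong (pow a) suc-order ⟨
    a * pow a (q ℕ.∸ 1)        ≡⟨ cong (a *_) (pow-order a≢0) ⟩
    a * 1#                     ≡⟨ *-identityʳ a ⟩
    a                          ∎
    where open ≡-Reasoning

  -- Polynomial functions

  -- f is given by a polynomial of degree less than n
  IsPoly : ℕ → (Carrier → Carrier) → Set
  IsPoly zero    f = ∀ x → f x ≡ 0#
  IsPoly (suc n) f = ∃ λ c → ∃ λ g → IsPoly n g × (∀ x → f x ≡ c + x * g x)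

  isPoly-≗ : ∀ n {f g} → (∀ x → f x ≡ g x) → IsPoly n g → IsPoly n f
  isPoly-≗ zero    f≗g z                 = λ x → trans (f≗g x) (z x)
  isPoly-≗ (suc n) f≗g (c , h , hp , eq) = c , h , hp , λ x → trans (f≗g x) (eq x)

  isPoly-0 : ∀ n → IsPoly n (λ _ → 0#)
  isPoly-0 zero    = λ _ → refl
  isPoly-0 (suc n) = 0# , _ , isPoly-0 n , λ x → sym (trans (+-identityˡ _) (zeroʳ x))

  isPoly-const : ∀ n c → IsPoly (suc n) (λ _ → c)
  isPoly-const n c = c , _ , isPoly-0 n , λ x → sym (trans (cong (c +_) (zeroʳ x)) (+-identityʳ c))

  isPoly-x* : ∀ n {f} → IsPoly n f → IsPoly (suc n) (λ x → x * f x)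
  isPoly-x* n fp = 0# , _ , fp , λ x → sym (+-identityˡ _)

  isPoly-+ : ∀ n {f g} → IsPoly n f → IsPoly n g → IsPoly n (λ x → f x + g x)
  isPoly-+ zero    z w x = trans (cong₂ _+_ (z x) (w x)) (+-identityˡ 0#)
  isPoly-+ (suc n) (c , f , fp , eq) (d , g , gp , eq′) = c + d , _ , isPoly-+ n fp gp , λ x →
    trans (cong₂ _+_ (eq x) (eq′ x))
      (solve 5 (λ c d x f g → (c :+ x :* f) :+ (d :+ x :* g) := (c :+ d) :+ x :* (f :+ g)) refl c d x (f x) (g x))

  isPoly-* : ∀ n a {f} → IsPoly n f → IsPoly n (λ x → a * f x)
  isPoly-* zero    a z x = trans (cong (a *_) (z x)) (zeroʳ a)
  isPoly-* (suc n) a (c , f , fp , eq) = a * c , _ , isPoly-* n a fp , λ x →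
    trans (cong (a *_) (eq x)) (solve 4 (λ a c x f → a :* (c :+ x :* f) := a :* c :+ x :* (a :* f)) refl a c x (f x))

  isPoly-suc : ∀ n {f} → IsPoly n f → IsPoly (suc n) f
  isPoly-suc zero    z                 = isPoly-≗ 1 z (isPoly-0 1)
  isPoly-suc (suc n) (c , g , gp , eq) = c , g , isPoly-suc n gp , eq

  isPoly-pow : ∀ n → IsPoly (suc n) (λ x → pow x n)
  isPoly-pow zero    = isPoly-const 0 1#
  isPoly-pow (suc n) = isPoly-x* (suc n) (isPoly-pow n)

  -- The leading terms cancel, so the degree drops below `n`. The recursion splits (x + y)ⁿ⁺¹ - xⁿ⁺¹
  -- as x ((x + y)ⁿ - xⁿ) + y (x + y)ⁿ and needs no binomial coefficients. Thanks to the drop, q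
  -- roots suffice in `defect-0`.
  isPoly-shift : ∀ y n → IsPoly n (λ x → pow (x + y) n - pow x n)
  isPoly-shift y zero    x = -‿inverseʳ 1#
  isPoly-shift y (suc n) = isPoly-≗ (suc n)
    (λ x → solve 4 (λ x y a b → (x :+ y) :* a :- x :* b := x :* (a :- b) :+ y :* ((a :- b) :+ b))
             refl x y (pow (x + y) n) (pow x n))
    (isPoly-+ (suc n) (isPoly-x* n (isPoly-shift y n))
      (isPoly-* (suc n) y (isPoly-+ (suc n) (isPoly-suc n (isPoly-shift y n)) (isPoly-pow n))))

  -- Synthetic division: with f = c + x g, the quotient is `g r` plus x times the quotient obtained
  -- from `g`.
  isPoly-factor : ∀ n {f} → IsPoly (suc n) f → ∀ r →
                  ∃ λ g → IsPoly n g × (∀ x → f x - f r ≡ (x - r) * g x)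
  isPoly-factor zero {f} (c , g , gp , eq) r = _ , (λ _ → refl) , λ x → begin
    f x - f r    ≡⟨ x≡y⇒x-y≡0 (trans (const x) (sym (const r))) ⟩
    0#           ≡⟨ zeroʳ _ ⟨
    (x - r) * 0# ∎
    where
    open ≡-Reasoning
    const : ∀ x → f x ≡ c + 0#
    const x = trans (eq x) (cong (c +_) (trans (cong (x *_) (gp x)) (zeroʳ x)))
  isPoly-factor (suc n) {f} (c , g , gp , eq) r with isPoly-factor n gp r
  ... | k , kp , keq = _ , (g r , k , kp , λ _ → refl) , λ x → begin
    f x - f r                                  ≡⟨ cong₂ _-_ (eq x) (eq r) ⟩
    (c + x * g x) - (c + r * g r)              ≡⟨ solve 5 (λ c x r a b → (c :+ x :* a) :- (c :+ r :* b) := (x :- r) :* b :+ x :* (a :- b)) refl c x r (g x) (g r) ⟩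
    (x - r) * g r + x * (g x - g r)            ≡⟨ cong (λ z → (x - r) * g r + x * z) (keq x) ⟩
    (x - r) * g r + x * ((x - r) * k x)        ≡⟨ solve 4 (λ x r b k → (x :- r) :* b :+ x :* ((x :- r) :* k) := (x :- r) :* (b :+ x :* k)) refl x r (g r) (k x) ⟩
    (x - r) * (g r + x * k x)                  ∎
    where open ≡-Reasoning

  -- Dividing by one root leaves the others as roots of the quotient, because injectivity of `r`
  -- makes the linear factor nonzero there; the degree bound runs out together with the roots.
  isPoly-roots : ∀ n {f} → IsPoly n f → (r : Fin n → Carrier) → (∀ {i j} → r i ≡ r j → i ≡ j) →
                 (∀ i → f (r i) ≡ 0#) → ∀ x → f x ≡ 0#
  isPoly-roots zero    z  r r-inj roots x = z x
  isPoly-roots (suc n) {f} fp r r-inj roots x with isPoly-factor n fp (r Fin.zero)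
  ... | g , gp , eq = begin
    f x                       ≡⟨ f-eq x ⟩
    (x - r Fin.zero) * g x    ≡⟨ cong ((x - r Fin.zero) *_) (isPoly-roots n gp (λ i → r (Fin.suc i)) (λ e → Finₚ.suc-injective (r-inj e)) groots x) ⟩
    (x - r Fin.zero) * 0#     ≡⟨ zeroʳ _ ⟩
    0#                        ∎
    where
    open ≡-Reasoning
    f-eq : ∀ x → f x ≡ (x - r Fin.zero) * g x
    f-eq x = begin
      f x                     ≡⟨ solve 1 (λ a → a := a :- con (ℤ.+ 0)) refl (f x) ⟩
      f x - 0#                ≡⟨ cong (λ z → f x - z) (roots Fin.zero) ⟨
      f x - f (r Fin.zero)    ≡⟨ eq x ⟩
      (x - r Fin.zero) * g x  ∎
    groots : ∀ i → g (r (Fin.suc i)) ≡ 0#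
    groots i = integral
      (λ e → contradiction (r-inj (x-y≡0⇒x≡y e)) λ ())
      (trans (sym (f-eq (r (Fin.suc i)))) (roots (Fin.suc i)))

  -- Orders of powers and primitive elements

  pow-% : ∀ x {n} .{{_ : ℕ.NonZero n}} → pow x n ≡ 1# → ∀ k → pow x k ≡ pow x (k % n)
  pow-% x {n} xⁿ≡1 k = begin
    pow x k                                ≡⟨ cong (pow x) (m≡m%n+[m/n]*n k n) ⟩
    pow x (k % n ℕ.+ k / n ℕ.* n)          ≡⟨ pow-+ x (k % n) _ ⟩
    pow x (k % n) * pow x (k / n ℕ.* n)    ≡⟨ cong (λ j → pow x (k % n) * pow x j) (ℕₚ.*-comm (k / n) n) ⟩
    pow x (k % n) * pow x (n ℕ.* (k / n))  ≡⟨ cong (pow x (k % n) *_) (pow-* x n (k / n)) ⟩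
    pow x (k % n) * pow (pow x n) (k / n)  ≡⟨ cong (λ z → pow x (k % n) * pow z (k / n)) xⁿ≡1 ⟩
    pow x (k % n) * pow 1# (k / n)         ≡⟨ cong (pow x (k % n) *_) (pow-1 (k / n)) ⟩
    pow x (k % n) * 1#                     ≡⟨ *-identityʳ _ ⟩
    pow x (k % n)                          ∎
    where open ≡-Reasoning

  surjective⇒≤ : ∀ {n} (f : Fin n → Carrier) → (∀ x → ∃ λ i → f i ≡ x) → q ≤ n
  surjective⇒≤ f surj = Finₚ.injective⇒≤ {f = λ i → proj₁ (surj (Inverse.from enum i))} λ {i} {j} eq →
    Injection.injective (↔⇒↣ (↔-sym enum))
      (trans (sym (proj₂ (surj _))) (trans (cong f eq) (proj₂ (surj _))))

  -- `Primitive` by itself does not exclude 0: in the field with two elements `pow 0# 0` already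
  -- reaches every nonzero element. In general the powers of 0 are only 0 and 1, too few once
  -- `2 < q`.
  primitive-nonZero : ∀ {α} → Primitive K α → 2 < q → α ≢ 0#
  primitive-nonZero prim 2<q refl = contradiction (surjective⇒≤ f surj) (ℕₚ.<⇒≱ 2<q)
    where
    f : Fin 2 → Carrier
    f Fin.zero           = 0#
    f (Fin.suc Fin.zero) = 1#
    surj : ∀ x → ∃ λ i → f i ≡ x
    surj x with x ≟ 0#
    ... | yes x≡0 = Fin.zero , sym x≡0
    ... | no  x≢0 with prim x x≢0
    ...   | zero  , eq = Fin.suc Fin.zero , eq
    ...   | suc n , eq = Fin.zero , trans (sym (zeroˡ _)) eq

  module Primitivity {α : Carrier} (prim : Primitive K α) (α≢0 : α ≢ 0#) where

    -- If αⁿ = 1, then 0 and the n powers below αⁿ exhaust the field, so it has at most n + 1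
    -- elements.
    order-minimal : ∀ n → 0 < n → pow α n ≡ 1# → q ℕ.∸ 1 ≤ n
    order-minimal n@(suc n-1) _ αⁿ≡1 = ℕₚ.∸-monoˡ-≤ 1 (surjective⇒≤ f surj)
      where
      f : Fin (suc n) → Carrier
      f Fin.zero    = 0#
      f (Fin.suc i) = pow α (Fin.toℕ i)
      surj : ∀ x → ∃ λ i → f i ≡ x
      surj x with x ≟ 0#
      ... | yes x≡0 = Fin.zero , sym x≡0
      ... | no  x≢0 with prim x x≢0
      ...   | k , αᵏ≡x = Fin.suc (Fin.fromℕ< (m%n<n k n)) , (begin
        pow α (Fin.toℕ (Fin.fromℕ< (m%n<n k n)))   ≡⟨ cong (pow α) (Finₚ.toℕ-fromℕ< (m%n<n k n)) ⟩
        pow α (k % n)                                 ≡⟨ pow-% α αⁿ≡1 k ⟨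
        pow α k                                       ≡⟨ αᵏ≡x ⟩
        x                                             ∎)
        where open ≡-Reasoning

    private
      instance
        order-nonZero : ℕ.NonZero (q ℕ.∸ 1)
        order-nonZero = ℕ.>-nonZero 0<order

    pow≡1⇒≡0 : ∀ n → n < q ℕ.∸ 1 → pow α n ≡ 1# → n ≡ 0
    pow≡1⇒≡0 zero    _   _  = refl
    pow≡1⇒≡0 (suc n) n<N eq = contradiction (order-minimal (suc n) ℕ.z<s eq) (ℕₚ.<⇒≱ n<N)

    pow-injective-≤ : ∀ {m n} → m ≤ n → n < q ℕ.∸ 1 → pow α m ≡ pow α n → m ≡ n
    pow-injective-≤ {m} {n} m≤n n<N eq = ℕₚ.≤-antisym m≤n (ℕₚ.m∸n≡0⇒m≤n
      (pow≡1⇒≡0 (n ℕ.∸ m) (ℕₚ.≤-<-trans (ℕₚ.m∸n≤m n m) n<N)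
        (*-cancelˡ-nonZero (pow α m) (pow-nonZero m α≢0) (begin
          pow α m * pow α (n ℕ.∸ m)   ≡⟨ pow-+ α m (n ℕ.∸ m) ⟨
          pow α (m ℕ.+ (n ℕ.∸ m))     ≡⟨ cong (pow α) (ℕₚ.m+[n∸m]≡n m≤n) ⟩
          pow α n                     ≡⟨ eq ⟨
          pow α m                     ≡⟨ *-identityʳ _ ⟨
          pow α m * 1#                ∎))))
      where open ≡-Reasoning

    pow-injective-< : ∀ {m n} → m < q ℕ.∸ 1 → n < q ℕ.∸ 1 → pow α m ≡ pow α n → m ≡ n
    pow-injective-< {m} {n} m<N n<N eq with ℕₚ.≤-total m n
    ... | inj₁ m≤n = pow-injective-≤ m≤n n<N eq
    ... | inj₂ n≤m = sym (pow-injective-≤ n≤m m<N (sym eq))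

    pow-≡⇒%-≡ : ∀ m n → pow α m ≡ pow α n → m % (q ℕ.∸ 1) ≡ n % (q ℕ.∸ 1)
    pow-≡⇒%-≡ m n eq = pow-injective-< (m%n<n m _) (m%n<n n _)
      (trans (sym (pow-% α (pow-order α≢0) m)) (trans eq (pow-% α (pow-order α≢0) n)))

-- The cubic extension E of F: Frobenius, trace and alternating product

module CubicExtension {q} (F : FiniteField q) (E : FiniteField (q ^ 3)) (emb : Embedding F E)
                      (α : FiniteField.Carrier E) (prim : Primitive E α) where
  private module F = FieldTheory F
  open FieldTheory E
  open Embedding emb

  instance
    q-nonZero : ℕ.NonZero q
    q-nonZero = ℕ.>-nonZero (ℕₚ.≤-trans F.0<order (ℕₚ.m∸n≤m q 1))

    q∸1-nonZero : ℕ.NonZero (q ℕ.∸ 1)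
    q∸1-nonZero = ℕ.>-nonZero F.0<order

  -- Both the number of points of a projective plane of order q and the exponent of the norm from E
  -- to F.
  θ : ℕ
  θ = q ℕ.* q ℕ.+ q ℕ.+ 1

  q³∸1≡[q∸1]θ : q ^ 3 ℕ.∸ 1 ≡ (q ℕ.∸ 1) ℕ.* θ
  q³∸1≡[q∸1]θ = begin
    q ^ 3 ℕ.∸ 1                                  ≡⟨ cong (λ n → n ^ 3 ℕ.∸ 1) F.suc-order ⟨
    suc r ^ 3 ℕ.∸ 1                              ≡⟨ cong (ℕ._∸ 1) (ℕS.solve 1 (λ r →
      let s = ℕS.con 1 ℕS.:+ r in
      s ℕS.:* (s ℕS.:* (s ℕS.:* ℕS.con 1)) ℕS.:= ℕS.con 1 ℕS.:+ r ℕS.:* (s ℕS.:* s ℕS.:+ s ℕS.:+ ℕS.con 1)) refl r) ⟩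
    r ℕ.* (suc r ℕ.* suc r ℕ.+ suc r ℕ.+ 1)      ≡⟨ cong (λ n → r ℕ.* (n ℕ.* n ℕ.+ n ℕ.+ 1)) F.suc-order ⟩
    r ℕ.* θ                                      ∎
    where
    open ≡-Reasoning
    r = q ℕ.∸ 1

  1<θ : 1 < θ
  1<θ = ℕₚ.+-monoˡ-≤ 1 (ℕₚ.≤-trans (ℕ.>-nonZero⁻¹ q) (ℕₚ.m≤n+m q (q ℕ.* q)))

  instance
    θ-nonZero : ℕ.NonZero θ
    θ-nonZero = ℕ.>-nonZero (ℕₚ.<-trans ℕ.z<s 1<θ)

  α≢0 : α ≢ 0#
  α≢0 = primitive-nonZero prim (begin-strict
    2                          <⟨ ℕ.s<s (ℕ.s<s ℕ.z<s) ⟩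
    2 ^ 3                      ≤⟨ ℕₚ.^-monoˡ-≤ 3 (subst (2 ≤_) F.suc-order (ℕ.s≤s F.0<order)) ⟩
    q ^ 3                      ∎)
    where open ℕₚ.≤-Reasoning

  open Primitivity prim α≢0 public

  ι-0 : ι F.0# ≡ 0#
  ι-0 = begin
    ι F.0#                              ≡⟨ solve 1 (λ a → a := (a :+ a) :- a) refl (ι F.0#) ⟩
    (ι F.0# + ι F.0#) - ι F.0#          ≡⟨ cong (_- ι F.0#) (trans (sym (ι-+ F.0# F.0#)) (cong ι (F.+-identityˡ F.0#))) ⟩
    ι F.0# - ι F.0#                     ≡⟨ -‿inverseʳ _ ⟩
    0#                                  ∎
    where open ≡-Reasoning

  ι≡0⇒≡0 : ∀ {a} → ι a ≡ 0# → a ≡ F.0#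
  ι≡0⇒≡0 eq = ι-inj _ _ (trans eq (sym ι-0))

  ι-nonZero : ∀ {a} → a ≢ F.0# → ι a ≢ 0#
  ι-nonZero a≢0 eq = a≢0 (ι≡0⇒≡0 eq)

  ι-pow : ∀ a n → ι (F.pow a n) ≡ pow (ι a) n
  ι-pow a zero    = ι-1
  ι-pow a (suc n) = trans (ι-* a _) (cong (ι a *_) (ι-pow a n))

  -- The Frobenius automorphism

  φ : Carrier → Carrier
  φ x = pow x q

  φ-* : ∀ x y → φ (x * y) ≡ φ x * φ y
  φ-* x y = pow-distrib-* x y q

  φ-ι : ∀ a → φ (ι a) ≡ ι a
  φ-ι a = trans (sym (ι-pow a q)) (cong ι (F.pow-fixed a))

  φ-cube : ∀ x → φ (φ (φ x)) ≡ x
  φ-cube x = begin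
    pow (pow (pow x q) q) q       ≡⟨ cong φ (pow-* x q q) ⟨
    pow (pow x (q ℕ.* q)) q       ≡⟨ pow-* x (q ℕ.* q) q ⟨
    pow x (q ℕ.* q ℕ.* q)         ≡⟨ cong (pow x) (ℕS.solve 1 (λ q → q ℕS.:* q ℕS.:* q ℕS.:= q ℕS.:* (q ℕS.:* (q ℕS.:* ℕS.con 1))) refl q) ⟩
    pow x (q ^ 3)                 ≡⟨ pow-fixed x ⟩
    x                             ∎
    where open ≡-Reasoning

  φ-injective : ∀ {x y} → φ x ≡ φ y → x ≡ y
  φ-injective {x} {y} eq = trans (sym (φ-cube x)) (trans (cong (λ z → φ (φ z)) eq) (φ-cube y))

  isPoly-const′ : ∀ c → IsPoly q (λ _ → c)
  isPoly-const′ c = subst (λ n → IsPoly n (λ _ → c)) F.suc-order (isPoly-const (q ℕ.∸ 1) c)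

  fromF : Fin q → Carrier
  fromF i = ι (Inverse.from F.enum i)

  fromF-injective : ∀ {i j} → fromF i ≡ fromF j → i ≡ j
  fromF-injective eq = Injection.injective (↔⇒↣ (↔-sym F.enum)) (ι-inj _ _ eq)

  -- A polynomial of degree less than q is determined by its values on F; this
  -- gives additivity first for a summand in F, then in general.
  private
    defect : Carrier → Carrier → Carrier
    defect y x = (pow (x + y) q - pow x q) + - pow y q

    defect-comm : ∀ x y → defect y x ≡ defect x y
    defect-comm x y = trans
      (solve 3 (λ a b c → (a :- b) :+ :- c := (a :- c) :+ :- b) refl (pow (x + y) q) (pow x q) (pow y q))
      (cong (λ s → (pow s q - pow y q) + - pow x q) (+-comm x y))

    defect-isPoly : ∀ y → IsPoly q (defect y)
    defect-isPoly y = isPoly-+ q (isPoly-shift y q) (isPoly-const′ _)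

    defect-ι : ∀ a b → defect (ι a) (ι b) ≡ 0#
    defect-ι a b = trans (cong₂ (λ s t → (s - t) + - φ (ι a)) (trans (cong φ (sym (ι-+ b a))) (φ-ι (b F.+ a))) (φ-ι b))
      (trans (cong₂ (λ s t → (s - ι b) + - t) (ι-+ b a) (φ-ι a))
        (solve 2 (λ a b → (b :+ a :- b) :+ :- a := con (ℤ.+ 0)) refl (ι a) (ι b)))

    defect-ι-x : ∀ a x → defect (ι a) x ≡ 0#
    defect-ι-x a = isPoly-roots q (defect-isPoly (ι a)) fromF fromF-injective (λ i → defect-ι a _)

    defect-0 : ∀ y x → defect y x ≡ 0#
    defect-0 y = isPoly-roots q (defect-isPoly y) fromF fromF-injective
      (λ i → trans (defect-comm (fromF i) y) (defect-ι-x _ y))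

  φ-+ : ∀ x y → φ (x + y) ≡ φ x + φ y
  φ-+ x y = x-y≡0⇒x≡y (trans
    (solve 3 (λ a b c → a :- (b :+ c) := (a :- b) :+ :- c) refl (φ (x + y)) (φ x) (φ y))
    (defect-0 y x))

  φ-- : ∀ x y → φ (x - y) ≡ φ x - φ y
  φ-- x y = begin
    φ (x - y)                   ≡⟨ solve 2 (λ a b → a := (a :+ b) :- b) refl (φ (x - y)) (φ y) ⟩
    (φ (x - y) + φ y) - φ y     ≡⟨ cong (_- φ y) (φ-+ (x - y) y) ⟨
    φ ((x - y) + y) - φ y       ≡⟨ cong (λ z → φ z - φ y) (solve 2 (λ x y → (x :- y) :+ y := x) refl x y) ⟩
    φ x - φ y                   ∎
    where open ≡-Reasoning

  -- Otherwise α would satisfy α^(q-1) = 1, whereas its order is q³ - 1 = (q - 1) θ.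
  φα≢α : φ α ≢ α
  φα≢α eq = contradiction
    (order-minimal (q ℕ.∸ 1) F.0<order (*-cancelˡ-nonZero α α≢0 (begin
      pow α (suc (q ℕ.∸ 1))   ≡⟨ cong (pow α) F.suc-order ⟩
      φ α                     ≡⟨ eq ⟩
      α                       ≡⟨ *-identityʳ α ⟨
      α * 1#                  ∎)))
    (ℕₚ.<⇒≱ (subst (q ℕ.∸ 1 <_) (sym q³∸1≡[q∸1]θ) (ℕₚ.m<m*n (q ℕ.∸ 1) θ 1<θ)))
    where open ≡-Reasoning

  -- A fixed element outside F would be a root number q + 1 of y^q - y. This polynomial would then
  -- vanish on all of E, in particular at α.
  φ-fixed : ∀ x → φ x ≡ x → ∃ λ a → x ≡ ι a
  φ-fixed x fx with F.∃? (λ a → x ≟ ι a)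
  ... | yes x∈F = x∈F
  ... | no  x∉F = contradiction (fixed α) φα≢α
    where
    s : Fin (suc q) → Carrier
    s Fin.zero    = x
    s (Fin.suc i) = fromF i
    s-injective : ∀ {i j} → s i ≡ s j → i ≡ j
    s-injective {Fin.zero}  {Fin.zero}  _  = refl
    s-injective {Fin.zero}  {Fin.suc j} eq = contradiction (_ , eq) x∉F
    s-injective {Fin.suc i} {Fin.zero}  eq = contradiction (_ , sym eq) x∉F
    s-injective {Fin.suc i} {Fin.suc j} eq = cong Fin.suc (fromF-injective eq)
    -- The term -y appears as `- 1# * (y * 1#)` because this is the shape that the closure lemmas
    -- `isPoly-*` and `isPoly-x*` produce.
    poly : IsPoly (suc q) (λ y → φ y + - 1# * (y * 1#))
    poly = isPoly-+ (suc q) (isPoly-pow q) (isPoly-* (suc q) (- 1#) (isPoly-x* q (isPoly-const′ 1#)))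
    simplify : ∀ y → - 1# * (y * 1#) ≡ - y
    simplify y = begin
      - 1# * (y * 1#)   ≡⟨ cong (- 1# *_) (*-identityʳ y) ⟩
      - 1# * y          ≡⟨ -‿distribˡ-* 1# y ⟨
      - (1# * y)        ≡⟨ cong -_ (*-identityˡ y) ⟩
      - y               ∎
      where open ≡-Reasoning
    root : ∀ {y} → φ y ≡ y → φ y + - 1# * (y * 1#) ≡ 0#
    root {y} fy = trans (cong (φ y +_) (simplify y)) (x≡y⇒x-y≡0 fy)
    s-root : ∀ i → φ (s i) + - 1# * (s i * 1#) ≡ 0#
    s-root Fin.zero    = root fx
    s-root (Fin.suc i) = root (φ-ι _)
    fixed : ∀ y → φ y ≡ y
    fixed y = x-y≡0⇒x≡y (trans (cong (φ y +_) (sym (simplify y)))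
      (isPoly-roots (suc q) poly s s-injective s-root y))

  -- The trace and the alternating product on E

  tr : Carrier → Carrier
  tr x = x + φ x + φ (φ x)

  infixl 7 _⨯_
  -- If x stands for the vector (x, φ x, φ (φ x)) of its conjugates, this is the first coordinate of
  -- the cross product; by `φ-⨯` and `φφ-⨯` its conjugates are the other two. In the same picture
  -- `tr (x * y)` is the dot product, which explains the vector identities below.
  _⨯_ : Carrier → Carrier → Carrier
  x ⨯ y = φ x * φ (φ y) - φ (φ x) * φ y

  φφ-* : ∀ x y → φ (φ (x * y)) ≡ φ (φ x) * φ (φ y)
  φφ-* x y = trans (cong φ (φ-* x y)) (φ-* (φ x) (φ y))

  φφ-+ : ∀ x y → φ (φ (x + y)) ≡ φ (φ x) + φ (φ y)
  φφ-+ x y = trans (cong φ (φ-+ x y)) (φ-+ (φ x) (φ y))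

  φφ-- : ∀ x y → φ (φ (x - y)) ≡ φ (φ x) - φ (φ y)
  φφ-- x y = trans (cong φ (φ-- x y)) (φ-- (φ x) (φ y))

  φφ-ι : ∀ a → φ (φ (ι a)) ≡ ι a
  φφ-ι a = trans (cong φ (φ-ι a)) (φ-ι a)

  φ-1 : φ 1# ≡ 1#
  φ-1 = pow-1 q

  tr-* : ∀ x y → tr (x * y) ≡ x * y + φ x * φ y + φ (φ x) * φ (φ y)
  tr-* x y = cong₂ (λ a b → x * y + a + b) (φ-* x y) (φφ-* x y)

  tr-+ : ∀ x y → tr (x + y) ≡ tr x + tr y
  tr-+ x y = trans (cong₂ (λ a b → x + y + a + b) (φ-+ x y) (φφ-+ x y))
    (solve 6 (λ a b c d e f → (a :+ b) :+ (c :+ d) :+ (e :+ f) := (a :+ c :+ e) :+ (b :+ d :+ f)) refl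
      x y (φ x) (φ y) (φ (φ x)) (φ (φ y)))

  tr-- : ∀ x y → tr (x - y) ≡ tr x - tr y
  tr-- x y = trans (cong₂ (λ a b → x - y + a + b) (φ-- x y) (φφ-- x y))
    (solve 6 (λ a b c d e f → (a :- b) :+ (c :- d) :+ (e :- f) := (a :+ c :+ e) :- (b :+ d :+ f)) refl
      x y (φ x) (φ y) (φ (φ x)) (φ (φ y)))

  tr-ι* : ∀ a x → tr (ι a * x) ≡ ι a * tr x
  tr-ι* a x = trans (tr-* (ι a) x) (trans (cong₂ (λ b c → ι a * x + b * φ x + c * φ (φ x)) (φ-ι a) (φφ-ι a))
    (solve 4 (λ a x y z → a :* x :+ a :* y :+ a :* z := a :* (x :+ y :+ z)) refl (ι a) x (φ x) (φ (φ x))))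

  tr-0 : tr 0# ≡ 0#
  tr-0 = begin
    tr 0#              ≡⟨ cong tr (-‿inverseʳ 0#) ⟨
    tr (0# - 0#)       ≡⟨ tr-- 0# 0# ⟩
    tr 0# - tr 0#      ≡⟨ -‿inverseʳ _ ⟩
    0#                 ∎
    where open ≡-Reasoning

  tr-*0 : ∀ x → tr (x * 0#) ≡ 0#
  tr-*0 x = trans (cong tr (zeroʳ x)) tr-0

  tr-0* : ∀ x → tr (0# * x) ≡ 0#
  tr-0* x = trans (cong tr (zeroˡ x)) tr-0

  φ-⨯ : ∀ x y → φ (x ⨯ y) ≡ φ (φ x) * y - x * φ (φ y)
  φ-⨯ x y = trans (φ-- _ _) (cong₂ _-_
    (trans (φ-* _ _) (cong (φ (φ x) *_) (φ-cube y)))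
    (trans (φ-* _ _) (cong (_* φ (φ y)) (φ-cube x))))

  φφ-⨯ : ∀ x y → φ (φ (x ⨯ y)) ≡ x * φ y - φ x * y
  φφ-⨯ x y = trans (cong φ (φ-⨯ x y)) (trans (φ-- _ _) (cong₂ _-_
    (trans (φ-* _ _) (cong (_* φ y) (φ-cube x)))
    (trans (φ-* _ _) (cong (φ x *_) (φ-cube y)))))

  -- The determinant of the 3 × 3 matrix of conjugates of z, x, y
  tr-⨯ : ∀ z x y → tr (z * (x ⨯ y)) ≡
         z * (φ x * φ (φ y) - φ (φ x) * φ y) + φ z * (φ (φ x) * y - x * φ (φ y)) + φ (φ z) * (x * φ y - φ x * y)
  tr-⨯ z x y = trans (tr-* z (x ⨯ y))
    (cong₂ (λ a b → z * (x ⨯ y) + φ z * a + φ (φ z) * b) (φ-⨯ x y) (φφ-⨯ x y))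

  tr-⨯-cycle : ∀ x y z → tr (x * (y ⨯ z)) ≡ tr (y * (z ⨯ x))
  tr-⨯-cycle x y z = trans (tr-⨯ x y z) (trans
    (solve 9 (λ x x₁ x₂ y y₁ y₂ z z₁ z₂ →
        x :* (y₁ :* z₂ :- y₂ :* z₁) :+ x₁ :* (y₂ :* z :- y :* z₂) :+ x₂ :* (y :* z₁ :- y₁ :* z)
        := y :* (z₁ :* x₂ :- z₂ :* x₁) :+ y₁ :* (z₂ :* x :- z :* x₂) :+ y₂ :* (z :* x₁ :- z₁ :* x)) refl
      x (φ x) (φ (φ x)) y (φ y) (φ (φ y)) z (φ z) (φ (φ z)))
    (sym (tr-⨯ y z x)))

  ⨯-self : ∀ x → x ⨯ x ≡ 0#
  ⨯-self x = solve 2 (λ a b → a :* b :- b :* a := con (ℤ.+ 0)) refl (φ x) (φ (φ x))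

  ⨯-antisym : ∀ x y → x ⨯ y ≡ - (y ⨯ x)
  ⨯-antisym x y = solve 4 (λ a b c d → a :* d :- b :* c := :- (c :* b :- d :* a)) refl
    (φ x) (φ (φ x)) (φ y) (φ (φ y))

  ⨯-antisym-0 : ∀ {x y} → x ⨯ y ≡ 0# → y ⨯ x ≡ 0#
  ⨯-antisym-0 {x} {y} eq = trans (⨯-antisym y x) (trans (cong -_ eq) -0#≈0#)

  tr-x[x⨯y]≡0 : ∀ x y → tr (x * (x ⨯ y)) ≡ 0#
  tr-x[x⨯y]≡0 x y = trans (tr-⨯-cycle x x y) (trans (tr-⨯-cycle x y x)
    (trans (cong (λ z → tr (y * z)) (⨯-self x)) (tr-*0 y)))

  tr-y[x⨯y]≡0 : ∀ x y → tr (y * (x ⨯ y)) ≡ 0#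
  tr-y[x⨯y]≡0 x y = trans (tr-⨯-cycle y x y) (trans (cong (λ z → tr (x * z)) (⨯-self y)) (tr-*0 x))

  -- Exchanging two rows changes the sign of a determinant. Thus x ↦ x ⨯ z is skew for the trace
  -- form, and its graph consists of pairwise orthogonal vectors.
  tr-⨯-skew : ∀ x y z → tr (x * (y ⨯ z)) + tr (y * (x ⨯ z)) ≡ 0#
  tr-⨯-skew x y z = trans (cong₂ _+_ (tr-⨯ x y z) (tr-⨯ y x z))
    (solve 9 (λ x x₁ x₂ y y₁ y₂ z z₁ z₂ →
        (x :* (y₁ :* z₂ :- y₂ :* z₁) :+ x₁ :* (y₂ :* z :- y :* z₂) :+ x₂ :* (y :* z₁ :- y₁ :* z))
        :+ (y :* (x₁ :* z₂ :- x₂ :* z₁) :+ y₁ :* (x₂ :* z :- x :* z₂) :+ y₂ :* (x :* z₁ :- x₁ :* z))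
        := con (ℤ.+ 0)) refl
      x (φ x) (φ (φ x)) y (φ y) (φ (φ y)) z (φ z) (φ (φ z)))

  ι*-⨯ : ∀ a x y → (ι a * x) ⨯ y ≡ ι a * (x ⨯ y)
  ι*-⨯ a x y = trans
    (cong₂ (λ s t → s * φ (φ y) - t * φ y)
      (trans (φ-* _ _) (cong (_* φ x) (φ-ι a))) (trans (φφ-* _ _) (cong (_* φ (φ x)) (φφ-ι a))))
    (solve 5 (λ a x₁ x₂ y₁ y₂ → (a :* x₁) :* y₂ :- (a :* x₂) :* y₁ := a :* (x₁ :* y₂ :- x₂ :* y₁)) refl
      (ι a) (φ x) (φ (φ x)) (φ y) (φ (φ y)))

  ⨯-ι* : ∀ a x y → x ⨯ (ι a * y) ≡ ι a * (x ⨯ y)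
  ⨯-ι* a x y = begin
    x ⨯ (ι a * y)          ≡⟨ ⨯-antisym _ _ ⟩
    - ((ι a * y) ⨯ x)      ≡⟨ cong -_ (ι*-⨯ a y x) ⟩
    - (ι a * (y ⨯ x))      ≡⟨ -‿distribʳ-* _ _ ⟩
    ι a * - (y ⨯ x)        ≡⟨ cong (ι a *_) (⨯-antisym x y) ⟨
    ι a * (x ⨯ y)          ∎
    where open ≡-Reasoning

  ⨯-- : ∀ x y z → x ⨯ (y - z) ≡ x ⨯ y - x ⨯ z
  ⨯-- x y z = trans (cong₂ (λ s t → φ x * t - φ (φ x) * s) (φ-- y z) (φφ-- y z))
    (solve 6 (λ a b y₁ y₂ z₁ z₂ → a :* (y₂ :- z₂) :- b :* (y₁ :- z₁) := (a :* y₂ :- b :* y₁) :- (a :* z₂ :- b :* z₁)) refl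
      (φ x) (φ (φ x)) (φ y) (φ (φ y)) (φ z) (φ (φ z)))

  ⨯-0 : ∀ x → x ⨯ 0# ≡ 0#
  ⨯-0 x = trans (cong (x ⨯_) (sym (-‿inverseʳ 0#))) (trans (⨯-- x 0# 0#) (-‿inverseʳ _))

  0-⨯ : ∀ x → 0# ⨯ x ≡ 0#
  0-⨯ x = ⨯-antisym-0 (⨯-0 x)

  -- Cramer's rule
  tr-nondegenerate : ∀ x y z {v} → tr (z * (x ⨯ y)) ≢ 0# →
                     tr (x * v) ≡ 0# → tr (y * v) ≡ 0# → tr (z * v) ≡ 0# → v ≡ 0#
  tr-nondegenerate x y z {v} det≢0 xv yv zv = integral det≢0 (begin
    tr (z * (x ⨯ y)) * v
      ≡⟨ cong (_* v) (tr-⨯ z x y) ⟩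
    (z * (x₁ * y₂ - x₂ * y₁) + z₁ * (x₂ * y - x * y₂) + z₂ * (x * y₁ - x₁ * y)) * v
      ≡⟨ solve 12 (λ x x₁ x₂ y y₁ y₂ z z₁ z₂ v v₁ v₂ →
           (z :* (x₁ :* y₂ :- x₂ :* y₁) :+ z₁ :* (x₂ :* y :- x :* y₂) :+ z₂ :* (x :* y₁ :- x₁ :* y)) :* v
           := (y₁ :* z₂ :- y₂ :* z₁) :* (x :* v :+ x₁ :* v₁ :+ x₂ :* v₂)
              :+ (x₂ :* z₁ :- x₁ :* z₂) :* (y :* v :+ y₁ :* v₁ :+ y₂ :* v₂)
              :+ (x₁ :* y₂ :- x₂ :* y₁) :* (z :* v :+ z₁ :* v₁ :+ z₂ :* v₂)) refl
           x x₁ x₂ y y₁ y₂ z z₁ z₂ v (φ v) (φ (φ v)) ⟩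
    (y₁ * z₂ - y₂ * z₁) * (x * v + x₁ * φ v + x₂ * φ (φ v))
      + (x₂ * z₁ - x₁ * z₂) * (y * v + y₁ * φ v + y₂ * φ (φ v))
      + (x₁ * y₂ - x₂ * y₁) * (z * v + z₁ * φ v + z₂ * φ (φ v))
      ≡⟨ cong₂ _+_ (cong₂ _+_ (vanish x xv) (vanish y yv)) (vanish z zv) ⟩
    0# + 0# + 0#
      ≡⟨ trans (+-identityʳ _) (+-identityʳ _) ⟩
    0# ∎)
    where
    open ≡-Reasoning
    x₁ = φ x
    x₂ = φ (φ x)
    y₁ = φ y
    y₂ = φ (φ y)
    z₁ = φ z
    z₂ = φ (φ z)
    vanish : ∀ w {a} → tr (w * v) ≡ 0# → a * (w * v + φ w * φ v + φ (φ w) * φ (φ v)) ≡ 0#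
    vanish w {a} eq = trans (cong (a *_) (trans (sym (tr-* w v)) eq)) (zeroʳ a)

  -- 1, α, α² form a basis of E over F: the determinant of their conjugates is the Vandermonde
  -- determinant of α, φ α, φ (φ α), which are distinct because φ moves α and has order three.
  tr-basis : ∀ {v} → tr v ≡ 0# → tr (α * v) ≡ 0# → tr (α * α * v) ≡ 0# → v ≡ 0#
  tr-basis {v} v₀ = tr-nondegenerate 1# α (α * α) det≢0 (trans (cong tr (*-identityˡ v)) v₀)
    where
    open ≡-Reasoning
    a₁ = φ α
    a₂ = φ (φ α)
    vandermonde : tr (α * α * (1# ⨯ α)) ≡ (a₁ - α) * ((a₂ - α) * (a₂ - a₁))
    vandermonde = begin
      tr (α * α * (1# ⨯ α))
        ≡⟨ tr-⨯ (α * α) 1# α ⟩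
      _ ≡⟨ cong₂ (λ s t → α * α * (φ 1# * a₂ - φ (φ 1#) * a₁) + s * (φ (φ 1#) * α - 1# * a₂) + t * (1# * a₁ - φ 1# * α))
             (φ-* α α) (φφ-* α α) ⟩
      _ ≡⟨ cong₂ (λ s t → α * α * (s * a₂ - t * a₁) + a₁ * a₁ * (t * α - 1# * a₂) + a₂ * a₂ * (1# * a₁ - s * α))
             φ-1 (trans (cong φ φ-1) φ-1) ⟩
      _ ≡⟨ cong₂ (λ s t → α * α * (s - t) + a₁ * a₁ * (1# * α - s) + a₂ * a₂ * (t - 1# * α)) (*-identityˡ a₂) (*-identityˡ a₁) ⟩
      _ ≡⟨ cong (λ s → α * α * (a₂ - a₁) + a₁ * a₁ * (s - a₂) + a₂ * a₂ * (a₁ - s)) (*-identityˡ α) ⟩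
      α * α * (a₂ - a₁) + a₁ * a₁ * (α - a₂) + a₂ * a₂ * (a₁ - α)
        ≡⟨ solve 3 (λ a b c → a :* a :* (c :- b) :+ b :* b :* (a :- c) :+ c :* c :* (b :- a)
                      := (b :- a) :* ((c :- a) :* (c :- b))) refl α a₁ a₂ ⟩
      (a₁ - α) * ((a₂ - α) * (a₂ - a₁)) ∎
    det≢0 : tr (α * α * (1# ⨯ α)) ≢ 0#
    det≢0 eq = *-nonZero (λ e → φα≢α (x-y≡0⇒x≡y e))
      (*-nonZero (λ e → φα≢α (trans (cong φ (sym (x-y≡0⇒x≡y e))) (φ-cube α)))
                 (λ e → φα≢α (φ-injective (x-y≡0⇒x≡y e))))
      (trans (sym vandermonde) eq)

  -- Nondegeneracy of the trace form with an explicit witness, found by testing the basis 1, α, α².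
  tr-witness : ∀ {v} → v ≢ 0# → ∃ λ s → tr (s * v) ≢ 0#
  tr-witness {v} v≢0 = select (tr v ≟ 0#) (tr (α * v) ≟ 0#) (tr (α * α * v) ≟ 0#)
    where
    select : Dec (tr v ≡ 0#) → Dec (tr (α * v) ≡ 0#) → Dec (tr (α * α * v) ≡ 0#) → ∃ λ s → tr (s * v) ≢ 0#
    select (no ≢0) _       _       = 1# , λ eq → ≢0 (trans (cong tr (sym (*-identityˡ v))) eq)
    select (yes _) (no ≢0) _       = α , ≢0
    select (yes _) (yes _) (no ≢0) = α * α , ≢0
    select (yes a) (yes b) (yes c) = contradiction (tr-basis a b c) v≢0

  -- Up to one application of φ, the hypothesis says x φ(u) = φ(x) u, so the quotient x / u is fixed
  -- by φ and lies in F.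
  ⨯≡0⇒∥ : ∀ {x u} → u ≢ 0# → x ⨯ u ≡ 0# → ∃ λ a → x ≡ ι a * u
  ⨯≡0⇒∥ {x} {u} u≢0 eq = proj₁ w∈F , (begin
    x                  ≡⟨ u*w≡x ⟨
    u * w              ≡⟨ cong (u *_) (proj₂ w∈F) ⟩
    u * ι (proj₁ w∈F)  ≡⟨ *-comm u _ ⟩
    ι (proj₁ w∈F) * u  ∎)
    where
    open ≡-Reasoning
    w = u ⁻¹ * x
    u*w≡x : u * w ≡ x
    u*w≡x = a*[a⁻¹*x]≡x u≢0 x
    xφu≡φxu : x * φ u ≡ φ x * u
    xφu≡φxu = φ-injective (trans (φ-* x (φ u)) (trans (x-y≡0⇒x≡y eq) (sym (φ-* (φ x) u))))
    w-fixed : φ w ≡ w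
    w-fixed = *-cancelˡ-nonZero (φ u) (pow-nonZero q u≢0) (*-cancelˡ-nonZero u u≢0 (begin
      u * (φ u * φ w)    ≡⟨ cong (u *_) (trans (sym (φ-* u w)) (cong φ u*w≡x)) ⟩
      u * φ x            ≡⟨ *-comm u (φ x) ⟩
      φ x * u            ≡⟨ xφu≡φxu ⟨
      x * φ u            ≡⟨ cong (_* φ u) u*w≡x ⟨
      (u * w) * φ u      ≡⟨ solve 3 (λ u w f → (u :* w) :* f := u :* (f :* w)) refl u w (φ u) ⟩
      u * (φ u * w)      ∎))
    w∈F : ∃ λ a → w ≡ ι a
    w∈F = φ-fixed w w-fixed

  -- Since α is not in F, `α * u` is independent of `u`. This yields without any search a second
  -- direction and, in `(α * u) ⨯ u`, a nonzero vector orthogonal to `u`; both are used throughout.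
  αu⨯u≢0 : ∀ {u} → u ≢ 0# → (α * u) ⨯ u ≢ 0#
  αu⨯u≢0 {u} u≢0 eq = φα≢α (trans (cong φ α≡ιa) (trans (φ-ι _) (sym α≡ιa)))
    where
    αu∥u : ∃ λ a → α * u ≡ ι a * u
    αu∥u = ⨯≡0⇒∥ u≢0 eq
    α≡ιa : α ≡ ι (proj₁ αu∥u)
    α≡ιa = *-cancelˡ-nonZero u u≢0 (trans (*-comm u α) (trans (proj₂ αu∥u) (*-comm _ u)))

  ⨯-trans : ∀ {x y u} → u ≢ 0# → x ⨯ u ≡ 0# → y ⨯ u ≡ 0# → x ⨯ y ≡ 0#
  ⨯-trans {x} {y} {u} u≢0 xu yu = begin
    x ⨯ y           ≡⟨ cong (x ⨯_) (proj₂ y∥u) ⟩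
    x ⨯ (ι b * u)   ≡⟨ ⨯-ι* b x u ⟩
    ι b * (x ⨯ u)   ≡⟨ cong (ι b *_) xu ⟩
    ι b * 0#        ≡⟨ zeroʳ _ ⟩
    0#              ∎
    where
    open ≡-Reasoning
    y∥u : ∃ λ a → y ≡ ι a * u
    y∥u = ⨯≡0⇒∥ u≢0 yu
    b = proj₁ y∥u

  -- The vector triple product (x ⨯ u) ⨯ y = u tr(xy) - x tr(uy)
  ⊥⊥⇒∥⨯ : ∀ {x u y} → x ⨯ u ≢ 0# → tr (x * y) ≡ 0# → tr (u * y) ≡ 0# → ∃ λ a → y ≡ ι a * (x ⨯ u)
  ⊥⊥⇒∥⨯ {x} {u} {y} xu≢0 xy uy = ⨯≡0⇒∥ xu≢0 (⨯-antisym-0 (begin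
    (x ⨯ u) ⨯ y
      ≡⟨ cong₂ (λ s t → s * φ (φ y) - t * φ y) (φ-⨯ x u) (φφ-⨯ x u) ⟩
    (φ (φ x) * u - x * φ (φ u)) * φ (φ y) - (x * φ u - φ x * u) * φ y
      ≡⟨ solve 9 (λ x x₁ x₂ u u₁ u₂ y y₁ y₂ →
           (x₂ :* u :- x :* u₂) :* y₂ :- (x :* u₁ :- x₁ :* u) :* y₁
           := u :* (x :* y :+ x₁ :* y₁ :+ x₂ :* y₂) :- x :* (u :* y :+ u₁ :* y₁ :+ u₂ :* y₂)) refl
           x (φ x) (φ (φ x)) u (φ u) (φ (φ u)) y (φ y) (φ (φ y)) ⟩
    u * (x * y + φ x * φ y + φ (φ x) * φ (φ y)) - x * (u * y + φ u * φ y + φ (φ u) * φ (φ y))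
      ≡⟨ cong₂ (λ s t → u * s - x * t) (trans (sym (tr-* x y)) xy) (trans (sym (tr-* u y)) uy) ⟩
    u * 0# - x * 0#   ≡⟨ cong₂ _-_ (zeroʳ u) (zeroʳ x) ⟩
    0# - 0#           ≡⟨ -‿inverseʳ _ ⟩
    0#                ∎))
    where open ≡-Reasoning

  ⨯-injective : ∀ {β γ} → (∀ x → x ≢ 0# → x ⨯ β ≡ x ⨯ γ) → β ≡ γ
  ⨯-injective {β} {γ} eq = decide (β - γ ≟ 0#)
    where
    decide : Dec (β - γ ≡ 0#) → β ≡ γ
    decide (yes ≡0) = x-y≡0⇒x≡y ≡0
    -- Test the hypothesis at α (β - γ), which is independent of β - γ.
    decide (no  ≢0) = contradiction
      (trans (⨯-- (α * (β - γ)) β γ) (x≡y⇒x-y≡0 (eq _ (*-nonZero α≢0 ≢0))))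
      (αu⨯u≢0 ≢0)

  -- The multipliers μ and ω

  μ ω : Carrier
  μ = pow α (q ℕ.∸ 1)
  ω = pow α θ

  μ≢0 : μ ≢ 0#
  μ≢0 = pow-nonZero (q ℕ.∸ 1) α≢0

  ω≢0 : ω ≢ 0#
  ω≢0 = pow-nonZero θ α≢0

  μ^θ≡1 : pow μ θ ≡ 1#
  μ^θ≡1 = begin
    pow μ θ                        ≡⟨ pow-* α (q ℕ.∸ 1) θ ⟨
    pow α ((q ℕ.∸ 1) ℕ.* θ)        ≡⟨ cong (pow α) q³∸1≡[q∸1]θ ⟨
    pow α (q ^ 3 ℕ.∸ 1)            ≡⟨ pow-order α≢0 ⟩
    1#                             ∎
    where open ≡-Reasoning

  ω∈F : ∃ λ a → ω ≡ ι a
  ω∈F = φ-fixed ω (begin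
    pow ω q                         ≡⟨ cong (pow ω) F.suc-order ⟨
    ω * pow ω (q ℕ.∸ 1)             ≡⟨ cong (ω *_) (pow-* α θ (q ℕ.∸ 1)) ⟨
    ω * pow α (θ ℕ.* (q ℕ.∸ 1))     ≡⟨ cong (λ n → ω * pow α n) (trans (ℕₚ.*-comm θ (q ℕ.∸ 1)) (sym q³∸1≡[q∸1]θ)) ⟩
    ω * pow α (q ^ 3 ℕ.∸ 1)         ≡⟨ cong (ω *_) (pow-order α≢0) ⟩
    ω * 1#                          ≡⟨ *-identityʳ ω ⟩
    ω                               ∎)
    where open ≡-Reasoning

  ω^k∈F : ∀ k → ∃ λ a → pow ω k ≡ ι a
  ω^k∈F k = F.pow (proj₁ ω∈F) k , trans (cong (λ z → pow z k) (proj₂ ω∈F)) (sym (ι-pow _ k))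

  norm-μ^i : ∀ i → φ (pow μ i) * φ (φ (pow μ i)) * pow μ i ≡ 1#
  norm-μ^i i = begin
    φ m * φ (φ m) * m                        ≡⟨ solve 3 (λ a b c → a :* b :* c := b :* a :* c) refl (φ m) (φ (φ m)) m ⟩
    φ (φ m) * φ m * m                        ≡⟨ cong₂ (λ s t → s * φ m * t) (pow-* m q q) (*-identityʳ m) ⟨
    pow m (q ℕ.* q) * pow m q * pow m 1      ≡⟨ cong (_* pow m 1) (pow-+ m (q ℕ.* q) q) ⟨
    pow m (q ℕ.* q ℕ.+ q) * pow m 1          ≡⟨ pow-+ m (q ℕ.* q ℕ.+ q) 1 ⟨
    pow m θ                                  ≡⟨ pow-* μ i θ ⟨
    pow μ (i ℕ.* θ)                          ≡⟨ cong (pow μ) (ℕₚ.*-comm i θ) ⟩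
    pow μ (θ ℕ.* i)                          ≡⟨ pow-* μ θ i ⟩
    pow (pow μ θ) i                          ≡⟨ cong (λ z → pow z i) μ^θ≡1 ⟩
    pow 1# i                                 ≡⟨ pow-1 i ⟩
    1#                                       ∎
    where
    open ≡-Reasoning
    m = pow μ i

  pow-⁻¹ : ∀ {x} n → x ≢ 0# → pow x n * pow (x ⁻¹) n ≡ 1#
  pow-⁻¹ {x} n x≢0 = trans (sym (pow-distrib-* x (x ⁻¹) n)) (trans (cong (λ z → pow z n) (⁻¹-inverse x x≢0)) (pow-1 n))

  primitive-ratio : ∀ {x y} → x ≢ 0# → y ≢ 0# → ∃ λ n → y ≡ pow α n * x
  primitive-ratio {x} {y} x≢0 y≢0 = proj₁ p , (begin
    y                     ≡⟨ a*[a⁻¹*x]≡x x≢0 y ⟨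
    x * (x ⁻¹ * y)        ≡⟨ cong (x *_) (proj₂ p) ⟨
    x * pow α (proj₁ p)   ≡⟨ *-comm x _ ⟩
    pow α (proj₁ p) * x   ∎)
    where
    open ≡-Reasoning
    p : ∃ λ n → pow α n ≡ x ⁻¹ * y
    p = prim _ (*-nonZero (⁻¹-nonZero x≢0) y≢0)

  -- The subgroups of E* generated by μ and by powers of ω

  module Coprime (q%3≢1 : q % 3 ≢ 1) where

    -- θ = (q - 1)(q + 2) + 3
    bezout : ∃ λ j → ∃ λ m → j ℕ.* θ ≡ m ℕ.* (q ℕ.∸ 1) ℕ.+ 1
    bezout = residue (q % 3) refl (m%n<n q 3)
      where
      k = q / 3
      q≡ : ∀ {c} → q % 3 ≡ c → q ≡ c ℕ.+ k ℕ.* 3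
      q≡ eq = trans (m≡m%n+[m/n]*n q 3) (cong (ℕ._+ k ℕ.* 3) eq)
      Goal : ℕ → Set
      Goal q = ∃ λ j → ∃ λ m → j ℕ.* (q ℕ.* q ℕ.+ q ℕ.+ 1) ≡ m ℕ.* (q ℕ.∸ 1) ℕ.+ 1
      multiple : ∀ k → 0 < k ℕ.* 3 → Goal (k ℕ.* 3)
      -- Here q = 3j, so the remainder 3j left by j θ modulo q - 1 is q = (q - 1) + 1.
      multiple (suc k) _ = suc k , suc k ℕ.* (suc k ℕ.* 3 ℕ.+ 2) ℕ.+ 1 , ℕS.solve 1 (λ k →
        let r = ℕS.con 2 ℕS.:+ k ℕS.:* ℕS.con 3; n = ℕS.con 1 ℕS.:+ r; j = ℕS.con 1 ℕS.:+ k in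
        j ℕS.:* (n ℕS.:* n ℕS.:+ n ℕS.:+ ℕS.con 1)
        ℕS.:= (j ℕS.:* (n ℕS.:+ ℕS.con 2) ℕS.:+ ℕS.con 1) ℕS.:* r ℕS.:+ ℕS.con 1) refl k
      residue : ∀ c → q % 3 ≡ c → c < 3 → Goal q
      residue 0 eq _ = subst Goal (sym (q≡ eq)) (multiple k (subst (0 <_) (q≡ eq) (ℕ.>-nonZero⁻¹ q)))
      residue 1 eq _ = contradiction eq q%3≢1
      -- Here q = 3k + 2 and j = 2k + 1, so 3j = 2q - 1 = 2 (q - 1) + 1.
      residue 2 eq _ = subst Goal (sym (q≡ eq)) (2 ℕ.* k ℕ.+ 1 , (2 ℕ.* k ℕ.+ 1) ℕ.* (2 ℕ.+ k ℕ.* 3 ℕ.+ 2) ℕ.+ 2 , ℕS.solve 1 (λ k →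
        let r = ℕS.con 1 ℕS.:+ k ℕS.:* ℕS.con 3; n = ℕS.con 1 ℕS.:+ r; j = ℕS.con 2 ℕS.:* k ℕS.:+ ℕS.con 1 in
        j ℕS.:* (n ℕS.:* n ℕS.:+ n ℕS.:+ ℕS.con 1)
        ℕS.:= (j ℕS.:* (n ℕS.:+ ℕS.con 2) ℕS.:+ ℕS.con 2) ℕS.:* r ℕS.:+ ℕS.con 1) refl k)
      residue (suc (suc (suc c))) eq (ℕ.s≤s (ℕ.s≤s (ℕ.s≤s ())))

    α-split : ∃ λ i → ∃ λ j → α ≡ pow μ i * pow ω j
    -- `bezout` reads μ^m α = ω^j. As exponents are natural numbers, the inverse of μ^m is written
    -- as the power m (θ - 1) of μ.
    α-split = m ℕ.* (θ ℕ.∸ 1) , j , (begin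
      α                                                  ≡⟨ *-identityʳ α ⟨
      α * 1#                                             ≡⟨ cong (α *_) μ^mθ≡1 ⟨
      α * (pow μ m * pow μ (m ℕ.* (θ ℕ.∸ 1)))            ≡⟨ solve 3 (λ a b c → a :* (b :* c) := c :* (b :* a)) refl α _ _ ⟩
      pow μ (m ℕ.* (θ ℕ.∸ 1)) * (pow μ m * α)            ≡⟨ cong (pow μ (m ℕ.* (θ ℕ.∸ 1)) *_) μ^mα≡ω^j ⟩
      pow μ (m ℕ.* (θ ℕ.∸ 1)) * pow ω j                  ∎)
      where
      open ≡-Reasoning
      j = proj₁ bezout
      m = proj₁ (proj₂ bezout)
      μ^mθ≡1 : pow μ m * pow μ (m ℕ.* (θ ℕ.∸ 1)) ≡ 1#
      μ^mθ≡1 = begin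
        pow μ m * pow μ (m ℕ.* (θ ℕ.∸ 1))    ≡⟨ pow-+ μ m _ ⟨
        pow μ (m ℕ.+ m ℕ.* (θ ℕ.∸ 1))        ≡⟨ cong (pow μ) (ℕₚ.*-suc m (θ ℕ.∸ 1)) ⟨
        pow μ (m ℕ.* suc (θ ℕ.∸ 1))          ≡⟨ cong (λ n → pow μ (m ℕ.* n)) (ℕₚ.m+[n∸m]≡n (ℕₚ.<⇒≤ 1<θ)) ⟩
        pow μ (m ℕ.* θ)                      ≡⟨ cong (pow μ) (ℕₚ.*-comm m θ) ⟩
        pow μ (θ ℕ.* m)                      ≡⟨ pow-* μ θ m ⟩
        pow (pow μ θ) m                      ≡⟨ cong (λ z → pow z m) μ^θ≡1 ⟩
        pow 1# m                             ≡⟨ pow-1 m ⟩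
        1#                                   ∎
      μ^mα≡ω^j : pow μ m * α ≡ pow ω j
      μ^mα≡ω^j = begin
        pow μ m * α                                   ≡⟨ cong₂ _*_ (sym (pow-* α (q ℕ.∸ 1) m)) (sym (*-identityʳ α)) ⟩
        pow α ((q ℕ.∸ 1) ℕ.* m) * pow α 1             ≡⟨ pow-+ α ((q ℕ.∸ 1) ℕ.* m) 1 ⟨
        pow α ((q ℕ.∸ 1) ℕ.* m ℕ.+ 1)                 ≡⟨ cong (λ n → pow α (n ℕ.+ 1)) (ℕₚ.*-comm (q ℕ.∸ 1) m) ⟩
        pow α (m ℕ.* (q ℕ.∸ 1) ℕ.+ 1)                 ≡⟨ cong (pow α) (proj₂ (proj₂ bezout)) ⟨
        pow α (j ℕ.* θ)                               ≡⟨ cong (pow α) (ℕₚ.*-comm j θ) ⟩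
        pow α (θ ℕ.* j)                               ≡⟨ pow-* α θ j ⟩
        pow ω j                                       ∎

    -- The exponent of ω stays a visible multiple of `n`, so that for n = 4s the second factor is a
    -- power of ω⁴.
    α^n-split : ∀ n → ∃ λ i → ∃ λ j → pow α n ≡ pow μ i * pow ω (n ℕ.* j)
    α^n-split n = i ℕ.* n , j , (begin
      pow α n                                     ≡⟨ cong (λ z → pow z n) (proj₂ (proj₂ α-split)) ⟩
      pow (pow μ i * pow ω j) n                   ≡⟨ pow-distrib-* _ _ n ⟩
      pow (pow μ i) n * pow (pow ω j) n           ≡⟨ cong₂ _*_ (pow-* μ i n) (pow-* ω j n) ⟨
      pow μ (i ℕ.* n) * pow ω (j ℕ.* n)           ≡⟨ cong (λ k → pow μ (i ℕ.* n) * pow ω k) (ℕₚ.*-comm j n) ⟩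
      pow μ (i ℕ.* n) * pow ω (n ℕ.* j)           ∎)
      where
      open ≡-Reasoning
      i = proj₁ α-split
      j = proj₁ (proj₂ α-split)

    α^4s-split : ∀ s → ∃ λ i → ∃ λ j → pow α (4 ℕ.* s) ≡ pow μ i * pow (pow ω 4) j
    α^4s-split s = proj₁ p , s ℕ.* proj₁ (proj₂ p) , trans (proj₂ (proj₂ p))
      (cong (pow μ (proj₁ p) *_)
        (trans (cong (pow ω) (ℕₚ.*-assoc 4 s (proj₁ (proj₂ p)))) (pow-* ω 4 (s ℕ.* proj₁ (proj₂ p)))))
      where
      p : ∃ λ i → ∃ λ j → pow α (4 ℕ.* s) ≡ pow μ i * pow ω (4 ℕ.* s ℕ.* j)
      p = α^n-split (4 ℕ.* s)

    μ-transitive : ∀ {x y} → x ≢ 0# → y ≢ 0# → ∃ λ i → ∃ λ a → y ≡ ι a * (pow μ i * x)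
    μ-transitive {x} {y} x≢0 y≢0 = i , proj₁ (ω^k∈F k) , (begin
      y                                       ≡⟨ proj₂ ratio ⟩
      pow α n * x                             ≡⟨ cong (_* x) (proj₂ (proj₂ split)) ⟩
      pow μ i * pow ω k * x                   ≡⟨ solve 3 (λ a b c → a :* b :* c := b :* (a :* c)) refl (pow μ i) (pow ω k) x ⟩
      pow ω k * (pow μ i * x)                 ≡⟨ cong (_* (pow μ i * x)) (proj₂ (ω^k∈F k)) ⟩
      ι (proj₁ (ω^k∈F k)) * (pow μ i * x)     ∎)
      where
      open ≡-Reasoning
      ratio : ∃ λ n → y ≡ pow α n * x
      ratio = primitive-ratio x≢0 y≢0
      n = proj₁ ratio
      split : ∃ λ i → ∃ λ j → pow α n ≡ pow μ i * pow ω (n ℕ.* j)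
      split = α^n-split n
      i = proj₁ split
      k = n ℕ.* proj₁ (proj₂ split)

  module Divisible (q%4≡1 : q % 4 ≡ 1) where

    [q∸1]≡4*[q∸1]/4 : q ℕ.∸ 1 ≡ 4 ℕ.* ((q ℕ.∸ 1) / 4)
    [q∸1]≡4*[q∸1]/4 = begin
      q ℕ.∸ 1                        ≡⟨ r≡ ⟩
      q / 4 ℕ.* 4                    ≡⟨ cong (ℕ._* 4) (m*n/n≡m (q / 4) 4) ⟨
      q / 4 ℕ.* 4 / 4 ℕ.* 4          ≡⟨ cong (λ n → n / 4 ℕ.* 4) r≡ ⟨
      (q ℕ.∸ 1) / 4 ℕ.* 4            ≡⟨ ℕₚ.*-comm ((q ℕ.∸ 1) / 4) 4 ⟩
      4 ℕ.* ((q ℕ.∸ 1) / 4)          ∎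
      where
      open ≡-Reasoning
      r≡ : q ℕ.∸ 1 ≡ q / 4 ℕ.* 4
      r≡ = cong (ℕ._∸ 1) (trans (m≡m%n+[m/n]*n q 4) (cong (ℕ._+ q / 4 ℕ.* 4) q%4≡1))

    q³∸1≡4*orbit : q ^ 3 ℕ.∸ 1 ≡ 4 ℕ.* ((q ℕ.∸ 1) / 4 ℕ.* θ)
    q³∸1≡4*orbit = trans q³∸1≡[q∸1]θ (trans (cong (ℕ._* θ) [q∸1]≡4*[q∸1]/4) (ℕₚ.*-assoc 4 ((q ℕ.∸ 1) / 4) θ))

    -- The inclusion of ⟨μ, ω⁴⟩ in ⟨α⁴⟩: it uses that 4 divides q - 1, which puts μ itself into
    -- ⟨α⁴⟩. The reverse inclusion `α^4s-split` rests on coprimality instead.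
    multiplier-α^4s : ∀ i j → ∃ λ s → pow μ i * pow (pow ω 4) j ≡ pow α (4 ℕ.* s)
    multiplier-α^4s i j = t ℕ.* i ℕ.+ θ ℕ.* j , (begin
      pow μ i * pow (pow ω 4) j                        ≡⟨ cong₂ _*_ (pow-* α (q ℕ.∸ 1) i) (cong (λ z → pow z j) (pow-* α θ 4)) ⟨
      pow α ((q ℕ.∸ 1) ℕ.* i) * pow (pow α (θ ℕ.* 4)) j ≡⟨ cong₂ _*_ refl (pow-* α (θ ℕ.* 4) j) ⟨
      pow α ((q ℕ.∸ 1) ℕ.* i) * pow α (θ ℕ.* 4 ℕ.* j)  ≡⟨ pow-+ α ((q ℕ.∸ 1) ℕ.* i) _ ⟨
      pow α ((q ℕ.∸ 1) ℕ.* i ℕ.+ θ ℕ.* 4 ℕ.* j)        ≡⟨ cong (λ r → pow α (r ℕ.* i ℕ.+ θ ℕ.* 4 ℕ.* j)) [q∸1]≡4*[q∸1]/4 ⟩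
      pow α (4 ℕ.* t ℕ.* i ℕ.+ θ ℕ.* 4 ℕ.* j)          ≡⟨ cong (pow α) (ℕS.solve 4 (λ t i θ j →
          ℕS.con 4 ℕS.:* t ℕS.:* i ℕS.:+ θ ℕS.:* ℕS.con 4 ℕS.:* j
          ℕS.:= ℕS.con 4 ℕS.:* (t ℕS.:* i ℕS.:+ θ ℕS.:* j)) refl t i θ j) ⟩
      pow α (4 ℕ.* (t ℕ.* i ℕ.+ θ ℕ.* j))              ∎)
      where
      open ≡-Reasoning
      t = (q ℕ.∸ 1) / 4

-- Points, lines and planes of PG(3,q)

module Projective {q} (F : FiniteField q) (E : FiniteField (q ^ 3)) (emb : Embedding F E) where
  private module F = FieldTheory F
  open FieldTheory F
  open Geometry F E emb hiding (module F; module E)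

  propW-sym : ∀ {P P′} → PropW P P′ → PropW P′ P
  propW-sym {P} {P′} (a , a≢0 , eq) = a ⁻¹ , ⁻¹-nonZero a≢0 , λ i → begin
    P i                 ≡⟨ *-cancelˡ-nonZero a a≢0 (a*[a⁻¹*x]≡x a≢0 _) ⟨
    a ⁻¹ * (a * P i)    ≡⟨ cong (a ⁻¹ *_) (eq i) ⟨
    a ⁻¹ * P′ i         ∎
    where open ≡-Reasoning

  propW? : ∀ P P′ → Dec (PropW P P′)
  propW? P P′ = ∃? λ a → ¬? (a ≟ 0#) ×-dec Finₚ.all? (λ i → P′ i ≟ a * P i)

  propW-nonzero : ∀ {P P′} → PropW P P′ → NonzeroW P → NonzeroW P′
  propW-nonzero (a , a≢0 , eq) P≢0 P′≡0 = P≢0 λ i → integral a≢0 (trans (sym (eq i)) (P′≡0 i))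

  -- Proportionality with cleared denominators: `d` is nonzero automatically, as otherwise `P′`
  -- would be the zero vector.
  propW-cross : ∀ {P P′ c d} → NonzeroW P′ → c ≢ 0# → (∀ i → c * P′ i ≡ d * P i) → PropW P P′
  propW-cross {P} {P′} {c} {d} P′≢0 c≢0 eq = c ⁻¹ * d , b≢0 , P′≡bP
    where
    open ≡-Reasoning
    P′≡bP : ∀ i → P′ i ≡ c ⁻¹ * d * P i
    P′≡bP i = *-cancelˡ-nonZero c c≢0 (begin
      c * P′ i                  ≡⟨ eq i ⟩
      d * P i                   ≡⟨ a*[a⁻¹*x]≡x c≢0 _ ⟨
      c * (c ⁻¹ * (d * P i))    ≡⟨ cong (c *_) (*-assoc (c ⁻¹) d (P i)) ⟨
      c * (c ⁻¹ * d * P i)      ∎)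
    b≢0 : c ⁻¹ * d ≢ 0#
    b≢0 b≡0 = P′≢0 λ i → trans (P′≡bP i) (trans (cong (_* P i) b≡0) (zeroˡ _))

  propW-trans : ∀ {P Q R} → PropW P Q → PropW Q R → PropW P R
  propW-trans {P} (a , a≢0 , eq) (b , b≢0 , eq′) = b * a , *-nonZero b≢0 a≢0 , λ i →
    trans (eq′ i) (trans (cong (b *_) (eq i)) (sym (*-assoc b a (P i))))

  onLine-resp : ∀ {P P′} L → PropW P P′ → OnLine P L → OnLine P′ L
  onLine-resp {P} {P′} (a , b) P~P′@(c , _ , eq) (P≢0 , s , t , P≡) =
    propW-nonzero P~P′ P≢0 , c * s , c * t , λ i → begin
      P′ i                                ≡⟨ eq i ⟩
      c * P i                             ≡⟨ cong (c *_) (P≡ i) ⟩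
      c * (s * a i + t * b i)             ≡⟨ solve 5 (λ c s t a b → c :* (s :* a :+ t :* b) := c :* s :* a :+ c :* t :* b) refl c s t (a i) (b i) ⟩
      c * s * a i + c * t * b i           ∎
    where open ≡-Reasoning

  onLine₁ : ∀ {P Q} → NonzeroW P → OnLine P (P , Q)
  onLine₁ {P} {Q} P≢0 = P≢0 , 1# , 0# , λ i → sym (trans (cong₂ _+_ (*-identityˡ (P i)) (zeroˡ (Q i))) (+-identityʳ (P i)))

  onLine₂ : ∀ {P Q} → NonzeroW Q → OnLine Q (P , Q)
  onLine₂ {P} {Q} Q≢0 = Q≢0 , 0# , 1# , λ i → sym (trans (cong₂ _+_ (zeroˡ (P i)) (*-identityˡ (Q i))) (+-identityˡ (Q i)))

  join-independent : ∀ {P Q} → NonzeroW P → NonzeroW Q → ¬ PropW P Q → Independent (P , Q)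
  join-independent {P} {Q} P≢0 Q≢0 P≁Q s t eq = s≡0 (s ≟ 0#) , t≡0
    where
    open ≡-Reasoning
    t-case : Dec (t ≡ 0#) → t ≡ 0#
    t-case (yes t≡0) = t≡0
    t-case (no  t≢0) = contradiction (propW-cross {c = t} {d = - s} Q≢0 t≢0 λ i → begin
      t * Q i                                  ≡⟨ solve 4 (λ s t p q → t :* q := (s :* p :+ t :* q) :+ (:- s) :* p) refl s t (P i) (Q i) ⟩
      (s * P i + t * Q i) + (- s) * P i        ≡⟨ cong (_+ (- s) * P i) (eq i) ⟩
      0# + (- s) * P i                         ≡⟨ +-identityˡ _ ⟩
      (- s) * P i                              ∎) P≁Q
    t≡0 : t ≡ 0#
    t≡0 = t-case (t ≟ 0#)
    s≡0 : Dec (s ≡ 0#) → s ≡ 0#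
    s≡0 (yes s≡0) = s≡0
    s≡0 (no  s≢0) = contradiction (λ i → integral s≢0 (begin
      s * P i                                  ≡⟨ +-identityʳ _ ⟨
      s * P i + 0#                             ≡⟨ cong (s * P i +_) (trans (cong (_* Q i) t≡0) (zeroˡ _)) ⟨
      s * P i + t * Q i                        ≡⟨ eq i ⟩
      0#                                       ∎)) P≢0

  independent-nonzero₁ : ∀ {P Q} → Independent (P , Q) → NonzeroW P
  independent-nonzero₁ {P} {Q} ind P≡0 = 0≢1 (sym (proj₁ (ind 1# 0# λ i →
    trans (cong₂ _+_ (trans (*-identityˡ _) (P≡0 i)) (zeroˡ _)) (+-identityˡ 0#))))

  independent-nonzero₂ : ∀ {P Q} → Independent (P , Q) → NonzeroW Q
  independent-nonzero₂ {P} {Q} ind Q≡0 = 0≢1 (sym (proj₂ (ind 0# 1# λ i →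
    trans (cong₂ _+_ (zeroˡ _) (trans (*-identityˡ _) (Q≡0 i))) (+-identityˡ 0#))))

  independent⇒≁ : ∀ {P Q} → Independent (P , Q) → ¬ PropW P Q
  independent⇒≁ {P} {Q} ind (a , a≢0 , eq) = a≢0 (proj₁ (ind a (- 1#) λ i → begin
    a * P i + (- 1#) * Q i     ≡⟨ cong₂ _+_ (sym (eq i)) (trans (sym (-‿distribˡ-* 1# _)) (cong -_ (*-identityˡ _))) ⟩
    Q i - Q i                  ≡⟨ -‿inverseʳ _ ⟩
    0#                         ∎))
    where open ≡-Reasoning

  module TwoPoints {P P′ : W} (L : Line) (P∈L : OnLine P L) (P′∈L : OnLine P′ L) (P≁P′ : ¬ PropW P P′) where
    private
      a = proj₁ L
      b = proj₂ L
      s = proj₁ (proj₂ P∈L)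
      t = proj₁ (proj₂ (proj₂ P∈L))
      P≡ = proj₂ (proj₂ (proj₂ P∈L))
      s′ = proj₁ (proj₂ P′∈L)
      t′ = proj₁ (proj₂ (proj₂ P′∈L))
      P′≡ = proj₂ (proj₂ (proj₂ P′∈L))
      -- The determinant of the coordinates of `P` and `P′` with respect to `a`, `b`. It vanishes
      -- only for proportional points, and `onJoin` is Cramer's rule with denominator `d`.
      d = s * t′ - t * s′

      d≢0 : d ≢ 0#
      d≢0 d≡0 = P≁P′ (by (s ≟ 0#) (t ≟ 0#))
        where
        open ≡-Reasoning
        by : Dec (s ≡ 0#) → Dec (t ≡ 0#) → PropW P P′
        by (no s≢0) _ = propW-cross {c = s} {d = s′} (proj₁ P′∈L) s≢0 λ i → begin
          s * P′ i                            ≡⟨ cong (s *_) (P′≡ i) ⟩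
          s * (s′ * a i + t′ * b i)           ≡⟨ solve 6 (λ s t s′ t′ a b → s :* (s′ :* a :+ t′ :* b) := s′ :* (s :* a :+ t :* b) :+ (s :* t′ :- t :* s′) :* b) refl s t s′ t′ (a i) (b i) ⟩
          s′ * (s * a i + t * b i) + d * b i  ≡⟨ cong₂ _+_ (cong (s′ *_) (sym (P≡ i))) (trans (cong (_* b i) d≡0) (zeroˡ _)) ⟩
          s′ * P i + 0#                       ≡⟨ +-identityʳ _ ⟩
          s′ * P i                            ∎
        by (yes _) (no t≢0) = propW-cross {c = t} {d = t′} (proj₁ P′∈L) t≢0 λ i → begin
          t * P′ i                            ≡⟨ cong (t *_) (P′≡ i) ⟩
          t * (s′ * a i + t′ * b i)           ≡⟨ solve 6 (λ s t s′ t′ a b → t :* (s′ :* a :+ t′ :* b) := t′ :* (s :* a :+ t :* b) :- (s :* t′ :- t :* s′) :* a) refl s t s′ t′ (a i) (b i) ⟩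
          t′ * (s * a i + t * b i) - d * a i  ≡⟨ cong₂ (λ x y → t′ * x - y * a i) (sym (P≡ i)) d≡0 ⟩
          t′ * P i - 0# * a i                 ≡⟨ cong (t′ * P i +_) (trans (cong -_ (zeroˡ _)) -0#≈0#) ⟩
          t′ * P i + 0#                       ≡⟨ +-identityʳ _ ⟩
          t′ * P i                            ∎
        by (yes s≡0) (yes t≡0) = contradiction (λ i → begin
          P i                       ≡⟨ P≡ i ⟩
          s * a i + t * b i         ≡⟨ cong₂ (λ x y → x * a i + y * b i) s≡0 t≡0 ⟩
          0# * a i + 0# * b i       ≡⟨ cong₂ _+_ (zeroˡ _) (zeroˡ _) ⟩
          0# + 0#                   ≡⟨ +-identityˡ 0# ⟩
          0#                        ∎) (proj₁ P∈L)

    onJoin : ∀ {Q} → OnLine Q L → OnLine Q (P , P′)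
    onJoin {Q} (Q≢0 , x , y , Q≡) = Q≢0 , d ⁻¹ * (x * t′ - y * s′) , d ⁻¹ * (y * s - x * t) , λ i →
      *-cancelˡ-nonZero d d≢0 (begin
        d * Q i                                        ≡⟨ cong (d *_) (Q≡ i) ⟩
        d * (x * a i + y * b i)
          ≡⟨ solve 8 (λ x y s t s′ t′ a b →
               (s :* t′ :- t :* s′) :* (x :* a :+ y :* b)
               := (x :* t′ :- y :* s′) :* (s :* a :+ t :* b) :+ (y :* s :- x :* t) :* (s′ :* a :+ t′ :* b)) refl
               x y s t s′ t′ (a i) (b i) ⟩
        (x * t′ - y * s′) * (s * a i + t * b i) + (y * s - x * t) * (s′ * a i + t′ * b i)
          ≡⟨ cong₂ (λ u v → (x * t′ - y * s′) * u + (y * s - x * t) * v) (P≡ i) (P′≡ i) ⟨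
        (x * t′ - y * s′) * P i + (y * s - x * t) * P′ i
          ≡⟨ cong₂ (λ u v → u * P i + v * P′ i) (a*[a⁻¹*x]≡x d≢0 _) (a*[a⁻¹*x]≡x d≢0 _) ⟨
        d * (d ⁻¹ * (x * t′ - y * s′)) * P i + d * (d ⁻¹ * (y * s - x * t)) * P′ i
          ≡⟨ solve 5 (λ d u v p q → d :* u :* p :+ d :* v :* q := d :* (u :* p :+ v :* q)) refl d _ _ (P i) (P′ i) ⟩
        d * (d ⁻¹ * (x * t′ - y * s′) * P i + d ⁻¹ * (y * s - x * t) * P′ i) ∎)
      where open ≡-Reasoning

    fromJoin : ∀ {Q} → OnLine Q (P , P′) → OnLine Q L
    fromJoin {Q} (Q≢0 , x , y , Q≡) = Q≢0 , x * s + y * s′ , x * t + y * t′ , λ i → begin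
      Q i                                                    ≡⟨ Q≡ i ⟩
      x * P i + y * P′ i                                     ≡⟨ cong₂ (λ u v → x * u + y * v) (P≡ i) (P′≡ i) ⟩
      x * (s * a i + t * b i) + y * (s′ * a i + t′ * b i)
        ≡⟨ solve 8 (λ x y s t s′ t′ a b →
             x :* (s :* a :+ t :* b) :+ y :* (s′ :* a :+ t′ :* b) := (x :* s :+ y :* s′) :* a :+ (x :* t :+ y :* t′) :* b) refl
             x y s t s′ t′ (a i) (b i) ⟩
      (x * s + y * s′) * a i + (x * t + y * t′) * b i ∎
      where open ≡-Reasoning

    sameAsJoin : SameLine L (P , P′)
    sameAsJoin Q = mk⇔ onJoin fromJoin

  sameLine-sym : ∀ {L M} → SameLine L M → SameLine M L
  sameLine-sym L~M Q = mk⇔ (Equivalence.from (L~M Q)) (Equivalence.to (L~M Q))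

  sameLine-trans : ∀ {L M N} → SameLine L M → SameLine M N → SameLine L N
  sameLine-trans L~M M~N Q = mk⇔ (λ z → Equivalence.to (M~N Q) (Equivalence.to (L~M Q) z))
                                 (λ z → Equivalence.from (L~M Q) (Equivalence.from (M~N Q) z))

  two-points : ∀ {P P′} L M → ¬ PropW P P′ → OnLine P L → OnLine P′ L → OnLine P M → OnLine P′ M → SameLine L M
  two-points {P} {P′} L M P≁P′ PL P′L PM P′M =
    sameLine-trans {L} {P , P′} {M} (TwoPoints.sameAsJoin L PL P′L P≁P′)
      (sameLine-sym {M} {P , P′} (TwoPoints.sameAsJoin M PM P′M P≁P′))

  ⟨_,_⟩ : W → W → Carrier
  ⟨ h , P ⟩ = h 0F * P 0F + h 1F * P 1F + h 2F * P 2F + h 3F * P 3F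

  ⟨⟩-linear : ∀ h {P a b s t} → (∀ i → P i ≡ s * a i + t * b i) → ⟨ h , P ⟩ ≡ s * ⟨ h , a ⟩ + t * ⟨ h , b ⟩
  ⟨⟩-linear h {P} {a} {b} {s} {t} eq = trans
    (cong₂ _+_ (cong₂ _+_ (cong₂ _+_ (cong (h 0F *_) (eq 0F)) (cong (h 1F *_) (eq 1F))) (cong (h 2F *_) (eq 2F))) (cong (h 3F *_) (eq 3F)))
    (solve 14 (λ h₀ h₁ h₂ h₃ a₀ a₁ a₂ a₃ b₀ b₁ b₂ b₃ s t →
        h₀ :* (s :* a₀ :+ t :* b₀) :+ h₁ :* (s :* a₁ :+ t :* b₁) :+ h₂ :* (s :* a₂ :+ t :* b₂) :+ h₃ :* (s :* a₃ :+ t :* b₃)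
        := s :* (h₀ :* a₀ :+ h₁ :* a₁ :+ h₂ :* a₂ :+ h₃ :* a₃) :+ t :* (h₀ :* b₀ :+ h₁ :* b₁ :+ h₂ :* b₂ :+ h₃ :* b₃)) refl
      (h 0F) (h 1F) (h 2F) (h 3F) (a 0F) (a 1F) (a 2F) (a 3F) (b 0F) (b 1F) (b 2F) (b 3F) s t)

  inPlane-resp : ∀ h {P P′} → PropW P P′ → InPlane h P → InPlane h P′
  inPlane-resp h {P} {P′} P~P′@(a , _ , eq) (P≢0 , hP) = propW-nonzero P~P′ P≢0 , (begin
    ⟨ h , P′ ⟩                           ≡⟨ ⟨⟩-linear h {P′} {P} {P} {a} {0#} (λ i → trans (eq i) (sym (trans (cong (a * P i +_) (zeroˡ _)) (+-identityʳ _)))) ⟩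
    a * ⟨ h , P ⟩ + 0# * ⟨ h , P ⟩       ≡⟨ cong (λ z → a * z + 0# * z) hP ⟩
    a * 0# + 0# * 0#                     ≡⟨ cong₂ _+_ (zeroʳ a) (zeroʳ 0#) ⟩
    0# + 0#                              ≡⟨ +-identityˡ 0# ⟩
    0#                                   ∎)
    where open ≡-Reasoning

  join⊆plane : ∀ h {P P′} → InPlane h P → InPlane h P′ → ∀ {Q} → OnLine Q (P , P′) → InPlane h Q
  join⊆plane h {P} {P′} (_ , hP) (_ , hP′) {Q} (Q≢0 , s , t , Q≡) = Q≢0 , (begin
    ⟨ h , Q ⟩                            ≡⟨ ⟨⟩-linear h {Q} {P} {P′} Q≡ ⟩
    s * ⟨ h , P ⟩ + t * ⟨ h , P′ ⟩       ≡⟨ cong₂ (λ x y → s * x + t * y) hP hP′ ⟩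
    s * 0# + t * 0#                      ≡⟨ cong₂ _+_ (zeroʳ s) (zeroʳ t) ⟩
    0# + 0#                              ≡⟨ +-identityˡ 0# ⟩
    0#                                   ∎)
    where open ≡-Reasoning

-- Points of PG(3,q) described by the quadric points of the lines through them

module KleinCorrespondence {q} (F : FiniteField q) (E : FiniteField (q ^ 3)) (emb : Embedding F E)
                           (α : FiniteField.Carrier E) (prim : Primitive E α)
                           (p h : Geometry.W F E emb) (p≢0 : Geometry.NonzeroW F E emb p)
                           (K : Geometry.Klein F E emb p h) where
  private module F = FieldTheory F
  open FieldTheory E
  open CubicExtension F E emb α prim
  open Geometry F E emb hiding (module F; module E)
  open Projective F E emb
  open Embedding emb
  open Klein K

  T≡tr : ∀ x → T x ≡ tr x
  T≡tr x = cong (x + φ x +_) (pow-* x q q)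

  qpt : ∀ {u v} → NonzeroV (u , v) → tr (u * v) ≡ 0# → QPt (u , v)
  qpt {u} {v} ≢0 eq = ≢0 , trans (T≡tr (u * v)) eq

  qptˡ : ∀ {u v} → u ≢ 0# → tr (u * v) ≡ 0# → QPt (u , v)
  qptˡ u≢0 = qpt (λ eq → u≢0 (cong proj₁ eq))

  qptʳ : ∀ {u v} → v ≢ 0# → tr (u * v) ≡ 0# → QPt (u , v)
  qptʳ v≢0 = qpt (λ eq → v≢0 (cong proj₂ eq))

  qpt-π₁ : ∀ {u} → u ≢ 0# → QPt (u , 0#)
  qpt-π₁ u≢0 = qptˡ u≢0 (tr-*0 _)

  qpt-π₂ : ∀ {v} → v ≢ 0# → QPt (0# , v)
  qpt-π₂ v≢0 = qptʳ v≢0 (tr-0* _)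

  qpt-tr : ∀ {u v} → QPt (u , v) → tr (u * v) ≡ 0#
  qpt-tr {u} {v} (_ , eq) = trans (sym (T≡tr (u * v))) eq

  qpt-≡0ˡ : ∀ {u v} → QPt (u , v) → u ≡ 0# → v ≢ 0#
  qpt-≡0ˡ (≢0 , _) u≡0 v≡0 = ≢0 (cong₂ _,_ u≡0 v≡0)

  qpt-≡0ʳ : ∀ {u v} → QPt (u , v) → v ≡ 0# → u ≢ 0#
  qpt-≡0ʳ (≢0 , _) v≡0 u≡0 = ≢0 (cong₂ _,_ u≡0 v≡0)

  polar : V → V → Carrier
  polar (u , v) (u′ , v′) = tr (u * v′) + tr (u′ * v)

  Qf-combination : ∀ x y a b → Qf ((a ·V x) +V (b ·V y)) ≡
                   ι a * (ι a * Qf x) + (ι a * (ι b * polar x y) + ι b * (ι b * Qf y))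
  Qf-combination (u , v) (u′ , v′) a b = begin
    T ((ι a * u + ι b * u′) * (ι a * v + ι b * v′))
      ≡⟨ T≡tr _ ⟩
    tr ((ι a * u + ι b * u′) * (ι a * v + ι b * v′))
      ≡⟨ cong tr (solve 6 (λ a b u v u′ v′ → (a :* u :+ b :* u′) :* (a :* v :+ b :* v′)
           := a :* (a :* (u :* v)) :+ (a :* (b :* (u :* v′ :+ u′ :* v)) :+ b :* (b :* (u′ :* v′)))) refl
           (ι a) (ι b) u v u′ v′) ⟩
    tr (ι a * (ι a * (u * v)) + (ι a * (ι b * (u * v′ + u′ * v)) + ι b * (ι b * (u′ * v′))))
      ≡⟨ trans (tr-+ _ _) (cong (tr (ι a * (ι a * (u * v))) +_) (tr-+ _ _)) ⟩
    tr (ι a * (ι a * (u * v))) + (tr (ι a * (ι b * (u * v′ + u′ * v))) + tr (ι b * (ι b * (u′ * v′))))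
      ≡⟨ cong₂ _+_ (tr-ι*ι* a a (u * v)) (cong₂ _+_ (tr-ι*ι* a b (u * v′ + u′ * v)) (tr-ι*ι* b b (u′ * v′))) ⟩
    ι a * (ι a * tr (u * v)) + (ι a * (ι b * tr (u * v′ + u′ * v)) + ι b * (ι b * tr (u′ * v′)))
      ≡⟨ cong₂ (λ s t → ι a * (ι a * s) + (ι a * (ι b * tr (u * v′ + u′ * v)) + ι b * (ι b * t))) (T≡tr _) (T≡tr _) ⟨
    ι a * (ι a * Qf (u , v)) + (ι a * (ι b * tr (u * v′ + u′ * v)) + ι b * (ι b * Qf (u′ , v′)))
      ≡⟨ cong (λ s → ι a * (ι a * Qf (u , v)) + (ι a * (ι b * s) + ι b * (ι b * Qf (u′ , v′)))) (tr-+ _ _) ⟩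
    ι a * (ι a * Qf (u , v)) + (ι a * (ι b * polar (u , v) (u′ , v′)) + ι b * (ι b * Qf (u′ , v′))) ∎
    where
    open ≡-Reasoning
    tr-ι*ι* : ∀ a b x → tr (ι a * (ι b * x)) ≡ ι a * (ι b * tr x)
    tr-ι*ι* a b x = trans (tr-ι* a _) (cong (ι a *_) (tr-ι* b x))

  meet⇒polar≡0 : ∀ {P} x y → QPt x → QPt y → OnLine P (κ x) → OnLine P (κ y) → polar x y ≡ 0#
  meet⇒polar≡0 {P} x y qx qy Px Py = begin
    polar x y
      ≡⟨ solve 1 (λ s → s := con (ℤ.+ 1) :* (con (ℤ.+ 1) :* con (ℤ.+ 0)) :+ (con (ℤ.+ 1) :* (con (ℤ.+ 1) :* s) :+ con (ℤ.+ 1) :* (con (ℤ.+ 1) :* con (ℤ.+ 0)))) refl (polar x y) ⟩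
    -- The coefficient `con (ℤ.+ 1)` evaluates to `1# + 0#`; it is turned into `ι F.1#` to match the
    -- combination x + y, whose value under `Qf` is the polar form because both points are singular.
    _ ≡⟨ cong (λ e → e * (e * 0#) + (e * (e * polar x y) + e * (e * 0#))) (trans (+-identityʳ 1#) (sym ι-1)) ⟩
    ι F.1# * (ι F.1# * 0#) + (ι F.1# * (ι F.1# * polar x y) + ι F.1# * (ι F.1# * 0#))
      ≡⟨ cong₂ (λ s t → ι F.1# * (ι F.1# * s) + (ι F.1# * (ι F.1# * polar x y) + ι F.1# * (ι F.1# * t))) (proj₂ qx) (proj₂ qy) ⟨
    ι F.1# * (ι F.1# * Qf x) + (ι F.1# * (ι F.1# * polar x y) + ι F.1# * (ι F.1# * Qf y))
      ≡⟨ Qf-combination x y F.1# F.1# ⟨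
    Qf ((F.1# ·V x) +V (F.1# ·V y))
      ≡⟨ Equivalence.from (collin x y qx qy) (P , Px , Py) F.1# F.1# ⟩
    0# ∎
    where open ≡-Reasoning

  polar≡0⇒meet : ∀ x y → QPt x → QPt y → polar x y ≡ 0# → Meet (κ x) (κ y)
  polar≡0⇒meet x y qx qy eq = Equivalence.to (collin x y qx qy) λ a b → begin
    Qf ((a ·V x) +V (b ·V y))
      ≡⟨ Qf-combination x y a b ⟩
    ι a * (ι a * Qf x) + (ι a * (ι b * polar x y) + ι b * (ι b * Qf y))
      ≡⟨ cong₂ _+_ (vanish (proj₂ qx)) (cong₂ _+_ (vanish eq) (vanish (proj₂ qy))) ⟩
    0# + (0# + 0#)
      ≡⟨ trans (+-identityˡ _) (+-identityˡ 0#) ⟩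
    0# ∎
    where
    open ≡-Reasoning
    vanish : ∀ {s t z} → z ≡ 0# → s * (t * z) ≡ 0#
    vanish {s} {t} z≡0 = trans (cong (λ z → s * (t * z)) z≡0) (trans (cong (s *_) (zeroʳ t)) (zeroʳ s))

  polar-π₁ : ∀ {x y u} → tr (u * y) ≡ 0# → polar (x , y) (u , 0#) ≡ 0#
  polar-π₁ {x} eq = trans (cong₂ _+_ (tr-*0 x) eq) (+-identityˡ 0#)

  polar-π₁⁻¹ : ∀ {x y u} → polar (x , y) (u , 0#) ≡ 0# → tr (u * y) ≡ 0#
  polar-π₁⁻¹ {x} {y} {u} eq = trans (sym (trans (cong (_+ tr (u * y)) (tr-*0 x)) (+-identityˡ _))) eq

  polar-π₂ : ∀ {x y v} → tr (x * v) ≡ 0# → polar (x , y) (0# , v) ≡ 0#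
  polar-π₂ {y = y} eq = trans (cong₂ _+_ eq (tr-0* y)) (+-identityʳ 0#)

  polar-π₂⁻¹ : ∀ {x y v} → polar (x , y) (0# , v) ≡ 0# → tr (x * v) ≡ 0#
  polar-π₂⁻¹ {x} {y} {v} eq = trans (sym (trans (cong (tr (x * v) +_) (tr-0* y)) (+-identityʳ _))) eq

  κ-resp : ∀ {P} x y → QPt x → QPt y → PropV x y → OnLine P (κ x) → OnLine P (κ y)
  κ-resp {P} x y qx qy x~y = Equivalence.to (wellDef x y qx qy x~y P)

  -- Distinct quadric points give distinct lines, and these share at most one point: two
  -- non-proportional common points would force the lines to agree by `two-points`, contradicting
  -- `inj`.
  point-unique : ∀ {P P′} x y → QPt x → QPt y → ¬ PropV x y →
                 OnLine P (κ x) → OnLine P′ (κ x) → OnLine P (κ y) → OnLine P′ (κ y) → PropW P P′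
  point-unique {P} {P′} x y qx qy x≁y Px P′x Py P′y = Dec.decidable-stable (propW? P P′) λ P≁P′ →
    x≁y (inj x y qx qy (two-points (κ x) (κ y) P≁P′ Px P′x Py P′y))

  π₁∥ : ∀ {u x} → PropV (u , 0#) x → proj₂ x ≡ 0#
  π₁∥ (a , _ , refl) = zeroʳ (ι a)

  π₂∥ : ∀ {v x} → PropV (0# , v) x → proj₁ x ≡ 0#
  π₂∥ (a , _ , refl) = zeroʳ (ι a)

  p∈κ⇒π₁ : ∀ x → QPt x → OnLine p (κ x) → proj₂ x ≡ 0#
  p∈κ⇒π₁ x qx px = π₁∥ (inj (proj₁ l , 0#) x (qpt-π₁ (proj₁ (proj₂ l))) qx (proj₂ (proj₂ l)))
    where
    l : ∃ λ u → u ≢ 0# × SameLine (κ (u , 0#)) (κ x)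
    l = p→π₁ (κ x) (indep x qx) px

  -- A line with two distinct points in `h` is their join, hence lies in `h` and comes from a point
  -- of π₂.
  κ⊆h⇒π₂ : ∀ {P P′} x → QPt x → OnLine P (κ x) → OnLine P′ (κ x) → InPlane h P → InPlane h P′ → ¬ PropW P P′ → proj₁ x ≡ 0#
  κ⊆h⇒π₂ {P} {P′} x qx Px P′x Ph P′h P≁P′ =
    π₂∥ (inj (0# , proj₁ l) x (qpt-π₂ (proj₁ (proj₂ l))) qx
      (sameLine-trans {κ (0# , proj₁ l)} {P , P′} {κ x} (proj₂ (proj₂ l))
        (sameLine-sym {κ x} {P , P′} (TwoPoints.sameAsJoin (κ x) Px P′x P≁P′))))
    where
    l : ∃ λ v → v ≢ 0# × SameLine (κ (0# , v)) (P , P′)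
    l = π→π₂ (P , P′) (join-independent (proj₁ Ph) (proj₁ P′h) P≁P′) (λ Q → join⊆plane h Ph P′h)

  h-point-unique : ∀ {P P′} x → QPt x → proj₁ x ≢ 0# → OnLine P (κ x) → OnLine P′ (κ x) → InPlane h P → InPlane h P′ → PropW P P′
  h-point-unique {P} {P′} x qx x≢0 Px P′x Ph P′h =
    Dec.decidable-stable (propW? P P′) λ P≁P′ → x≢0 (κ⊆h⇒π₂ x qx Px P′x Ph P′h P≁P′)

  1≢0 : 1# ≢ 0#
  1≢0 eq = 0≢1 (sym eq)

  -- A line in h through p would correspond to a point of both π₁ and π₂.
  p∉h : ¬ InPlane h p
  p∉h ph = distinct (propW? p a) (propW? p b)
    where
    L : Line
    L = κ (0# , 1#)
    a b : W
    a = proj₁ L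
    b = proj₂ L
    L-indep : Independent (a , b)
    L-indep = indep _ (qpt-π₂ 1≢0)
    a∈h : InPlane h a
    a∈h = π₂→π 1# 1≢0 a (onLine₁ (independent-nonzero₁ L-indep))
    b∈h : InPlane h b
    b∈h = π₂→π 1# 1≢0 b (onLine₂ (independent-nonzero₂ L-indep))
    no-line : ∀ {Q} → InPlane h Q → ¬ PropW p Q → ⊥
    no-line {Q} Qh p≁Q = proj₁ (proj₂ l) (κ⊆h⇒π₂ (proj₁ l , 0#) (qpt-π₁ (proj₁ (proj₂ l)))
        (Equivalence.from (proj₂ (proj₂ l) p) (onLine₁ p≢0))
        (Equivalence.from (proj₂ (proj₂ l) Q) (onLine₂ (proj₁ Qh))) ph Qh p≁Q)
      where
      l : ∃ λ u → u ≢ 0# × SameLine (κ (u , 0#)) (p , Q)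
      l = p→π₁ (p , Q) (join-independent p≢0 (proj₁ Qh) p≁Q) (onLine₁ p≢0)
    -- The two spanning points of a line in `h` cannot both be `p`; joining `p` to the other one
    -- gives a line that `no-line` forbids.
    distinct : Dec (PropW p a) → Dec (PropW p b) → ⊥
    distinct (no p≁a)  _         = no-line a∈h p≁a
    distinct (yes _)   (no p≁b)  = no-line b∈h p≁b
    distinct (yes p~a) (yes p~b) = independent⇒≁ L-indep (propW-trans (propW-sym p~a) p~b)

  line-through-p : ∀ {P} → NonzeroW P → ∃ λ u → u ≢ 0# × OnLine P (κ (u , 0#))
  line-through-p {P} P≢0 = by (propW? p P)
    where
    by : Dec (PropW p P) → ∃ λ u → u ≢ 0# × OnLine P (κ (u , 0#))
    by (yes p~P) = 1# , 1≢0 , onLine-resp _ p~P (π₁→p 1# 1≢0)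
    by (no  p≁P) = proj₁ l , proj₁ (proj₂ l) , Equivalence.from (proj₂ (proj₂ l) P) (onLine₂ P≢0)
      where
      l : ∃ λ u → u ≢ 0# × SameLine (κ (u , 0#)) (p , P)
      l = p→π₁ (p , P) (join-independent p≢0 P≢0 p≁P) (onLine₁ p≢0)

  -- The lines through a point form a plane of Q⁺(5,q): disjoint from π₂ for a point off h, and
  -- meeting π₂ in a line for a point in h. In the latter case u matters only up to F*.
  OffPlane : Carrier → W → Set
  OffPlane β P = ∀ x y → QPt (x , y) → (OnLine P (κ (x , y)) ⇔ y ≡ x ⨯ β)

  OnPlane : Carrier → W → Set
  OnPlane u P = ∀ x y → QPt (x , y) → (OnLine P (κ (x , y)) ⇔ (x ⨯ u ≡ 0# × tr (u * y) ≡ 0#))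

  -- The line κ (u , 0) is not in `h`, so P is its only point there. For v orthogonal to u, the line
  -- κ (0 , v) lies in `h` and meets κ (u , 0), hence passes through P (`on-π₂`). Lines through P
  -- meet all of these lines, which pins down their quadric points.
  classify-on : ∀ {P u} → InPlane h P → u ≢ 0# → OnLine P (κ (u , 0#)) → OnPlane u P
  classify-on {P} {u} Ph u≢0 Pu x y qx = mk⇔ forward (λ (xu , uy) → backward xu uy (x ≟ 0#) (y ≟ 0#))
    where
    on-π₂ : ∀ {v} → v ≢ 0# → tr (u * v) ≡ 0# → OnLine P (κ (0# , v))
    on-π₂ {v} v≢0 uv = onLine-resp _ (h-point-unique _ (qpt-π₁ u≢0) u≢0 (proj₁ (proj₂ m)) Pu
                         (π₂→π v v≢0 _ (proj₂ (proj₂ m))) Ph) (proj₂ (proj₂ m))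
      where
      m : Meet (κ (u , 0#)) (κ (0# , v))
      m = polar≡0⇒meet _ _ (qpt-π₁ u≢0) (qpt-π₂ v≢0) (polar-π₂ uv)

    forward : OnLine P (κ (x , y)) → x ⨯ u ≡ 0# × tr (u * y) ≡ 0#
    forward Px = Dec.decidable-stable (x ⨯ u ≟ 0#) parallel , polar-π₁⁻¹ (meet⇒polar≡0 _ _ qx (qpt-π₁ u≢0) Px Pu)
      where
      parallel : ¬ ¬ (x ⨯ u ≡ 0#)
      -- If x were not parallel to u, some s would have tr (s (x ⨯ u)) nonzero. By cyclicity this is
      -- tr (x v) for v = u ⨯ s, which is orthogonal to u, so that κ (x , y) and κ (0 , v) meet in P
      -- and the trace is zero.
      parallel xu≢0 = proj₂ w (trans (tr-⨯-cycle s x u)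
          (polar-π₂⁻¹ (meet⇒polar≡0 _ _ qx (qpt-π₂ v≢0) Px (on-π₂ v≢0 (tr-x[x⨯y]≡0 u s)))))
        where
        w : ∃ λ s → tr (s * (x ⨯ u)) ≢ 0#
        w = tr-witness xu≢0
        s = proj₁ w
        v≢0 : u ⨯ s ≢ 0#
        v≢0 eq = proj₂ w (trans (tr-⨯-cycle s x u) (trans (cong (λ z → tr (x * z)) eq) (tr-*0 x)))

    backward : x ⨯ u ≡ 0# → tr (u * y) ≡ 0# → Dec (x ≡ 0#) → Dec (y ≡ 0#) → OnLine P (κ (x , y))
    backward xu uy (yes x≡0) _ = subst (λ x → OnLine P (κ (x , y))) (sym x≡0) (on-π₂ (qpt-≡0ˡ qx x≡0) uy)
    backward xu uy (no x≢0) (yes y≡0) = κ-resp _ _ (qpt-π₁ u≢0) qx (a , a≢0 , cong₂ _,_ (proj₂ x∥u) (trans y≡0 (sym (zeroʳ _)))) Pu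
      where
      x∥u : ∃ λ a → x ≡ ι a * u
      x∥u = ⨯≡0⇒∥ u≢0 xu
      a = proj₁ x∥u
      a≢0 : a ≢ F.0#
      a≢0 a≡0 = x≢0 (trans (proj₂ x∥u) (trans (cong (_* u) (trans (cong ι a≡0) ι-0)) (zeroˡ u)))
    -- κ (x , y) meets both κ (0 , y) and κ (0 , v), and has only one point in `h` because x is
    -- nonzero. That point lies on two distinct lines through P, so it is P. The choice of s makes v
    -- independent of y: tr (s v) vanishes while tr (s y) does not.
    backward xu uy (no x≢0) (no y≢0) = onLine-resp _ R~P (proj₁ (proj₂ m₁))
      where
      x∥u : ∃ λ a → x ≡ ι a * u
      x∥u = ⨯≡0⇒∥ u≢0 xu
      w : ∃ λ s → tr (s * y) ≢ 0#
      w = tr-witness y≢0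
      s v : Carrier
      s = proj₁ w
      v = u ⨯ s
      uv : tr (u * v) ≡ 0#
      uv = tr-x[x⨯y]≡0 u s
      xv : tr (x * v) ≡ 0#
      xv = trans (cong (λ z → tr (z * v)) (proj₂ x∥u)) (trans (cong tr (*-assoc _ u v)) (trans (tr-ι* _ (u * v))
             (trans (cong (ι (proj₁ x∥u) *_) uv) (zeroʳ _))))
      v≢0 : v ≢ 0#
      v≢0 eq = proj₂ w (trans (cong (λ z → tr (z * y)) (proj₂ s∥u)) (trans (cong tr (*-assoc _ u y)) (trans (tr-ι* _ (u * y))
             (trans (cong (ι (proj₁ s∥u) *_) uy) (zeroʳ _)))))
        where
        s∥u : ∃ λ a → s ≡ ι a * u
        s∥u = ⨯≡0⇒∥ u≢0 (⨯-antisym-0 eq)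
      y≁v : ¬ PropV (0# , y) (0# , v)
      y≁v (c , c≢0 , eq) = proj₂ w (integral (ι-nonZero c≢0) (begin
        ι c * tr (s * y)      ≡⟨ tr-ι* c (s * y) ⟨
        tr (ι c * (s * y))    ≡⟨ cong tr (solve 3 (λ c s y → c :* (s :* y) := s :* (c :* y)) refl (ι c) s y) ⟩
        tr (s * (ι c * y))    ≡⟨ cong (λ z → tr (s * z)) (cong proj₂ eq) ⟨
        tr (s * v)            ≡⟨ tr-y[x⨯y]≡0 u s ⟩
        0#                    ∎))
        where open ≡-Reasoning
      m₁ : Meet (κ (x , y)) (κ (0# , y))
      m₁ = polar≡0⇒meet _ _ qx (qpt-π₂ y≢0) (polar-π₂ (qpt-tr qx))
      m₂ : Meet (κ (x , y)) (κ (0# , v))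
      m₂ = polar≡0⇒meet _ _ qx (qpt-π₂ v≢0) (polar-π₂ xv)
      R₂~R₁ : PropW (proj₁ m₂) (proj₁ m₁)
      R₂~R₁ = h-point-unique _ qx x≢0 (proj₁ (proj₂ m₂)) (proj₁ (proj₂ m₁))
                (π₂→π v v≢0 _ (proj₂ (proj₂ m₂))) (π₂→π y y≢0 _ (proj₂ (proj₂ m₁)))
      R~P : PropW (proj₁ m₁) P
      R~P = point-unique _ _ (qpt-π₂ y≢0) (qpt-π₂ v≢0) y≁v (proj₂ (proj₂ m₁)) (on-π₂ y≢0 uy)
              (onLine-resp _ R₂~R₁ (proj₂ (proj₂ m₂))) (on-π₂ v≢0 uv)

  point-on : ∀ {u} → u ≢ 0# → ∃ λ P → InPlane h P × OnPlane u P
  point-on {u} u≢0 = proj₁ m , P∈h , classify-on P∈h u≢0 (proj₁ (proj₂ m))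
    where
    v : Carrier
    v = (α * u) ⨯ u
    v≢0 : v ≢ 0#
    v≢0 = αu⨯u≢0 u≢0
    m : Meet (κ (u , 0#)) (κ (0# , v))
    m = polar≡0⇒meet _ _ (qpt-π₁ u≢0) (qpt-π₂ v≢0) (polar-π₂ (tr-y[x⨯y]≡0 (α * u) u))
    P∈h : InPlane h (proj₁ m)
    P∈h = π₂→π v v≢0 _ (proj₂ (proj₂ m))

  on-h : ∀ {P x} → QPt x → proj₁ x ≡ 0# → OnLine P (κ x) → InPlane h P
  on-h {P} {_ , y} qx refl Px = π₂→π y (qpt-≡0ˡ qx refl) P Px

  -- The lines through a point off the plane form a graph

  module OffPlaneGraph {P} (P≢0 : NonzeroW P) (P∉h : ¬ InPlane h P) where

    -- Join P to the point R of `h` with label x. The lines through R have first coordinate in F x,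
    -- and for the join it is nonzero because P is off `h`; rescaling makes it equal to x.
    on-graph : ∀ {x} → x ≢ 0# → ∃ λ y → QPt (x , y) × OnLine P (κ (x , y))
    on-graph {x} x≢0 = y , qxy , κ-resp _ _ qz qxy z~xy Pz
      where
      open ≡-Reasoning
      R-data : ∃ λ R → InPlane h R × OnPlane x R
      R-data = point-on x≢0
      R : W
      R = proj₁ R-data
      R∈h : InPlane h R
      R∈h = proj₁ (proj₂ R-data)
      R≁P : ¬ PropW R P
      R≁P R~P = P∉h (inPlane-resp h R~P R∈h)
      l : ∃ λ z → QPt z × SameLine (κ z) (R , P)
      l = surj (R , P) (join-independent (proj₁ R∈h) P≢0 R≁P)
      z : V
      z = proj₁ l
      x′ y′ : Carrier
      x′ = proj₁ z
      y′ = proj₂ z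
      qz : QPt z
      qz = proj₁ (proj₂ l)
      Pz : OnLine P (κ z)
      Pz = Equivalence.from (proj₂ (proj₂ l) P) (onLine₂ P≢0)
      Rz : OnLine R (κ z)
      Rz = Equivalence.from (proj₂ (proj₂ l) R) (onLine₁ (proj₁ R∈h))
      x′∥x : ∃ λ a → x′ ≡ ι a * x
      x′∥x = ⨯≡0⇒∥ x≢0 (proj₁ (Equivalence.to (proj₂ (proj₂ R-data) x′ y′ qz) Rz))
      a : F.Carrier
      a = proj₁ x′∥x
      a≢0 : a ≢ F.0#
      a≢0 a≡0 = P∉h (on-h qz (trans (proj₂ x′∥x) (trans (cong (_* x) (trans (cong ι a≡0) ι-0)) (zeroˡ x))) Pz)
      y : Carrier
      y = ι a ⁻¹ * y′
      y′≡ay : y′ ≡ ι a * y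
      y′≡ay = sym (a*[a⁻¹*x]≡x (ι-nonZero a≢0) y′)
      qxy : QPt (x , y)
      qxy = qptˡ x≢0 (integral (ι-nonZero a≢0) (integral (ι-nonZero a≢0) (begin
        ι a * (ι a * tr (x * y))       ≡⟨ cong (ι a *_) (tr-ι* a (x * y)) ⟨
        ι a * tr (ι a * (x * y))       ≡⟨ tr-ι* a (ι a * (x * y)) ⟨
        tr (ι a * (ι a * (x * y)))     ≡⟨ cong tr (solve 3 (λ a x y → a :* (a :* (x :* y)) := (a :* x) :* (a :* y)) refl (ι a) x y) ⟩
        tr ((ι a * x) * (ι a * y))     ≡⟨ cong₂ (λ s t → tr (s * t)) (proj₂ x′∥x) y′≡ay ⟨
        tr (x′ * y′)                   ≡⟨ qpt-tr qz ⟩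
        0#                             ∎)))
      z~xy : PropV z (x , y)
      z~xy = a F.⁻¹ , F.⁻¹-nonZero a≢0 , cong₂ _,_ (undo x x′ (proj₂ x′∥x)) (undo y y′ y′≡ay)
        where
        undo : ∀ s s′ → s′ ≡ ι a * s → s ≡ ι (a F.⁻¹) * s′
        undo s s′ eq = begin
          s                             ≡⟨ *-identityˡ s ⟨
          1# * s                        ≡⟨ cong (_* s) ι-1 ⟨
          ι F.1# * s                    ≡⟨ cong (λ b → ι b * s) (trans (F.*-comm _ a) (F.⁻¹-inverse a a≢0)) ⟨
          ι (a F.⁻¹ F.* a) * s          ≡⟨ cong (_* s) (ι-* _ a) ⟩
          ι (a F.⁻¹) * ι a * s          ≡⟨ *-assoc _ _ s ⟩
          ι (a F.⁻¹) * (ι a * s)        ≡⟨ cong (ι (a F.⁻¹) *_) eq ⟨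
          ι (a F.⁻¹) * s′               ∎

    u-data : ∃ λ u → u ≢ 0# × OnLine P (κ (u , 0#))
    u-data = line-through-p P≢0

    u x₀ : Carrier
    u = proj₁ u-data
    x₀ = α * u

    u≢0 : u ≢ 0#
    u≢0 = proj₁ (proj₂ u-data)

    x₀≢0 : x₀ ≢ 0#
    x₀≢0 = *-nonZero α≢0 u≢0

    y₀-data : ∃ λ y → QPt (x₀ , y) × OnLine P (κ (x₀ , y))
    y₀-data = on-graph x₀≢0

    y₀ : Carrier
    y₀ = proj₁ y₀-data

    pairing-u : ∀ {x y} → QPt (x , y) → OnLine P (κ (x , y)) → tr (u * y) ≡ 0#
    pairing-u qxy Pxy = polar-π₁⁻¹ (meet⇒polar≡0 _ _ qxy (qpt-π₁ u≢0) Pxy (proj₂ (proj₂ u-data)))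

    -- y₀ is orthogonal to x₀ because the point is singular, and to u because both lines pass
    -- through P.
    y₀∥x₀⨯u : ∃ λ a → y₀ ≡ ι a * (x₀ ⨯ u)
    y₀∥x₀⨯u = ⊥⊥⇒∥⨯ (αu⨯u≢0 u≢0) (qpt-tr (proj₁ (proj₂ y₀-data))) (pairing-u (proj₁ (proj₂ y₀-data)) (proj₂ (proj₂ y₀-data)))

    -- The point (u , 0) belongs to P's plane, which forces u ⨯ β = 0 and makes β a multiple of u;
    -- the factor is dictated by the value y₀ at x₀.
    β : Carrier
    β = ι (proj₁ y₀∥x₀⨯u) * u

    y₀≡x₀⨯β : y₀ ≡ x₀ ⨯ β
    y₀≡x₀⨯β = trans (proj₂ y₀∥x₀⨯u) (sym (⨯-ι* _ x₀ u))

    -- Points through P are pairwise collinear, so P's plane is the graph of a skew map; comparing it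
    -- with x ↦ x ⨯ β, the deviation is orthogonal to every x₁ at which the two already agree.
    orthogonal : ∀ {x y x₁ y₁} → QPt (x , y) → OnLine P (κ (x , y)) → QPt (x₁ , y₁) → OnLine P (κ (x₁ , y₁)) →
                 y₁ ≡ x₁ ⨯ β → tr (x₁ * (y - x ⨯ β)) ≡ 0#
    orthogonal {x} {y} {x₁} {y₁} qxy Pxy q₁ P₁ eq = begin
      tr (x₁ * (y - x ⨯ β))                  ≡⟨ cong tr (solve 3 (λ x y z → x :* (y :- z) := x :* y :- x :* z) refl x₁ y (x ⨯ β)) ⟩
      tr (x₁ * y - x₁ * (x ⨯ β))             ≡⟨ tr-- _ _ ⟩
      tr (x₁ * y) - tr (x₁ * (x ⨯ β))        ≡⟨ solve 3 (λ a b c → b :- c := (a :+ b) :- (a :+ c)) refl (tr (x * y₁)) _ _ ⟩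
      (tr (x * y₁) + tr (x₁ * y)) - (tr (x * y₁) + tr (x₁ * (x ⨯ β)))
        ≡⟨ cong₂ _-_ (meet⇒polar≡0 _ _ qxy q₁ Pxy P₁)
             (trans (cong (λ z → tr (x * z) + tr (x₁ * (x ⨯ β))) eq) (tr-⨯-skew x x₁ β)) ⟩
      0# - 0#                                ≡⟨ -‿inverseʳ 0# ⟩
      0#                                     ∎
      where open ≡-Reasoning

    orthogonal-u : ∀ {x y} → QPt (x , y) → OnLine P (κ (x , y)) → tr (u * (y - x ⨯ β)) ≡ 0#
    orthogonal-u qxy Pxy = orthogonal qxy Pxy (qpt-π₁ u≢0) (proj₂ (proj₂ u-data))
      (sym (trans (⨯-ι* a u u) (trans (cong (ι a *_) (⨯-self u)) (zeroʳ (ι a)))))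
      where a = proj₁ y₀∥x₀⨯u

    orthogonal-x₀ : ∀ {x y} → QPt (x , y) → OnLine P (κ (x , y)) → tr (x₀ * (y - x ⨯ β)) ≡ 0#
    orthogonal-x₀ qxy Pxy = orthogonal qxy Pxy (proj₁ (proj₂ y₀-data)) (proj₂ (proj₂ y₀-data)) y₀≡x₀⨯β

    -- A third vector completing x₀, u to a basis: the nonzero trace is their determinant, as
    -- `tr-nondegenerate` requires.
    x₁-data : ∃ λ s → tr (s * (x₀ ⨯ u)) ≢ 0#
    x₁-data = tr-witness (αu⨯u≢0 u≢0)

    x₁ : Carrier
    x₁ = proj₁ x₁-data

    x₁≢0 : x₁ ≢ 0#
    x₁≢0 eq = proj₂ x₁-data (trans (cong (λ z → tr (z * (x₀ ⨯ u))) eq) (tr-0* _))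

    y₁-data : ∃ λ y → QPt (x₁ , y) × OnLine P (κ (x₁ , y))
    y₁-data = on-graph x₁≢0

    -- The graph is so far known only at u and x₀. At x₁ the third orthogonality comes for free,
    -- since y₁ and x₁ ⨯ β are both orthogonal to x₁ itself.
    y₁≡x₁⨯β : proj₁ y₁-data ≡ x₁ ⨯ β
    y₁≡x₁⨯β = x-y≡0⇒x≡y (tr-nondegenerate x₀ u x₁ (proj₂ x₁-data) (orthogonal-x₀ q₁ P₁) (orthogonal-u q₁ P₁) (begin
      tr (x₁ * (y₁ - x₁ ⨯ β))               ≡⟨ cong tr (solve 3 (λ x y z → x :* (y :- z) := x :* y :- x :* z) refl x₁ y₁ (x₁ ⨯ β)) ⟩
      tr (x₁ * y₁ - x₁ * (x₁ ⨯ β))          ≡⟨ tr-- _ _ ⟩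
      tr (x₁ * y₁) - tr (x₁ * (x₁ ⨯ β))     ≡⟨ cong₂ _-_ (qpt-tr q₁) (tr-x[x⨯y]≡0 x₁ β) ⟩
      0# - 0#                               ≡⟨ -‿inverseʳ 0# ⟩
      0#                                    ∎))
      where
      open ≡-Reasoning
      y₁ = proj₁ y₁-data
      q₁ = proj₁ (proj₂ y₁-data)
      P₁ = proj₂ (proj₂ y₁-data)

    graph-equation : ∀ {x y} → QPt (x , y) → OnLine P (κ (x , y)) → y ≡ x ⨯ β
    graph-equation qxy Pxy = x-y≡0⇒x≡y (tr-nondegenerate x₀ u x₁ (proj₂ x₁-data) (orthogonal-x₀ qxy Pxy) (orthogonal-u qxy Pxy)
      (orthogonal qxy Pxy (proj₁ (proj₂ y₁-data)) (proj₂ (proj₂ y₁-data)) y₁≡x₁⨯β))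

    offPlane : OffPlane β P
    offPlane x y qxy = mk⇔ (graph-equation qxy) onto
      where
      -- Some line through P lies over x by `on-graph`, and the equation just proved forces its
      -- second coordinate to be y.
      onto : y ≡ x ⨯ β → OnLine P (κ (x , y))
      onto eq = subst (λ y → OnLine P (κ (x , y)))
          (trans (graph-equation (proj₁ (proj₂ d)) (proj₂ (proj₂ d))) (sym eq)) (proj₂ (proj₂ d))
        where
        x≢0 : x ≢ 0#
        x≢0 x≡0 = qpt-≡0ˡ qxy x≡0 (trans eq (trans (cong (_⨯ β) x≡0) (0-⨯ β)))
        d : ∃ λ y → QPt (x , y) × OnLine P (κ (x , y))
        d = on-graph x≢0

  classify-off : ∀ {P} → NonzeroW P → ¬ InPlane h P → ∃ λ β → OffPlane β P
  classify-off P≢0 P∉h = OffPlaneGraph.β P≢0 P∉h , OffPlaneGraph.offPlane P≢0 P∉h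

  qpt-⨯ : ∀ {x} β → x ≢ 0# → QPt (x , x ⨯ β)
  qpt-⨯ {x} β x≢0 = qptˡ x≢0 (tr-x[x⨯y]≡0 x β)

  offPlane-on : ∀ {β P x} → OffPlane β P → x ≢ 0# → OnLine P (κ (x , x ⨯ β))
  offPlane-on {β} {P} {x} off x≢0 = Equivalence.from (off x (x ⨯ β) (qpt-⨯ β x≢0)) refl

  offPlane-0 : OffPlane 0# p
  offPlane-0 x y qxy = mk⇔
    (λ pxy → trans (p∈κ⇒π₁ _ qxy pxy) (sym (⨯-0 x)))
    (λ eq → subst (λ y → OnLine p (κ (x , y))) (sym (trans eq (⨯-0 x))) (π₁→p x (qpt-≡0ʳ qxy (trans eq (⨯-0 x)))))

  -- For nonzero β, intersect two lines that the graph must contain: those of (β , 0) and (x , x ⨯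
  -- β) with x = α β. If the meet were in `h`, both β and x would be parallel to its label, against
  -- x ⨯ β ≠ 0. Its label off `h` is parallel to β because of the first line and equals β because of
  -- the second.
  point-off : ∀ β → ∃ λ P → NonzeroW P × ¬ InPlane h P × OffPlane β P
  point-off β = by (β ≟ 0#)
    where
    open ≡-Reasoning
    by : Dec (β ≡ 0#) → ∃ λ P → NonzeroW P × ¬ InPlane h P × OffPlane β P
    by (yes β≡0) = p , p≢0 , p∉h , subst (λ γ → OffPlane γ p) (sym β≡0) offPlane-0
    by (no β≢0) = P , P≢0 , P∉h , subst (λ γ → OffPlane γ P) β′≡β (proj₂ off)
      where
      x w : Carrier
      x = α * β
      w = x ⨯ β
      w≢0 : w ≢ 0#
      w≢0 = αu⨯u≢0 β≢0
      qx : QPt (x , w)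
      qx = qpt-⨯ β (*-nonZero α≢0 β≢0)
      m : Meet (κ (x , w)) (κ (β , 0#))
      m = polar≡0⇒meet _ _ qx (qpt-π₁ β≢0) (polar-π₁ (tr-y[x⨯y]≡0 x β))
      P : W
      P = proj₁ m
      P≢0 : NonzeroW P
      P≢0 = proj₁ (proj₁ (proj₂ m))
      P∉h : ¬ InPlane h P
      P∉h P∈h = w≢0 (⨯-trans u≢0 (proj₁ (Equivalence.to (on x w qx) (proj₁ (proj₂ m))))
                  (proj₁ (Equivalence.to (on β 0# (qpt-π₁ β≢0)) (proj₂ (proj₂ m)))))
        where
        l : ∃ λ u → u ≢ 0# × OnLine P (κ (u , 0#))
        l = line-through-p P≢0
        u≢0 : proj₁ l ≢ 0#
        u≢0 = proj₁ (proj₂ l)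
        on : OnPlane (proj₁ l) P
        on = classify-on P∈h u≢0 (proj₂ (proj₂ l))
      off : ∃ λ β′ → OffPlane β′ P
      off = classify-off P≢0 P∉h
      β′ : Carrier
      β′ = proj₁ off
      w≡x⨯β′ : w ≡ x ⨯ β′
      w≡x⨯β′ = Equivalence.to (proj₂ off x w qx) (proj₁ (proj₂ m))
      β′∥β : ∃ λ a → β′ ≡ ι a * β
      β′∥β = ⨯≡0⇒∥ β≢0 (⨯-antisym-0 (sym (Equivalence.to (proj₂ off β 0# (qpt-π₁ β≢0)) (proj₂ (proj₂ m)))))
      a : F.Carrier
      a = proj₁ β′∥β
      ιa≡1 : ι a ≡ 1#
      ιa≡1 = *-cancelˡ-nonZero w w≢0 (begin
        w * ι a             ≡⟨ *-comm w (ι a) ⟩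
        ι a * w             ≡⟨ ⨯-ι* a x β ⟨
        x ⨯ (ι a * β)       ≡⟨ cong (x ⨯_) (proj₂ β′∥β) ⟨
        x ⨯ β′              ≡⟨ w≡x⨯β′ ⟨
        w                   ≡⟨ *-identityʳ w ⟨
        w * 1#              ∎)
      β′≡β : β′ ≡ β
      β′≡β = trans (proj₂ β′∥β) (trans (cong (_* β) ιa≡1) (*-identityˡ β))

  offPlane-label-unique : ∀ {β γ P} → OffPlane β P → OffPlane γ P → β ≡ γ
  offPlane-label-unique {β} off off′ = ⨯-injective λ x x≢0 →
    Equivalence.to (off′ x _ (qpt-⨯ β x≢0)) (offPlane-on off x≢0)

  offPlane-point-unique : ∀ {β P P′} → OffPlane β P → OffPlane β P′ → PropW P P′
  offPlane-point-unique {β} off off′ =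
    point-unique _ _ (qpt-⨯ β 1≢0) (qpt-⨯ β α≢0) 1≁α
      (offPlane-on off 1≢0) (offPlane-on off′ 1≢0) (offPlane-on off α≢0) (offPlane-on off′ α≢0)
    where
    1≁α : ¬ PropV (1# , 1# ⨯ β) (α , α ⨯ β)
    1≁α (a , _ , eq) = φα≢α (trans (cong φ α≡ιa) (trans (φ-ι a) (sym α≡ιa)))
      where
      α≡ιa : α ≡ ι a
      α≡ιa = trans (cong proj₁ eq) (*-identityʳ (ι a))

  offPlane-resp : ∀ {β P P′} → PropW P P′ → OffPlane β P → OffPlane β P′
  offPlane-resp P~P′ off x y qxy = mk⇔
    (λ P′xy → Equivalence.to (off x y qxy) (onLine-resp _ (propW-sym P~P′) P′xy))
    (λ eq → onLine-resp _ P~P′ (Equivalence.from (off x y qxy) eq))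

  onPlane-resp : ∀ {u P P′} → PropW P P′ → OnPlane u P → OnPlane u P′
  onPlane-resp P~P′ on x y qxy = mk⇔
    (λ P′xy → Equivalence.to (on x y qxy) (onLine-resp _ (propW-sym P~P′) P′xy))
    (λ eq → onLine-resp _ P~P′ (Equivalence.from (on x y qxy) eq))

  onPlane-through : ∀ {u P} → u ≢ 0# → OnPlane u P → OnLine P (κ (u , 0#))
  onPlane-through {u} u≢0 on = Equivalence.from (on u 0# (qpt-π₁ u≢0)) (⨯-self u , tr-*0 u)

  onPlane-point-unique : ∀ {u P P′} → u ≢ 0# → OnPlane u P → OnPlane u P′ → PropW P P′
  onPlane-point-unique {u} u≢0 on on′ =
    point-unique _ _ (qpt-π₁ u≢0) (qpt-π₂ v≢0) (λ u~v → u≁v (sym (π₁∥ u~v)))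
      (onPlane-through u≢0 on) (onPlane-through u≢0 on′) (on-v on) (on-v on′)
    where
    v : Carrier
    v = (α * u) ⨯ u
    v≢0 : v ≢ 0#
    v≢0 = αu⨯u≢0 u≢0
    u≁v : 0# ≢ v
    u≁v eq = v≢0 (sym eq)
    on-v : ∀ {P} → OnPlane u P → OnLine P (κ (0# , v))
    on-v on = Equivalence.from (on 0# v (qpt-π₂ v≢0)) (0-⨯ u , tr-y[x⨯y]≡0 (α * u) u)

  onPlane-label : ∀ {P} → InPlane h P → ∃ λ u → u ≢ 0# × OnPlane u P
  onPlane-label P∈h = proj₁ l , proj₁ (proj₂ l) , classify-on P∈h (proj₁ (proj₂ l)) (proj₂ (proj₂ l))
    where l = line-through-p (proj₁ P∈h)

  -- The action of G

  open Group α using (c; z; g)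
  open Orbits α K

  m m⁻¹ n : ℕ → Carrier
  m i   = pow μ i
  m⁻¹ i = pow (μ ⁻¹) i
  n j   = pow (pow ω 4) j

  m≢0 : ∀ i → m i ≢ 0#
  m≢0 i = pow-nonZero i μ≢0

  m⁻¹≢0 : ∀ i → m⁻¹ i ≢ 0#
  m⁻¹≢0 i = pow-nonZero i (⁻¹-nonZero μ≢0)

  n≢0 : ∀ j → n j ≢ 0#
  n≢0 j = pow-nonZero j (pow-nonZero 4 ω≢0)

  n∈F : ∀ j → ∃ λ a → n j ≡ ι a
  n∈F j = proj₁ (ω^k∈F (4 ℕ.* j)) , trans (sym (pow-* ω 4 j)) (proj₂ (ω^k∈F (4 ℕ.* j)))

  m*m⁻¹ : ∀ i x → m i * (m⁻¹ i * x) ≡ x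
  m*m⁻¹ i x = trans (sym (*-assoc _ _ x)) (trans (cong (_* x) (pow-⁻¹ i μ≢0)) (*-identityˡ x))

  m⁻¹≡φm*φφm : ∀ i → m⁻¹ i ≡ φ (m i) * φ (φ (m i))
  m⁻¹≡φm*φφm i = *-cancelˡ-nonZero (m i) (m≢0 i)
    (trans (pow-⁻¹ i μ≢0) (trans (sym (norm-μ^i i)) (*-comm _ (m i))))

  m*-⨯-m* : ∀ i x y → (m i * x) ⨯ (m i * y) ≡ m⁻¹ i * (x ⨯ y)
  m*-⨯-m* i x y = begin
    φ (m i * x) * φ (φ (m i * y)) - φ (φ (m i * x)) * φ (m i * y)
      ≡⟨ cong₂ _-_ (cong₂ _*_ (φ-* (m i) x) (φφ-* (m i) y)) (cong₂ _*_ (φφ-* (m i) x) (φ-* (m i) y)) ⟩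
    (φ (m i) * φ x) * (φ (φ (m i)) * φ (φ y)) - (φ (φ (m i)) * φ (φ x)) * (φ (m i) * φ y)
      ≡⟨ solve 6 (λ m₁ m₂ x₁ x₂ y₁ y₂ →
           (m₁ :* x₁) :* (m₂ :* y₂) :- (m₂ :* x₂) :* (m₁ :* y₁) := (m₁ :* m₂) :* (x₁ :* y₂ :- x₂ :* y₁)) refl
           (φ (m i)) (φ (φ (m i))) (φ x) (φ (φ x)) (φ y) (φ (φ y)) ⟩
    (φ (m i) * φ (φ (m i))) * (x ⨯ y)
      ≡⟨ cong (_* (x ⨯ y)) (m⁻¹≡φm*φφm i) ⟨
    m⁻¹ i * (x ⨯ y) ∎
    where open ≡-Reasoning

  n*tr : ∀ j x → tr (n j * x) ≡ n j * tr x
  n*tr j x = trans (cong (λ t → tr (t * x)) (proj₂ (n∈F j)))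
    (trans (tr-ι* _ x) (cong (_* tr x) (sym (proj₂ (n∈F j)))))

  ⨯-n* : ∀ j x y → x ⨯ (n j * y) ≡ n j * (x ⨯ y)
  ⨯-n* j x y = trans (cong (λ t → x ⨯ (t * y)) (proj₂ (n∈F j)))
    (trans (⨯-ι* _ x y) (cong (_* (x ⨯ y)) (sym (proj₂ (n∈F j)))))

  iter-c : ∀ i u v → iter i c (u , v) ≡ (m i * u , m⁻¹ i * v)
  iter-c zero    u v = sym (cong₂ _,_ (*-identityˡ u) (*-identityˡ v))
  iter-c (suc i) u v = trans (cong c (iter-c i u v)) (sym (cong₂ _,_ (*-assoc μ (m i) u) (*-assoc (μ ⁻¹) (m⁻¹ i) v)))

  iter-z : ∀ j u v → iter j z (u , v) ≡ (u , n j * v)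
  iter-z zero    u v = sym (cong (u ,_) (*-identityˡ v))
  iter-z (suc j) u v = trans (cong z (iter-z j u v)) (sym (cong (u ,_) (*-assoc (pow ω 4) (n j) v)))

  ĝ : ℕ → ℕ → V → V
  ĝ i j (u , v) = m i * u , m⁻¹ i * (n j * v)

  g≡ĝ : ∀ i j x → g i j x ≡ ĝ i j x
  g≡ĝ i j (u , v) = trans (cong (iter i c) (iter-z j u v)) (iter-c i u (n j * v))

  tr-ĝ : ∀ i j u y → tr ((m i * u) * (m⁻¹ i * (n j * y))) ≡ n j * tr (u * y)
  tr-ĝ i j u y = begin
    tr ((m i * u) * (m⁻¹ i * (n j * y)))
      ≡⟨ cong tr (solve 5 (λ m m′ n u y → (m :* u) :* (m′ :* (n :* y)) := m :* (m′ :* (n :* (u :* y)))) refl (m i) (m⁻¹ i) (n j) u y) ⟩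
    tr (m i * (m⁻¹ i * (n j * (u * y))))
      ≡⟨ cong tr (m*m⁻¹ i _) ⟩
    tr (n j * (u * y))
      ≡⟨ n*tr j (u * y) ⟩
    n j * tr (u * y) ∎
    where open ≡-Reasoning

  qpt-ĝ : ∀ i j {x y} → QPt (x , y) → QPt (ĝ i j (x , y))
  qpt-ĝ i j {x} {y} qxy@(xy≢0 , _) = qpt
    (λ eq → xy≢0 (cong₂ _,_ (integral (m≢0 i) (cong proj₁ eq)) (integral (n≢0 j) (integral (m⁻¹≢0 i) (cong proj₂ eq)))))
    (trans (tr-ĝ i j x y) (trans (cong (n j *_) (qpt-tr qxy)) (zeroʳ _)))

  Maps : ℕ → ℕ → W → W → Set
  Maps i j P P′ = ∀ x y → QPt (x , y) → (OnLine P (κ (x , y)) ⇔ OnLine P′ (κ (ĝ i j (x , y))))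

  maps⇒sameOrbit : ∀ i j {P P′} → Maps i j P P′ → SameOrbit P P′
  maps⇒sameOrbit i j {P} {P′} f = i , j , λ (x , y) qxy →
    subst (λ w → OnLine P (κ (x , y)) ⇔ OnLine P′ (κ w)) (sym (g≡ĝ i j (x , y))) (f x y qxy)

  sameOrbit⇒maps : ∀ {P P′} → SameOrbit P P′ → ∃ λ i → ∃ λ j → Maps i j P P′
  sameOrbit⇒maps {P} {P′} (i , j , f) = i , j , λ x y qxy →
    subst (λ w → OnLine P (κ (x , y)) ⇔ OnLine P′ (κ w)) (g≡ĝ i j (x , y)) (f (x , y) qxy)

  ĝ-⨯ : ∀ i j x β → (m i * x) ⨯ (m i * (n j * β)) ≡ m⁻¹ i * (n j * (x ⨯ β))
  ĝ-⨯ i j x β = trans (m*-⨯-m* i x (n j * β)) (cong (m⁻¹ i *_) (⨯-n* j x β))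

  offPlane-maps : ∀ i j {β P P′} → OffPlane β P → OffPlane (m i * (n j * β)) P′ → Maps i j P P′
  offPlane-maps i j {β} off off′ x y qxy = mk⇔
    (λ Pxy → Equivalence.from (off′ _ _ (qpt-ĝ i j qxy))
      (trans (cong (λ y → m⁻¹ i * (n j * y)) (Equivalence.to (off x y qxy) Pxy)) (sym (ĝ-⨯ i j x β))))
    (λ P′xy → Equivalence.from (off x y qxy)
      (*-cancelˡ-nonZero (n j) (n≢0 j) (*-cancelˡ-nonZero (m⁻¹ i) (m⁻¹≢0 i)
        (trans (Equivalence.to (off′ _ _ (qpt-ĝ i j qxy)) P′xy) (ĝ-⨯ i j x β)))))

  maps-offPlane : ∀ i j {β γ P P′} → OffPlane β P → OffPlane γ P′ → Maps i j P P′ → γ ≡ m i * (n j * β)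
  maps-offPlane i j {β} {γ} off off′ f = sym (⨯-injective λ x x≢0 →
    -- The test vector is `m⁻¹ i * x`, so that its image under `ĝ i j` has first coordinate x.
    subst (λ x → x ⨯ (m i * (n j * β)) ≡ x ⨯ γ) (m*m⁻¹ i x)
      (let w≢0 = *-nonZero (m⁻¹≢0 i) x≢0
           w   = m⁻¹ i * x
       in trans (ĝ-⨯ i j w β)
            (Equivalence.to (off′ _ _ (qpt-ĝ i j (qpt-⨯ β w≢0)))
              (Equivalence.to (f w (w ⨯ β) (qpt-⨯ β w≢0)) (offPlane-on off w≢0)))))

  -- Only `m i` reaches the label: `n j` lies in F and does not affect the vanishing of the trace,
  -- so z fixes every point of `h`. The free factor `ι a` reflects that labels count modulo F*.
  onPlane-maps : ∀ i j {u a P P′} → ι a ≢ 0# → OnPlane u P → OnPlane (ι a * (m i * u)) P′ → Maps i j P P′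
  onPlane-maps i j {u} {a} {P} {P′} a≢0 on on′ x y qxy = mk⇔
    (λ Pxy → let (xu , uy) = Equivalence.to (on x y qxy) Pxy in
      Equivalence.from (on′ _ _ (qpt-ĝ i j qxy))
        ( trans scaled-⨯ (trans (cong (λ t → ι a * (m⁻¹ i * t)) xu) (trans (cong (ι a *_) (zeroʳ _)) (zeroʳ _)))
        , trans scaled-tr (trans (cong (λ t → ι a * (n j * t)) uy) (trans (cong (ι a *_) (zeroʳ _)) (zeroʳ _)))))
    (λ P′xy → let (xu , uy) = Equivalence.to (on′ _ _ (qpt-ĝ i j qxy)) P′xy in
      Equivalence.from (on x y qxy)
        ( integral (m⁻¹≢0 i) (integral a≢0 (trans (sym scaled-⨯) xu))
        , integral (n≢0 j) (integral a≢0 (trans (sym scaled-tr) uy))))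
    where
    scaled-⨯ : (m i * x) ⨯ (ι a * (m i * u)) ≡ ι a * (m⁻¹ i * (x ⨯ u))
    scaled-⨯ = trans (⨯-ι* a (m i * x) (m i * u)) (cong (ι a *_) (m*-⨯-m* i x u))
    scaled-tr : tr (ι a * (m i * u) * (m⁻¹ i * (n j * y))) ≡ ι a * (n j * tr (u * y))
    scaled-tr = trans (cong tr (*-assoc (ι a) (m i * u) _)) (trans (tr-ι* a _) (cong (ι a *_) (tr-ĝ i j u y)))

  onPlane-π₂ : ∀ {P} → InPlane h P → ∃ λ v → v ≢ 0# × OnLine P (κ (0# , v))
  onPlane-π₂ P∈h = v , v≢0 , Equivalence.from (on 0# v (qpt-π₂ v≢0)) (0-⨯ u , tr-y[x⨯y]≡0 (α * u) u)
    where
    u : Carrier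
    u = proj₁ (onPlane-label P∈h)
    on : OnPlane u _
    on = proj₂ (proj₂ (onPlane-label P∈h))
    v : Carrier
    v = (α * u) ⨯ u
    v≢0 : v ≢ 0#
    v≢0 = αu⨯u≢0 (proj₁ (proj₂ (onPlane-label P∈h)))

  maps-plane : ∀ i j {P P′} → Maps i j P P′ → InPlane h P → InPlane h P′
  maps-plane i j f P∈h = on-h (qpt-ĝ i j (qpt-π₂ v≢0)) (zeroʳ (m i)) (Equivalence.to (f 0# v (qpt-π₂ v≢0)) Pv)
    where
    v : Carrier
    v = proj₁ (onPlane-π₂ P∈h)
    v≢0 : v ≢ 0#
    v≢0 = proj₁ (proj₂ (onPlane-π₂ P∈h))
    Pv : OnLine _ (κ (0# , v))
    Pv = proj₂ (proj₂ (onPlane-π₂ P∈h))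

  maps-plane⁻¹ : ∀ i j {P P′} → Maps i j P P′ → InPlane h P′ → InPlane h P
  maps-plane⁻¹ i j {P} {P′} f P′∈h = on-h (qpt-π₂ v≢0) refl (Equivalence.from (f 0# v (qpt-π₂ v≢0))
      (subst (λ w → OnLine P′ (κ w)) (sym ĝv≡v′) (proj₂ (proj₂ (onPlane-π₂ P′∈h)))))
    where
    v′ v : Carrier
    v′ = proj₁ (onPlane-π₂ P′∈h)
    -- The preimage of (0 , v′) under `ĝ i j`, computed directly since the natural exponents of `g`
    -- offer no formal inverse.
    v = n j ⁻¹ * (m i * v′)
    v≢0 : v ≢ 0#
    v≢0 = *-nonZero (⁻¹-nonZero (n≢0 j)) (*-nonZero (m≢0 i) (proj₁ (proj₂ (onPlane-π₂ P′∈h))))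
    ĝv≡v′ : ĝ i j (0# , v) ≡ (0# , v′)
    ĝv≡v′ = cong₂ _,_ (zeroʳ (m i)) (begin
      m⁻¹ i * (n j * v)        ≡⟨ cong (m⁻¹ i *_) (a*[a⁻¹*x]≡x (n≢0 j) _) ⟩
      m⁻¹ i * (m i * v′)       ≡⟨ solve 3 (λ a b v → a :* (b :* v) := b :* (a :* v)) refl (m⁻¹ i) (m i) v′ ⟩
      m i * (m⁻¹ i * v′)       ≡⟨ m*m⁻¹ i v′ ⟩
      v′                       ∎)
      where open ≡-Reasoning

  onPlane-scale : ∀ {u a P} → ι a ≢ 0# → OnPlane u P → OnPlane (ι a * u) P
  onPlane-scale {u} {a} {P} a≢0 on x y qxy = mk⇔ to from
    where
    ιa*0 : ∀ {t} → t ≡ 0# → ι a * t ≡ 0#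
    ιa*0 t≡0 = trans (cong (ι a *_) t≡0) (zeroʳ (ι a))
    scaled-⨯ : x ⨯ (ι a * u) ≡ ι a * (x ⨯ u)
    scaled-⨯ = ⨯-ι* a x u
    scaled-tr : tr (ι a * u * y) ≡ ι a * tr (u * y)
    scaled-tr = trans (cong tr (*-assoc (ι a) u y)) (tr-ι* a (u * y))
    to : OnLine P (κ (x , y)) → x ⨯ (ι a * u) ≡ 0# × tr (ι a * u * y) ≡ 0#
    to Pxy = trans scaled-⨯ (ιa*0 (proj₁ on-P)) , trans scaled-tr (ιa*0 (proj₂ on-P))
      where
      on-P : x ⨯ u ≡ 0# × tr (u * y) ≡ 0#
      on-P = Equivalence.to (on x y qxy) Pxy
    from : x ⨯ (ι a * u) ≡ 0# × tr (ι a * u * y) ≡ 0# → OnLine P (κ (x , y))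
    from (xau , auy) = Equivalence.from (on x y qxy)
      (integral a≢0 (trans (sym scaled-⨯) xau) , integral a≢0 (trans (sym scaled-tr) auy))

  -- The orbits of G

  offPlane-sameOrbit : ∀ i j {β γ P P′} → γ ≡ m i * (n j * β) → OffPlane β P → OffPlane γ P′ → SameOrbit P P′
  offPlane-sameOrbit i j refl off off′ = maps⇒sameOrbit i j (offPlane-maps i j off off′)

  sameOrbit-off : ∀ {P P′} → SameOrbit P P′ → ¬ InPlane h P → ¬ InPlane h P′
  sameOrbit-off s P∉h P′∈h = P∉h (maps-plane⁻¹ i j f P′∈h)
    where
    i = proj₁ (sameOrbit⇒maps s)
    j = proj₁ (proj₂ (sameOrbit⇒maps s))
    f = proj₂ (proj₂ (sameOrbit⇒maps s))

  sameOrbit-offPlane : ∀ {β γ P P′} → OffPlane β P → OffPlane γ P′ → SameOrbit P P′ →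
                       ∃ λ i → ∃ λ j → γ ≡ m i * (n j * β)
  sameOrbit-offPlane off off′ s = i , j , maps-offPlane i j off off′ f
    where
    i = proj₁ (sameOrbit⇒maps s)
    j = proj₁ (proj₂ (sameOrbit⇒maps s))
    f = proj₂ (proj₂ (sameOrbit⇒maps s))

  orbit-p : ∀ P → NonzeroW P → (SameOrbit p P ⇔ PropW p P)
  orbit-p P P≢0 = mk⇔ fixed
    (λ p~P → offPlane-sameOrbit 0 0 (sym (trans (*-identityˡ _) (*-identityˡ 0#))) offPlane-0 (offPlane-resp p~P offPlane-0))
    where
    fixed : SameOrbit p P → PropW p P
    fixed s = offPlane-point-unique offPlane-0 (subst (λ β → OffPlane β P) β≡0 (proj₂ off))
      where
      off : ∃ λ β → OffPlane β P
      off = classify-off P≢0 (sameOrbit-off s p∉h)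
      ij : ∃ λ i → ∃ λ j → proj₁ off ≡ m i * (n j * 0#)
      ij = sameOrbit-offPlane offPlane-0 (proj₂ off) s
      β≡0 : proj₁ off ≡ 0#
      β≡0 = trans (proj₂ (proj₂ ij)) (trans (cong (m (proj₁ ij) *_) (zeroʳ _)) (zeroʳ _))

  sameOrbit-plane : ∀ {P P′} → InPlane h P → SameOrbit P P′ → InPlane h P′
  sameOrbit-plane P∈h s = maps-plane (proj₁ d) (proj₁ (proj₂ d)) (proj₂ (proj₂ d)) P∈h
    where d = sameOrbit⇒maps s

  onPlane-label-∥ : ∀ {u u′ P} → u ≢ 0# → OnPlane u P → OnPlane u′ P → u ⨯ u′ ≡ 0#
  onPlane-label-∥ {u} u≢0 on on′ = proj₁ (Equivalence.to (on′ u 0# (qpt-π₁ u≢0)) (onPlane-through u≢0 on))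

  α^≢0 : ∀ k → pow α k ≢ 0#
  α^≢0 k = pow-nonZero k α≢0

  -- The group E*/F* is cyclic of order θ, generated by the class of α.
  plane-representatives : Fin θ → W
  plane-representatives k = proj₁ (point-on (α^≢0 (Fin.toℕ k)))

  plane-card : ∀ {S} → (∀ P → NonzeroW P → (S P ⇔ InPlane h P)) → ProjCard S θ
  plane-card {S} S⇔h = r , (λ k → proj₁ (r∈h k) , Equivalence.from (S⇔h (r k) (proj₁ (r∈h k))) (r∈h k)) , distinct , cover
    where
    open ≡-Reasoning
    r = plane-representatives
    r∈h : ∀ k → InPlane h (r k)
    r∈h k = proj₁ (proj₂ (point-on (α^≢0 (Fin.toℕ k))))
    r-on : ∀ k → OnPlane (pow α (Fin.toℕ k)) (r k)
    r-on k = proj₂ (proj₂ (point-on (α^≢0 (Fin.toℕ k))))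
    -- Raising to the power q - 1 kills the scalar between two labels of one point, and turns
    -- exponents below θ into multiples of q - 1 below q³ - 1, where powers of α are distinct.
    exponent : ℕ → ℕ
    exponent k = k ℕ.* (q ℕ.∸ 1)
    exponent< : ∀ (k : Fin θ) → exponent (Fin.toℕ k) < q ^ 3 ℕ.∸ 1
    exponent< k = subst (exponent (Fin.toℕ k) <_) (trans (ℕₚ.*-comm θ (q ℕ.∸ 1)) (sym q³∸1≡[q∸1]θ))
      (ℕₚ.*-monoˡ-< (q ℕ.∸ 1) (Finₚ.toℕ<n k))
    distinct : ∀ k l → PropW (r k) (r l) → k ≡ l
    distinct k l rk~rl = Finₚ.toℕ-injective (ℕₚ.*-cancelʳ-≡ (Fin.toℕ k) (Fin.toℕ l) (q ℕ.∸ 1)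
      (pow-injective-< (exponent< k) (exponent< l) (begin
        pow α (exponent (Fin.toℕ k))              ≡⟨ pow-* α (Fin.toℕ k) (q ℕ.∸ 1) ⟩
        pow αᵏ (q ℕ.∸ 1)                          ≡⟨ cong (λ z → pow z (q ℕ.∸ 1)) (proj₂ αᵏ∥αˡ) ⟩
        pow (ι a * αˡ) (q ℕ.∸ 1)                  ≡⟨ pow-distrib-* (ι a) αˡ (q ℕ.∸ 1) ⟩
        pow (ι a) (q ℕ.∸ 1) * pow αˡ (q ℕ.∸ 1)    ≡⟨ cong (_* pow αˡ (q ℕ.∸ 1)) ιa^[q∸1]≡1 ⟩
        1# * pow αˡ (q ℕ.∸ 1)                     ≡⟨ *-identityˡ _ ⟩
        pow αˡ (q ℕ.∸ 1)                          ≡⟨ pow-* α (Fin.toℕ l) (q ℕ.∸ 1) ⟨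
        pow α (exponent (Fin.toℕ l))              ∎)))
      where
      αᵏ αˡ : Carrier
      αᵏ = pow α (Fin.toℕ k)
      αˡ = pow α (Fin.toℕ l)
      αᵏ∥αˡ : ∃ λ a → αᵏ ≡ ι a * αˡ
      αᵏ∥αˡ = ⨯≡0⇒∥ (α^≢0 (Fin.toℕ l)) (onPlane-label-∥ (α^≢0 (Fin.toℕ k)) (r-on k) (onPlane-resp (propW-sym rk~rl) (r-on l)))
      a : F.Carrier
      a = proj₁ αᵏ∥αˡ
      a≢0 : a ≢ F.0#
      a≢0 a≡0 = α^≢0 (Fin.toℕ k) (trans (proj₂ αᵏ∥αˡ) (trans (cong (_* αˡ) (trans (cong ι a≡0) ι-0)) (zeroˡ αˡ)))
      ιa^[q∸1]≡1 : pow (ι a) (q ℕ.∸ 1) ≡ 1#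
      ιa^[q∸1]≡1 = trans (sym (ι-pow a (q ℕ.∸ 1))) (trans (cong ι (F.pow-order a≢0)) ι-1)
    cover : ∀ P → NonzeroW P → S P → ∃ λ k → PropW (r k) P
    cover P P≢0 SP = k , onPlane-point-unique (*-nonZero ιb≢0 (α^≢0 (Fin.toℕ k)))
        (onPlane-scale ιb≢0 (r-on k)) (subst (λ u → OnPlane u P) u≡ (proj₂ (proj₂ label)))
      where
      label : ∃ λ u → u ≢ 0# × OnPlane u P
      label = onPlane-label (Equivalence.to (S⇔h P P≢0) SP)
      u : Carrier
      u = proj₁ label
      e : ∃ λ e → pow α e ≡ u
      e = prim u (proj₁ (proj₂ label))
      k : Fin θ
      k = Fin.fromℕ< (m%n<n (proj₁ e) θ)
      b : F.Carrier
      -- Dividing the exponent by θ splits off a power of ω, that is, a scalar of F.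
      b = proj₁ (ω^k∈F (proj₁ e / θ))
      ιb≢0 : ι b ≢ 0#
      ιb≢0 eq = pow-nonZero (proj₁ e / θ) ω≢0 (trans (proj₂ (ω^k∈F (proj₁ e / θ))) eq)
      u≡ : u ≡ ι b * pow α (Fin.toℕ k)
      u≡ = begin
        u                                                           ≡⟨ proj₂ e ⟨
        pow α (proj₁ e)                                             ≡⟨ cong (pow α) (m≡m%n+[m/n]*n (proj₁ e) θ) ⟩
        pow α (proj₁ e % θ ℕ.+ proj₁ e / θ ℕ.* θ)                   ≡⟨ pow-+ α (proj₁ e % θ) (proj₁ e / θ ℕ.* θ) ⟩
        pow α (proj₁ e % θ) * pow α (proj₁ e / θ ℕ.* θ)             ≡⟨ cong (λ t → pow α (proj₁ e % θ) * pow α t) (ℕₚ.*-comm (proj₁ e / θ) θ) ⟩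
        pow α (proj₁ e % θ) * pow α (θ ℕ.* (proj₁ e / θ))           ≡⟨ cong (pow α (proj₁ e % θ) *_) (pow-* α θ (proj₁ e / θ)) ⟩
        pow α (proj₁ e % θ) * pow ω (proj₁ e / θ)                   ≡⟨ *-comm (pow α (proj₁ e % θ)) _ ⟩
        pow ω (proj₁ e / θ) * pow α (proj₁ e % θ)                   ≡⟨ cong₂ (λ s t → s * pow α t) (proj₂ (ω^k∈F (proj₁ e / θ))) (sym (Finₚ.toℕ-fromℕ< (m%n<n (proj₁ e) θ))) ⟩
        ι b * pow α (Fin.toℕ k)                                     ∎

  -- Transitivity on the plane and the four orbits off it

  module Main (q%4≡1 : q % 4 ≡ 1) (q%3≢1 : q % 3 ≢ 1) where
    open Coprime q%3≢1
    open Divisible q%4≡1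

    orbit-plane : ∀ P P′ → InPlane h P → NonzeroW P′ → (SameOrbit P P′ ⇔ InPlane h P′)
    orbit-plane P P′ P∈h P′≢0 = mk⇔ (sameOrbit-plane P∈h) transitive
      where
      transitive : InPlane h P′ → SameOrbit P P′
      -- A power of c suffices: μ and the scalars of F together generate E*.
      transitive P′∈h = maps⇒sameOrbit i 0 (onPlane-maps i 0 ιa≢0 (proj₂ (proj₂ l))
          (subst (λ u → OnPlane u P′) (proj₂ (proj₂ t)) (proj₂ (proj₂ l′))))
        where
        l : ∃ λ u → u ≢ 0# × OnPlane u P
        l = onPlane-label P∈h
        l′ : ∃ λ u → u ≢ 0# × OnPlane u P′
        l′ = onPlane-label P′∈h
        t : ∃ λ i → ∃ λ a → proj₁ l′ ≡ ι a * (pow μ i * proj₁ l)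
        t = μ-transitive (proj₁ (proj₂ l)) (proj₁ (proj₂ l′))
        i : ℕ
        i = proj₁ t
        ιa≢0 : ι (proj₁ (proj₂ t)) ≢ 0#
        ιa≢0 = factorˡ-nonZero (λ eq → proj₁ (proj₂ l′) (trans (proj₂ (proj₂ t)) eq))

    offPlane-α^4s : ∀ s {β γ P P′} → γ ≡ pow α (4 ℕ.* s) * β → OffPlane β P → OffPlane γ P′ → SameOrbit P P′
    offPlane-α^4s s {β} γ≡ = offPlane-sameOrbit (proj₁ d) (proj₁ (proj₂ d))
      (trans γ≡ (trans (cong (_* β) (proj₂ (proj₂ d))) (*-assoc _ _ β)))
      where
      d : ∃ λ i → ∃ λ j → pow α (4 ℕ.* s) ≡ pow μ i * pow (pow ω 4) j
      d = α^4s-split s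

    sameOrbit-α^4s : ∀ {β γ P P′} → OffPlane β P → OffPlane γ P′ → SameOrbit P P′ →
                     ∃ λ s → γ ≡ pow α (4 ℕ.* s) * β
    sameOrbit-α^4s {β} off off′ o = proj₁ s , trans (proj₂ (proj₂ d)) (trans (sym (*-assoc _ _ β)) (cong (_* β) (proj₂ s)))
      where
      d : ∃ λ i → ∃ λ j → _ ≡ m i * (n j * β)
      d = sameOrbit-offPlane off off′ o
      s : ∃ λ s → pow μ (proj₁ d) * pow (pow ω 4) (proj₁ (proj₂ d)) ≡ pow α (4 ℕ.* s)
      s = multiplier-α^4s (proj₁ d) (proj₁ (proj₂ d))

    point : ℕ → W
    point e = proj₁ (point-off (pow α e))

    point-nonzero : ∀ e → NonzeroW (point e)
    point-nonzero e = proj₁ (proj₂ (point-off (pow α e)))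

    point∉h : ∀ e → ¬ InPlane h (point e)
    point∉h e = proj₁ (proj₂ (proj₂ (point-off (pow α e))))

    point-offPlane : ∀ e → OffPlane (pow α e) (point e)
    point-offPlane e = proj₂ (proj₂ (proj₂ (point-off (pow α e))))

    point≁p : ∀ e → ¬ PropW p (point e)
    point≁p e p~P = α^≢0 e (offPlane-label-unique (point-offPlane e) (offPlane-resp p~P offPlane-0))

    -- Exponents of α are determined only modulo q³ - 1; this divisibility makes their residue
    -- modulo 4 well defined.
    4∣q³∸1 : 4 ∣ q ^ 3 ℕ.∸ 1
    4∣q³∸1 = subst (4 ∣_) (sym q³∸1≡4*orbit) (m∣m*n ((q ℕ.∸ 1) / 4 ℕ.* θ))

    instance
      q³∸1-nonZero : ℕ.NonZero (q ^ 3 ℕ.∸ 1)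
      q³∸1-nonZero = ℕ.>-nonZero 0<order

      orbit-nonZero : ℕ.NonZero ((q ℕ.∸ 1) / 4 ℕ.* θ)
      orbit-nonZero = ℕ.≢-nonZero λ eq → ℕ.≢-nonZero⁻¹ (q ^ 3 ℕ.∸ 1) (trans q³∸1≡4*orbit (cong (4 ℕ.*_) eq))

    -- The discrete logarithm of the label modulo 4 is constant on orbits, because G multiplies
    -- labels by powers of α⁴.
    points-sameOrbit⇒≡ : ∀ (k l : Fin 4) → SameOrbit (point (Fin.toℕ k)) (point (Fin.toℕ l)) → k ≡ l
    points-sameOrbit⇒≡ k l o = Finₚ.toℕ-injective (begin
      Fin.toℕ k                                       ≡⟨ m<n⇒m%n≡m (Finₚ.toℕ<n k) ⟨
      Fin.toℕ k % 4                                   ≡⟨ [m+kn]%n≡m%n (Fin.toℕ k) (proj₁ s) 4 ⟨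
      (Fin.toℕ k ℕ.+ proj₁ s ℕ.* 4) % 4               ≡⟨ m%n%o (Fin.toℕ k ℕ.+ proj₁ s ℕ.* 4) ⟨
      (Fin.toℕ k ℕ.+ proj₁ s ℕ.* 4) % (q ^ 3 ℕ.∸ 1) % 4  ≡⟨ cong (_% 4) (pow-≡⇒%-≡ _ _ powers) ⟨
      Fin.toℕ l % (q ^ 3 ℕ.∸ 1) % 4                   ≡⟨ m%n%o (Fin.toℕ l) ⟩
      Fin.toℕ l % 4                                   ≡⟨ m<n⇒m%n≡m (Finₚ.toℕ<n l) ⟩
      Fin.toℕ l                                       ∎)
      where
      open ≡-Reasoning
      s : ∃ λ s → pow α (Fin.toℕ l) ≡ pow α (4 ℕ.* s) * pow α (Fin.toℕ k)
      s = sameOrbit-α^4s (point-offPlane (Fin.toℕ k)) (point-offPlane (Fin.toℕ l)) o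
      powers : pow α (Fin.toℕ l) ≡ pow α (Fin.toℕ k ℕ.+ proj₁ s ℕ.* 4)
      powers = trans (proj₂ s) (trans (sym (pow-+ α (4 ℕ.* proj₁ s) (Fin.toℕ k)))
        (cong (pow α) (trans (ℕₚ.+-comm (4 ℕ.* proj₁ s) (Fin.toℕ k)) (cong (Fin.toℕ k ℕ.+_) (ℕₚ.*-comm 4 (proj₁ s))))))
      m%n%o : ∀ e → e % (q ^ 3 ℕ.∸ 1) % 4 ≡ e % 4
      m%n%o e = m∣n⇒o%n%m≡o%m 4 (q ^ 3 ℕ.∸ 1) e 4∣q³∸1

    points-cover : ∀ P → NonzeroW P → ¬ PropW p P → ¬ InPlane h P → ∃ λ (k : Fin 4) → SameOrbit (point (Fin.toℕ k)) P
    points-cover P P≢0 p≁P P∉h = k , offPlane-α^4s (e / 4) β≡ (point-offPlane (Fin.toℕ k)) (proj₂ off)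
      where
      open ≡-Reasoning
      off : ∃ λ β → OffPlane β P
      off = classify-off P≢0 P∉h
      β : Carrier
      β = proj₁ off
      β≢0 : β ≢ 0#
      β≢0 β≡0 = p≁P (offPlane-point-unique offPlane-0 (subst (λ β → OffPlane β P) β≡0 (proj₂ off)))
      e : ℕ
      e = proj₁ (prim β β≢0)
      k : Fin 4
      k = Fin.fromℕ< (m%n<n e 4)
      β≡ : β ≡ pow α (4 ℕ.* (e / 4)) * pow α (Fin.toℕ k)
      β≡ = begin
        β                                          ≡⟨ proj₂ (prim β β≢0) ⟨
        pow α e                                    ≡⟨ cong (pow α) (m≡m%n+[m/n]*n e 4) ⟩
        pow α (e % 4 ℕ.+ e / 4 ℕ.* 4)              ≡⟨ cong (pow α) (ℕₚ.+-comm (e % 4) (e / 4 ℕ.* 4)) ⟩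
        pow α (e / 4 ℕ.* 4 ℕ.+ e % 4)              ≡⟨ cong₂ (λ s t → pow α (s ℕ.+ t)) (ℕₚ.*-comm (e / 4) 4) (sym (Finₚ.toℕ-fromℕ< (m%n<n e 4))) ⟩
        pow α (4 ℕ.* (e / 4) ℕ.+ Fin.toℕ k)        ≡⟨ pow-+ α (4 ℕ.* (e / 4)) (Fin.toℕ k) ⟩
        pow α (4 ℕ.* (e / 4)) * pow α (Fin.toℕ k)  ∎

    orbit-card : ∀ (k : Fin 4) → ProjCard (SameOrbit (point (Fin.toℕ k))) ((q ℕ.∸ 1) / 4 ℕ.* θ)
    orbit-card k = (λ s → point (e s)) , (λ s → point-nonzero (e s) , in-orbit s) , distinct , cover
      where
      open ≡-Reasoning
      N : ℕ
      N = (q ℕ.∸ 1) / 4 ℕ.* θ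
      e : Fin N → ℕ
      -- The exponents congruent to k modulo 4 below 4N = q³ - 1; in this range powers of α are
      -- distinct, hence so are the labels.
      e s = 4 ℕ.* Fin.toℕ s ℕ.+ Fin.toℕ k
      in-orbit : ∀ s → SameOrbit (point (Fin.toℕ k)) (point (e s))
      in-orbit s = offPlane-α^4s (Fin.toℕ s) (pow-+ α (4 ℕ.* Fin.toℕ s) (Fin.toℕ k)) (point-offPlane (Fin.toℕ k)) (point-offPlane (e s))
      e< : ∀ s → e s < q ^ 3 ℕ.∸ 1
      e< s = ℕₚ.<-≤-trans (ℕₚ.+-monoʳ-< (4 ℕ.* Fin.toℕ s) (Finₚ.toℕ<n k))
        (ℕₚ.≤-trans (ℕₚ.≤-reflexive (trans (ℕₚ.+-comm (4 ℕ.* Fin.toℕ s) 4) (sym (ℕₚ.*-suc 4 (Fin.toℕ s)))))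
          (ℕₚ.≤-trans (ℕₚ.*-monoʳ-≤ 4 (Finₚ.toℕ<n s)) (ℕₚ.≤-reflexive (sym q³∸1≡4*orbit))))
      distinct : ∀ s t → PropW (point (e s)) (point (e t)) → s ≡ t
      distinct s t Ps~Pt = Finₚ.toℕ-injective (ℕₚ.*-cancelˡ-≡ (Fin.toℕ s) (Fin.toℕ t) 4 (ℕₚ.+-cancelʳ-≡ (Fin.toℕ k) (4 ℕ.* Fin.toℕ s) (4 ℕ.* Fin.toℕ t)
        (pow-injective-< (e< s) (e< t) (offPlane-label-unique (offPlane-resp Ps~Pt (point-offPlane (e s))) (point-offPlane (e t))))))
      cover : ∀ P → NonzeroW P → SameOrbit (point (Fin.toℕ k)) P → ∃ λ s → PropW (point (e s)) P
      cover P P≢0 o = s , offPlane-point-unique (point-offPlane (e s)) (subst (λ β → OffPlane β P) β≡ (proj₂ off))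
        where
        off : ∃ λ β → OffPlane β P
        off = classify-off P≢0 (sameOrbit-off o (point∉h (Fin.toℕ k)))
        d : ∃ λ s → proj₁ off ≡ pow α (4 ℕ.* s) * pow α (Fin.toℕ k)
        d = sameOrbit-α^4s (point-offPlane (Fin.toℕ k)) (proj₂ off) o
        s : Fin N
        -- The exponent of α⁴ may be reduced modulo N, since α⁴ raised to the power N is 1.
        s = Fin.fromℕ< (m%n<n (proj₁ d) N)
        [α⁴]^N≡1 : pow (pow α 4) N ≡ 1#
        [α⁴]^N≡1 = trans (sym (pow-* α 4 N)) (trans (cong (pow α) (sym q³∸1≡4*orbit)) (pow-order α≢0))
        β≡ : proj₁ off ≡ pow α (e s)
        β≡ = begin
          proj₁ off                                          ≡⟨ proj₂ d ⟩
          pow α (4 ℕ.* proj₁ d) * pow α (Fin.toℕ k)          ≡⟨ cong (_* pow α (Fin.toℕ k)) (pow-* α 4 (proj₁ d)) ⟩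
          pow (pow α 4) (proj₁ d) * pow α (Fin.toℕ k)        ≡⟨ cong (_* pow α (Fin.toℕ k)) (pow-% (pow α 4) [α⁴]^N≡1 (proj₁ d)) ⟩
          pow (pow α 4) (proj₁ d % N) * pow α (Fin.toℕ k)    ≡⟨ cong (λ t → pow (pow α 4) t * pow α (Fin.toℕ k)) (Finₚ.toℕ-fromℕ< (m%n<n (proj₁ d) N)) ⟨
          pow (pow α 4) (Fin.toℕ s) * pow α (Fin.toℕ k)      ≡⟨ cong (_* pow α (Fin.toℕ k)) (pow-* α 4 (Fin.toℕ s)) ⟨
          pow α (4 ℕ.* Fin.toℕ s) * pow α (Fin.toℕ k)        ≡⟨ pow-+ α (4 ℕ.* Fin.toℕ s) (Fin.toℕ k) ⟨
          pow α (e s)                                        ∎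

    orbits : OrbitDescription F E emb α p h K
    orbits =
        orbit-p
      , orbit-plane
      , (λ P P∈h → plane-card (λ P′ P′≢0 → orbit-plane P P′ P∈h P′≢0))
      , (λ k → point (Fin.toℕ k))
      , (λ k → point-nonzero (Fin.toℕ k) , point≁p (Fin.toℕ k) , point∉h (Fin.toℕ k))
      , points-sameOrbit⇒≡
      , points-cover
      , orbit-card

mainTheorem4 : (q : ℕ) → q % 4 ≡ 1 → q % 3 ≢ 1 →
    (F : FiniteField q) (E : FiniteField (q ^ 3)) (emb : Embedding F E) →
    (α : FiniteField.Carrier E) → Primitive E α →
    (p h : Geometry.W F E emb) →
    Geometry.NonzeroW F E emb p → Geometry.NonzeroW F E emb h →
    (K : Geometry.Klein F E emb p h) →
    OrbitDescription F E emb α p h K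
mainTheorem4 q q%4≡1 q%3≢1 F E emb α prim p h p≢0 _ K =
  KleinCorrespondence.Main.orbits F E emb α prim p h p≢0 K q%4≡1 q%3≢1
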